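{- Let $p$ be an odd prime, $m\ge 1$, $q=p^m$, let $\mathbb{F}_q$ be the field with $q$ elements, let $g$ be a generator of the cyclic group $\mathbb{F}_q^*$, and let $c\in\mathbb{F}_q$. For $n\ge 1$ let $N_n(c)=\#\{(x_1,\dots,x_n)\in\mathbb{F}_q^n : x_1^4+\cdots+x_n^4=c\}$. (i) Suppose $q\equiv 1\pmod 4$ and $c\in\mathbb{F}_q^*$. Define integers $s,t$ as follows: if $p\equiv 1\pmod 4$, then $s,t$ are the unique integers with $q=s^2+4t^2$, $\gcd(p,s)=1$, $s\equiv 1\pmod 4$ and $2t= s\,g^{3(q-1)/4}$ in $\mathbb{F}_q$ (i.e. $2t\equiv s g^{3(q-1)/4}\pmod p$); if $p\equiv 3\pmod 4$, then $s=(-p)^{m/2}$ and $t=0$. Define the polynomials $$B_1(c,x)=\begin{cases}3x-(6s+3)x^2+(-q+4s^2)x^3, & \operatorname{ind}_g(c)\equiv 0\pmod 4,\\ -x+(2s+8t-3)x^2+(-q-8st)x^3, & \operatorname{ind}_g(c)\equiv 1\pmod 4,\\ -x+(2s-3)x^2+(-q+16t^2)x^3, & \operatorname{ind}_g(c)\equiv 2\pmod 4,\\ -x+(2s-8t-3)x^2+(-q+8st)x^3, & \operatorname{ind}_g(c)\equiv 3\pmod 4,\end{cases}$$ $$B_2(c,x)=\begin{cases}3x+(2s+1)x^2+(3q-4s^2)x^3, & \operatorname{ind}_g(c)\equiv 0\pmod 4,\\ -x+(2s-8t+1)x^2+(3q+8st)x^3, & \operatorname{ind}_g(c)\equiv 1\pmod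 4,\\ -x+(-6s+1)x^2+(-5q-16t^2)x^3, & \operatorname{ind}_g(c)\equiv 2\pmod 4,\\ -x+(2s+8t+1)x^2+(3q-8st)x^3, & \operatorname{ind}_g(c)\equiv 3\pmod 4.\end{cases}$$ Then, as formal power series (equivalently, rational functions) in $x$, $$\sum_{n=1}^{\infty}N_n(c)x^n=\begin{cases}\dfrac{x}{1-qx}+\dfrac{6sx^3+(q-4s^2)x^4+B_1(c,x)}{1-6qx^2+8qsx^3+(q^2-4qs^2)x^4}, & q\equiv 1\pmod 8,\\[2ex] \dfrac{x}{1-qx}+\dfrac{6sx^3+(9q-4s^2)x^4+B_2(c,x)}{1+2qx^2+8qsx^3+(9q^2-4qs^2)x^4}, & q\equiv 5\pmod 8.\end{cases}$$ (ii) Suppose $q\equiv 3\pmod 4$. Then $$\sum_{n=1}^{\infty}N_n(c)x^n=\begin{cases}\dfrac{x}{1-qx}+\dfrac{(1-q)x^2}{1+qx^2}, & c=0,\\[1.5ex] \dfrac{x}{1-qx}+\dfrac{x+x^2}{1+qx^2}, & c\neq 0 \text{ is a square in } \mathbb{F}_q,\\[1.5ex] \dfrac{x}{1-qx}+\dfrac{ -x+x^2}{1+qx^2}, & c \text{ is a non-square in } \mathbb{F}_q.\end{cases}$$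
   Context: For $c\in\mathbb{F}_q^*$, $\operatorname{ind}_g(c)$ denotes the discrete logarithm of $c$ to base $g$, i.e. the integer $i\in\{0,\dots,q-2\}$ with $g^i=c$. Integers are mapped into $\mathbb{F}_q$ via the prime subfield. -}

module Defs where

open import Level using (Level; _⊔_) renaming (suc to lsuc)
open import Algebra.Bundles using (CommutativeRing)
open import Data.Nat as ℕ using (ℕ; zero; suc)
open import Data.Integer as ℤ using (ℤ; +_; -[1+_]; 0ℤ; 1ℤ)
open import Data.Fin using (Fin)
open import Data.Vec using (Vec; []; _∷_)
open import Data.List using (List; []; _∷_; [_]; map; concatMap; allFin; filter; length; zipWith; foldr)
open import Data.Product using (∃; _×_)
open import Data.Nat.GCD using (gcd)
open import Data.Integer.Divisibility using () renaming (_∣_ to _∣ℤ_)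
open import Relation.Nullary using (¬_; yes; no)
open import Relation.Binary using (Decidable)
open import Relation.Binary.PropositionalEquality using (_≡_)

-- Finite fields.  A field is a commutative ring with 0 ≠ 1 in which every
-- nonzero element has a multiplicative inverse.  We also require decidable
-- equality (automatic for finite fields) and an enumeration of the carrier
-- as Fin size, bijective up to the ring's equality _≈_.

record FiniteField (c ℓ : Level) : Set (lsuc (c ⊔ ℓ)) where
  field
    cring : CommutativeRing c ℓ
  open CommutativeRing cring public
  field
    0≉1       : ¬ (0# ≈ 1#)
    inverse   : ∀ x → ¬ (x ≈ 0#) → ∃ λ y → x * y ≈ 1#
    _≟_       : Decidable _≈_
    size      : ℕ
    enum      : Fin size → Carrier
    enum-surj : ∀ x → ∃ λ i → enum i ≈ x
    enum-inj  : ∀ i j → enum i ≈ enum j → i ≡ j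

module _ {c ℓ : Level} (F : FiniteField c ℓ) where
  open FiniteField F

  pow : Carrier → ℕ → Carrier
  pow x zero    = 1#
  pow x (suc n) = x * pow x n

  ℕtoF : ℕ → Carrier
  ℕtoF zero    = 0#
  ℕtoF (suc n) = 1# + ℕtoF n

  ℤtoF : ℤ → Carrier
  ℤtoF (+ n)      = ℕtoF n
  ℤtoF -[1+ n ]   = - ℕtoF (suc n)

  IsGenerator : Carrier → Set (c ⊔ ℓ)
  IsGenerator g = ¬ (g ≈ 0#) × (∀ x → ¬ (x ≈ 0#) → ∃ λ i → pow g i ≈ x)

  IsSquare : Carrier → Set (c ⊔ ℓ)
  IsSquare x = ∃ λ y → y * y ≈ x

  -- ind_g(x): the least i ∈ {0,…,q-2} with g^i = x (0 if there is none,
  -- which does not happen for a generator g and x ≠ 0)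
  indFrom : Carrier → Carrier → ℕ → ℕ → ℕ
  indFrom g x i zero = 0
  indFrom g x i (suc k) with pow g i ≟ x
  ... | yes _ = i
  ... | no  _ = indFrom g x (suc i) k

  ind : Carrier → Carrier → ℕ
  ind g x = indFrom g x 0 (size ℕ.∸ 1)

  tuples : (n : ℕ) → List (Vec (Fin size) n)
  tuples zero    = [ [] ]
  tuples (suc n) = concatMap (λ i → map (i ∷_) (tuples n)) (allFin size)

  sumPow4 : ∀ {n} → Vec (Fin size) n → Carrier
  sumPow4 []       = 0#
  sumPow4 (i ∷ xs) = pow (enum i) 4 + sumPow4 xs

  N : ℕ → Carrier → ℕ
  N n x = length (filter (λ v → sumPow4 v ≟ x) (tuples n))

  genSeries : Carrier → ℕ → ℤ
  genSeries x zero    = 0ℤ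
  genSeries x (suc n) = + N (suc n) x

  STSpec : (p m : ℕ) (g : Carrier) (s t : ℤ) → Set ℓ
  STSpec p m g s t =
    (p ℕ.% 4 ≡ 1 →
        (+ (p ℕ.^ m) ≡ s ℤ.* s ℤ.+ + 4 ℤ.* (t ℤ.* t))
      × (gcd p ℤ.∣ s ∣ ≡ 1)
      × (+ 4 ∣ℤ (s ℤ.- + 1))
      × (ℤtoF (+ 2 ℤ.* t) ≈ ℤtoF s * pow g ((3 ℕ.* (p ℕ.^ m ℕ.∸ 1)) ℕ./ 4)))
    × (p ℕ.% 4 ≡ 3 → (s ≡ (ℤ.- (+ p)) ℤ.^ (m ℕ./ 2)) × (t ≡ 0ℤ))

-- Formal power series over ℤ (coefficient sequences) and polynomials
-- (coefficient lists, constant term first).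

Series : Set
Series = ℕ → ℤ

Poly : Set
Poly = List ℤ

_⊕_ : Series → Series → Series
(f ⊕ g) n = f n ℤ.+ g n

_+ₚ_ : Poly → Poly → Poly
[]       +ₚ b        = b
(a ∷ as) +ₚ []       = a ∷ as
(a ∷ as) +ₚ (b ∷ bs) = (a ℤ.+ b) ∷ (as +ₚ bs)

_⊛_ : Poly → Series → Series
([]     ⊛ f) n       = 0ℤ
((a ∷ as) ⊛ f) zero    = a ℤ.* f zero
((a ∷ as) ⊛ f) (suc n) = a ℤ.* f (suc n) ℤ.+ (as ⊛ f) n

sumℤ : List ℤ → ℤ
sumℤ = foldr ℤ._+_ 0ℤ

-- Coefficients of 1/D for a polynomial D = 1 + d_1 x + d_2 x^2 + …
-- (constant term 1; the constant term of the list is not used).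
-- invRev D k = [e_k, e_{k-1}, …, e_0] where ∑ e_k x^k = 1/D, i.e.
-- e_0 = 1 and e_k = - ∑_{j=1}^{k} d_j e_{k-j}.
invRev : Poly → ℕ → List ℤ
invRev D zero    = [ 1ℤ ]
invRev D (suc k) = (ℤ.- sumℤ (zipWith ℤ._*_ (tail D) (invRev D k))) ∷ invRev D k
  where
  tail : Poly → Poly
  tail []       = []
  tail (_ ∷ xs) = xs

head0 : List ℤ → ℤ
head0 []      = 0ℤ
head0 (x ∷ _) = x

inv : Poly → Series
inv D k = head0 (invRev D k)

-- the rational function A / D as a formal power series (D(0) = 1)
_⁄_ : Poly → Poly → Series
A ⁄ D = A ⊛ inv D

infixl 6 _⊕_
infix 7 _⁄_

-- B_1(c,x) and B_2(c,x) as coefficient lists; r = ind_g(c) mod 4.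
B₁ : ℕ → ℤ → ℤ → ℤ → Poly
B₁ 0 q s t = 0ℤ ∷ + 3 ∷ ℤ.- (+ 6 ℤ.* s ℤ.+ + 3) ∷ (ℤ.- q ℤ.+ + 4 ℤ.* s ℤ.* s) ∷ []
B₁ 1 q s t = 0ℤ ∷ ℤ.- + 1 ∷ (+ 2 ℤ.* s ℤ.+ + 8 ℤ.* t ℤ.- + 3) ∷ (ℤ.- q ℤ.- + 8 ℤ.* s ℤ.* t) ∷ []
B₁ 2 q s t = 0ℤ ∷ ℤ.- + 1 ∷ (+ 2 ℤ.* s ℤ.- + 3) ∷ (ℤ.- q ℤ.+ + 16 ℤ.* t ℤ.* t) ∷ []
B₁ _ q s t = 0ℤ ∷ ℤ.- + 1 ∷ (+ 2 ℤ.* s ℤ.- + 8 ℤ.* t ℤ.- + 3) ∷ (ℤ.- q ℤ.+ + 8 ℤ.* s ℤ.* t) ∷ []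

B₂ : ℕ → ℤ → ℤ → ℤ → Poly
B₂ 0 q s t = 0ℤ ∷ + 3 ∷ (+ 2 ℤ.* s ℤ.+ + 1) ∷ (+ 3 ℤ.* q ℤ.- + 4 ℤ.* s ℤ.* s) ∷ []
B₂ 1 q s t = 0ℤ ∷ ℤ.- + 1 ∷ (+ 2 ℤ.* s ℤ.- + 8 ℤ.* t ℤ.+ + 1) ∷ (+ 3 ℤ.* q ℤ.+ + 8 ℤ.* s ℤ.* t) ∷ []
B₂ 2 q s t = 0ℤ ∷ ℤ.- + 1 ∷ (ℤ.- (+ 6) ℤ.* s ℤ.+ + 1) ∷ (ℤ.- (+ 5) ℤ.* q ℤ.- + 16 ℤ.* t ℤ.* t) ∷ []
B₂ _ q s t = 0ℤ ∷ ℤ.- + 1 ∷ (+ 2 ℤ.* s ℤ.+ + 8 ℤ.* t ℤ.+ + 1) ∷ (+ 3 ℤ.* q ℤ.- + 8 ℤ.* s ℤ.* t) ∷ []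

geomPart : ℤ → Series
geomPart q = (0ℤ ∷ 1ℤ ∷ []) ⁄ (1ℤ ∷ ℤ.- q ∷ [])

series1mod8 : ℕ → ℤ → ℤ → ℤ → Series
series1mod8 r q s t =
  geomPart q ⊕
  ((0ℤ ∷ 0ℤ ∷ 0ℤ ∷ + 6 ℤ.* s ∷ (q ℤ.- + 4 ℤ.* s ℤ.* s) ∷ []) +ₚ B₁ r q s t)
    ⁄ (1ℤ ∷ 0ℤ ∷ ℤ.- (+ 6 ℤ.* q) ∷ + 8 ℤ.* q ℤ.* s ∷ (q ℤ.* q ℤ.- + 4 ℤ.* q ℤ.* s ℤ.* s) ∷ [])

series5mod8 : ℕ → ℤ → ℤ → ℤ → Series
series5mod8 r q s t =
  geomPart q ⊕
  ((0ℤ ∷ 0ℤ ∷ 0ℤ ∷ + 6 ℤ.* s ∷ (+ 9 ℤ.* q ℤ.- + 4 ℤ.* s ℤ.* s) ∷ []) +ₚ B₂ r q s t)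
    ⁄ (1ℤ ∷ 0ℤ ∷ + 2 ℤ.* q ∷ + 8 ℤ.* q ℤ.* s ∷ (+ 9 ℤ.* q ℤ.* q ℤ.- + 4 ℤ.* q ℤ.* s ℤ.* s) ∷ [])

series3mod4 : ℤ → ℤ → ℤ → Series
series3mod4 q a b = geomPart q ⊕ (0ℤ ∷ a ∷ b ∷ []) ⁄ (1ℤ ∷ 0ℤ ∷ q ∷ [])

{-# OPTIONS --safe #-}

-- On integer-valued functions on F, N_n is the n-fold convolution power of r(a) = #{y : y⁴ = a}.
--
-- If q ≡ 1 (mod 4), write ρ for the quadratic character and χ = α + β i for the quartic character
-- with χ(g) = i.  Then r = 1 + h with h = ρ + 2α of sum zero, so N_n = qⁿ⁻¹ + hⁿ.  Convolution by h
-- preserves the span of E = q δ₀ - 1, ρ, α, β, and the matrix of this map depends only on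
-- ε = χ(-1) and on the Jacobi sum A + B i = J(ρ, χ), whose norm is q by associativity; the
-- characteristic polynomial of the matrix is the denominator of the generating function.
--
-- It remains to see that A = -ε s and B = 2 ε t.  Counting N_2 modulo 16 gives A modulo 4.  If
-- p ≡ 3 (mod 4), then p is inert in ℤ[i] and B = 0.  If p ≡ 1 (mod 4), reduce J to F, where χ
-- becomes x ↦ x^((q-1)/4): power sums show that A + B g^((q-1)/4) vanishes in F while the conjugate
-- expression is, up to sign, the binomial coefficient ((q-1)/2 choose (q-1)/4), which p does not
-- divide; these conditions single out one representation of q as a sum of two squares.
--
-- If q ≡ 3 (mod 4), fourth powers are equidistributed with squares, so h = ρ, and ρ ⋆ ρ = -E.

module Submission where

open import Defs
open import Algebra.Bundles using (CommutativeRing)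
import Algebra.Properties.Ring as RingProperties
import Algebra.Properties.Semiring.Sum as SumProperties
open import Data.Empty using (⊥; ⊥-elim)
open import Data.Fin using (Fin; zero; suc; toℕ; fromℕ<)
open import Data.Fin.Permutation using (permutation)
open import Data.Fin.Properties using (toℕ-fromℕ<; fromℕ<-injective; toℕ<n; toℕ-injective; injective⇒≤; pigeonhole)
open import Data.Integer as ℤ using (ℤ; +_; -[1+_]; 0ℤ; 1ℤ; -1ℤ; ∣_∣)
-- In the modules over F, the unqualified ring operations are those of F.
open import Data.Integer using () renaming (_+_ to _∔_; _*_ to _·_; -_ to ⊝_; _-_ to _⊟_)
import Data.Integer.Divisibility.Signed as Signed
import Data.Integer.Properties as ℤ
open import Data.Integer.Tactic.RingSolver using (solve-∀)
open import Data.List using (List; []; _∷_; _++_; map; concatMap; tabulate; filter; length; zipWith)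
open import Data.List.Properties using (filter-++; length-++)
open import Data.Nat as ℕ using (ℕ; zero; suc; NonZero; z≤n; s≤s; _!; _%_; _/_)
open import Data.Nat.Combinatorics using (_C_; nCk≡n!/k![n-k]!; k![n∸k]!∣n!; nCk+nC[k+1]≡[n+1]C[k+1])
open import Data.Nat.Coprimality using (Coprime; coprime-Bézout; gcd≡1⇒coprime)
open import Data.Nat.DivMod using (m≡m%n+[m/n]*n; m%n<n; m/n*n≡m; m*n/n≡m; %-distribˡ-*; [m+kn]%n≡m%n)
open import Data.Nat.Divisibility using (_∣_; _∤_; divides; ∣-trans; ∣m+n∣m⇒∣n; m∣m*n; n∣m*n; ∣m⇒∣m*n; ∣n⇒∣m*n; ∣⇒≤; *-cancelˡ-∣; *-monoʳ-∣; _∣?_; 1∣_; ∣m∣n⇒∣m+n)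
open import Data.Nat.GCD using (module Bézout)
open import Data.Nat.Induction using (<-rec)
open import Data.Nat.Primality using (Prime; euclidsLemma; prime⇒nonZero; prime⇒nonTrivial; prime⇒irreducible)
import Data.Nat.Properties as ℕ
import Data.Nat.Tactic.RingSolver as ℕ-Solver
open import Data.Product using (∃; _×_; _,_; proj₁; proj₂)
open import Data.Sum using (_⊎_; inj₁; inj₂; [_,_]′)
open import Data.Vec using (_∷_)
open import Function using (_∘_)
open import Relation.Binary.Definitions using (tri<; tri≈; tri>)
open import Relation.Binary.PropositionalEquality as ≡ using (_≡_; _≗_; cong; cong₂; subst; module ≡-Reasoning)
import Relation.Binary.Reasoning.Setoid as SetoidReasoning
open import Relation.Nullary using (¬_; Dec; yes; no)
open import Relation.Unary using (Decidable)

-- Everything is done with integers: χ is never formed, only its two components, and i survives as a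
-- pair of integers or as a square root of -1 in `F`. Using `E` in place of `δ` keeps every function
-- sum-zero, so `E` acts as the scalar q, and a constant value off 0 is forced by the value at 0.
-- The classical J(χ, χ) = χ(-1) J(ρ, χ) is not proved by a change of variables but by comparing two
-- bracketings of a triple convolution at 0. The delicate point is to match J with the prescribed s
-- and t, signs included. The residue modulo 4 settles the sign of s. For p ≡ 1 (mod 4), `F` has two
-- square roots of -1, hence ℤ[i] has two reductions; J vanishes under one and not under the other.
-- This excludes representations of q divisible by p, and it fixes the sign of t by the very
-- congruence that t satisfies. The recurrences become polynomial identities only when q is replaced
-- by s² + 4t², so `norm-ℤ s t` stands for q in them, and q is restored at the end.

-- Power series: clearing denominators.

module PowerSeries where
  open import Data.Integer using (-_; _+_; _*_; _-_; _^_)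
  open ≡ using (sym; trans; refl)
  open ≡-Reasoning
  open import Algebra.Properties.AbelianGroup ℤ.+-0-abelianGroup using () renaming (∙-cancelʳ to +-cancelʳ)

  coeff : Poly → Series
  coeff []       n       = 0ℤ
  coeff (a ∷ as) zero    = a
  coeff (a ∷ as) (suc n) = coeff as n

  shift : Series → Series
  shift f zero    = 0ℤ
  shift f (suc n) = f n

  -- Trades the split on `n` in `_⊛_` for a shift, so that products can be compared for all
  -- coefficients at once.
  ∷-⊛ : ∀ a as f n → ((a ∷ as) ⊛ f) n ≡ a * f n + shift (as ⊛ f) n
  ∷-⊛ a as f zero    = sym (ℤ.+-identityʳ _)
  ∷-⊛ a as f (suc n) = refl

  ⊛-cong-≤ : ∀ A {f g : Series} n → (∀ k → k ℕ.≤ n → f k ≡ g k) → (A ⊛ f) n ≡ (A ⊛ g) n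
  ⊛-cong-≤ []       n       eq = refl
  ⊛-cong-≤ (a ∷ as) zero    eq = cong (a *_) (eq 0 z≤n)
  ⊛-cong-≤ (a ∷ as) (suc n) eq = cong₂ _+_ (cong (a *_) (eq (suc n) ℕ.≤-refl))
    (⊛-cong-≤ as n (λ k k≤n → eq k (ℕ.m≤n⇒m≤1+n k≤n)))

  ⊛-cong : ∀ A {f g : Series} → f ≗ g → (A ⊛ f) ≗ (A ⊛ g)
  ⊛-cong A eq n = ⊛-cong-≤ A n (λ k _ → eq k)

  ⊛-zero : ∀ A n → (A ⊛ (λ _ → 0ℤ)) n ≡ 0ℤ
  ⊛-zero []       n       = refl
  ⊛-zero (a ∷ as) zero    = ℤ.*-zeroʳ a
  ⊛-zero (a ∷ as) (suc n) = cong₂ _+_ (ℤ.*-zeroʳ a) (⊛-zero as n)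

  ⊛-linear : ∀ A c f g n → (A ⊛ (λ k → c * f k + g k)) n ≡ c * (A ⊛ f) n + (A ⊛ g) n
  ⊛-linear []       c f g n       = sym (cong (_+ 0ℤ) (ℤ.*-zeroʳ c))
  ⊛-linear (a ∷ as) c f g zero    = lem a c (f 0) (g 0)
    where
    lem : ∀ a c x y → a * (c * x + y) ≡ c * (a * x) + a * y
    lem = solve-∀
  ⊛-linear (a ∷ as) c f g (suc n) = trans (cong (_+_ (a * (c * f (suc n) + g (suc n)))) (⊛-linear as c f g n))
    (lem a c (f (suc n)) (g (suc n)) ((as ⊛ f) n) ((as ⊛ g) n))
    where
    lem : ∀ a c x y u v → a * (c * x + y) + (c * u + v) ≡ c * (a * x + u) + (a * y + v)
    lem = solve-∀

  ⊛-shift : ∀ A f → (A ⊛ shift f) ≗ shift (A ⊛ f)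
  ⊛-shift []       f zero          = refl
  ⊛-shift []       f (suc n)       = refl
  ⊛-shift (a ∷ as) f zero          = ℤ.*-zeroʳ a
  ⊛-shift (a ∷ as) f (suc zero)    = trans (cong (_+_ (a * f 0)) (⊛-shift as f 0)) (ℤ.+-identityʳ _)
  ⊛-shift (a ∷ as) f (suc (suc n)) = cong (_+_ (a * f (suc n))) (⊛-shift as f (suc n))

  -- Multiplication by a polynomial is linear and commutes with `shift`, hence with every other such
  -- multiplication. This lets a denominator pass the numerator and meet its own inverse.
  ⊛-comm : ∀ D A f → (D ⊛ (A ⊛ f)) ≗ (A ⊛ (D ⊛ f))
  ⊛-comm []       A f n = sym (⊛-zero A n)
  ⊛-comm (d ∷ ds) A f n = begin
    ((d ∷ ds) ⊛ (A ⊛ f)) n  ≡⟨ ∷-⊛ d ds (A ⊛ f) n ⟩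
    d * (A ⊛ f) n + shift (ds ⊛ (A ⊛ f)) n  ≡⟨ cong (_+_ (d * (A ⊛ f) n)) (shift-cong (⊛-comm ds A f) n) ⟩
    d * (A ⊛ f) n + shift (A ⊛ (ds ⊛ f)) n  ≡⟨ cong (_+_ (d * (A ⊛ f) n)) (⊛-shift A (ds ⊛ f) n) ⟨
    d * (A ⊛ f) n + (A ⊛ shift (ds ⊛ f)) n  ≡⟨ ⊛-linear A d f (shift (ds ⊛ f)) n ⟨
    (A ⊛ (λ k → d * f k + shift (ds ⊛ f) k)) n  ≡⟨ ⊛-cong A (∷-⊛ d ds f) n ⟨
    (A ⊛ ((d ∷ ds) ⊛ f)) n  ∎
    where
    open ≡-Reasoning
    shift-cong : ∀ {f g : Series} → f ≗ g → shift f ≗ shift g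
    shift-cong eq zero    = refl
    shift-cong eq (suc n) = eq n

  -- `invRev` lists coefficients in descending order, so zipping with the ascending `ds` pairs
  -- degrees of constant sum, and `zipWith` truncates exactly where `_⊛_` stops.
  invRev-⊛ : ∀ D ds k → sumℤ (zipWith _*_ ds (invRev D k)) ≡ (ds ⊛ inv D) k
  invRev-⊛ D []       zero    = refl
  invRev-⊛ D []       (suc k) = refl
  invRev-⊛ D (d ∷ ds) zero    = trans (cong (λ z → d * 1ℤ + sumℤ z) (zipWith-[] ds)) (ℤ.+-identityʳ _)
    where
    zipWith-[] : ∀ (ds : List ℤ) → zipWith _*_ ds [] ≡ []
    zipWith-[] []       = refl
    zipWith-[] (_ ∷ _) = refl
  invRev-⊛ D (d ∷ ds) (suc k) = cong (_+_ (d * inv D (suc k))) (invRev-⊛ D ds k)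

  ⊛-inv : ∀ ds → ((1ℤ ∷ ds) ⊛ inv (1ℤ ∷ ds)) ≗ coeff (1ℤ ∷ [])
  ⊛-inv ds zero    = refl
  ⊛-inv ds (suc k) = trans
    (cong (λ z → 1ℤ * (- z) + (ds ⊛ inv D) k) (invRev-⊛ D ds k))
    (lem ((ds ⊛ inv D) k))
    where
    D = 1ℤ ∷ ds
    lem : ∀ x → 1ℤ * (- x) + x ≡ 0ℤ
    lem = solve-∀

  ⊛-one : ∀ A → (A ⊛ coeff (1ℤ ∷ [])) ≗ coeff A
  ⊛-one []       n       = refl
  ⊛-one (a ∷ as) zero    = ℤ.*-identityʳ a
  ⊛-one (a ∷ as) (suc n) = trans (cong₂ _+_ (ℤ.*-zeroʳ a) (⊛-one as n)) (ℤ.+-identityˡ _)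

  -- The constant term 1 isolates the coefficient in degree n + 1 once all lower ones agree.
  ⊛-injective : ∀ ds {f g : Series} → ((1ℤ ∷ ds) ⊛ f) ≗ ((1ℤ ∷ ds) ⊛ g) → f ≗ g
  ⊛-injective ds {f} {g} eq n = below n n ℕ.≤-refl
    where
    below : ∀ n k → k ℕ.≤ n → f k ≡ g k
    below zero    zero z≤n = trans (sym (ℤ.*-identityˡ _)) (trans (eq 0) (ℤ.*-identityˡ _))
    below (suc n) k    k≤n = [ (λ { (s≤s k≤n′) → below n k k≤n′ })
                             , (λ k≡ → subst (λ j → f j ≡ g j) (sym k≡) top) ]′ (ℕ.m≤n⇒m<n∨m≡n k≤n)
      where
      top : f (suc n) ≡ g (suc n)
      top = trans (sym (ℤ.*-identityˡ _)) (trans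
        (+-cancelʳ ((ds ⊛ f) n) _ _ (trans (eq (suc n)) (cong (_+_ (1ℤ * g (suc n))) (sym (⊛-cong-≤ ds n (below n))))))
        (ℤ.*-identityˡ _))

  -- A fraction is recognised by clearing its denominator; every generating function below is
  -- identified in this way.
  ⁄-unique : ∀ A ds {f : Series} → ((1ℤ ∷ ds) ⊛ f) ≗ coeff A → f ≗ A ⁄ (1ℤ ∷ ds)
  ⁄-unique A ds {f} eq = ⊛-injective ds λ n → trans (eq n) (sym (begin
    (D ⊛ (A ⊛ inv D)) n  ≡⟨ ⊛-comm D A (inv D) n ⟩
    (A ⊛ (D ⊛ inv D)) n  ≡⟨ ⊛-cong A (⊛-inv ds) n ⟩
    (A ⊛ coeff (1ℤ ∷ [])) n  ≡⟨ ⊛-one A n ⟩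
    coeff A n  ∎))
    where
    open ≡-Reasoning
    D = 1ℤ ∷ ds

  geomPart-suc : ∀ q → shift (q ^_) ≗ geomPart q
  geomPart-suc q = ⁄-unique (0ℤ ∷ 1ℤ ∷ []) (- q ∷ []) eqs
    where
    lem₁ : ∀ q → 1ℤ * 1ℤ + (- q * 0ℤ) ≡ 1ℤ
    lem₁ = solve-∀
    lem₂ : ∀ q x → 1ℤ * (q * x) + (- q * x + 0ℤ) ≡ 0ℤ
    lem₂ = solve-∀
    eqs : ((1ℤ ∷ - q ∷ []) ⊛ shift (q ^_)) ≗ coeff (0ℤ ∷ 1ℤ ∷ [])
    eqs zero          = refl
    eqs (suc zero)    = lem₁ q
    eqs (suc (suc n)) = lem₂ q (q ^ n)

-- The quadratic and quartic characters as periodic tables of exponents.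

module Tables where
  open import Data.Integer using (_+_; _*_; -_; _-_)

  -- cosℕ n + sinℕ n i = iⁿ
  signℕ cosℕ sinℕ : ℕ → ℤ
  signℕ zero          = 1ℤ
  signℕ (suc n)       = - signℕ n
  cosℕ zero           = 1ℤ
  cosℕ (suc zero)     = 0ℤ
  cosℕ (suc (suc n))  = - cosℕ n
  sinℕ zero           = 0ℤ
  sinℕ (suc zero)     = 1ℤ
  sinℕ (suc (suc n))  = - sinℕ n

  sign-+ : ∀ m n → signℕ (m ℕ.+ n) ≡ signℕ m * signℕ n
  sign-+ zero    n = ≡.sym (ℤ.*-identityˡ _)
  sign-+ (suc m) n = ≡.trans (cong -_ (sign-+ m n)) (ℤ.neg-distribˡ-* (signℕ m) (signℕ n))

  cos-suc : ∀ n → cosℕ (suc n) ≡ - sinℕ n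
  cos-suc zero          = ≡.refl
  cos-suc (suc zero)    = ≡.refl
  cos-suc (suc (suc n)) = cong -_ (cos-suc n)

  sin-suc : ∀ n → sinℕ (suc n) ≡ cosℕ n
  sin-suc zero          = ≡.refl
  sin-suc (suc zero)    = ≡.refl
  sin-suc (suc (suc n)) = cong -_ (sin-suc n)

  cos-+ : ∀ m n → cosℕ (m ℕ.+ n) ≡ cosℕ m * cosℕ n - sinℕ m * sinℕ n
  sin-+ : ∀ m n → sinℕ (m ℕ.+ n) ≡ cosℕ m * sinℕ n + sinℕ m * cosℕ n
  cos-+ zero    n = lem (cosℕ n) (sinℕ n)
    where
    lem : ∀ x y → x ≡ 1ℤ * x - 0ℤ * y
    lem = solve-∀
  cos-+ (suc m) n = begin
    cosℕ (suc (m ℕ.+ n))  ≡⟨ cos-suc (m ℕ.+ n) ⟩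
    - sinℕ (m ℕ.+ n)  ≡⟨ cong -_ (sin-+ m n) ⟩
    - (cosℕ m * sinℕ n + sinℕ m * cosℕ n)  ≡⟨ lem (cosℕ m) (sinℕ m) (cosℕ n) (sinℕ n) ⟩
    - sinℕ m * cosℕ n - cosℕ m * sinℕ n  ≡⟨ cong₂ (λ u v → u * cosℕ n - v * sinℕ n) (cos-suc m) (sin-suc m) ⟨
    cosℕ (suc m) * cosℕ n - sinℕ (suc m) * sinℕ n  ∎
    where
    open ≡-Reasoning
    lem : ∀ a b c d → - (a * d + b * c) ≡ - b * c - a * d
    lem = solve-∀
  sin-+ zero    n = lem (cosℕ n) (sinℕ n)
    where
    lem : ∀ x y → y ≡ 1ℤ * y + 0ℤ * x
    lem = solve-∀
  sin-+ (suc m) n = begin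
    sinℕ (suc (m ℕ.+ n))  ≡⟨ sin-suc (m ℕ.+ n) ⟩
    cosℕ (m ℕ.+ n)  ≡⟨ cos-+ m n ⟩
    cosℕ m * cosℕ n - sinℕ m * sinℕ n  ≡⟨ lem (cosℕ m) (sinℕ m) (cosℕ n) (sinℕ n) ⟩
    - sinℕ m * sinℕ n + cosℕ m * cosℕ n  ≡⟨ cong₂ (λ u v → u * sinℕ n + v * cosℕ n) (cos-suc m) (sin-suc m) ⟨
    cosℕ (suc m) * sinℕ n + sinℕ (suc m) * cosℕ n  ∎
    where
    open ≡-Reasoning
    lem : ∀ a b c d → a * c - b * d ≡ - b * d + a * c
    lem = solve-∀

  -- Any identity between the three tables need only be checked on one period.
  mod4-induction : ∀ {p} (P : ℤ → ℤ → ℤ → Set p) → P 1ℤ 1ℤ 0ℤ → P -1ℤ 0ℤ 1ℤ → P 1ℤ -1ℤ 0ℤ → P -1ℤ 0ℤ -1ℤ →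
    ∀ n → P (signℕ n) (cosℕ n) (sinℕ n)
  mod4-induction P p₀ p₁ p₂ p₃ 0 = p₀
  mod4-induction P p₀ p₁ p₂ p₃ 1 = p₁
  mod4-induction P p₀ p₁ p₂ p₃ 2 = p₂
  mod4-induction P p₀ p₁ p₂ p₃ 3 = p₃
  mod4-induction P p₀ p₁ p₂ p₃ (suc (suc (suc (suc n))))
    rewrite ℤ.neg-involutive (signℕ n) | ℤ.neg-involutive (signℕ n) | ℤ.neg-involutive (cosℕ n) | ℤ.neg-involutive (sinℕ n)
    = mod4-induction P p₀ p₁ p₂ p₃ n

  sign² : ∀ n → signℕ n * signℕ n ≡ 1ℤ
  sign² = mod4-induction (λ s c d → s * s ≡ 1ℤ) ≡.refl ≡.refl ≡.refl ≡.refl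

  sign-2*k : ∀ k n → signℕ (k ℕ.* 2 ℕ.+ n) ≡ signℕ n
  sign-2*k zero    n = ≡.refl
  sign-2*k (suc k) n = ≡.trans (ℤ.neg-involutive _) (sign-2*k k n)

  cos-4*k : ∀ k n → cosℕ (k ℕ.* 4 ℕ.+ n) ≡ cosℕ n
  cos-4*k zero    n = ≡.refl
  cos-4*k (suc k) n = ≡.trans (ℤ.neg-involutive _) (cos-4*k k n)

  sin-4*k : ∀ k n → sinℕ (k ℕ.* 4 ℕ.+ n) ≡ sinℕ n
  sin-4*k zero    n = ≡.refl
  sin-4*k (suc k) n = ≡.trans (ℤ.neg-involutive _) (sin-4*k k n)

  cos-k*2 : ∀ k → cosℕ (k ℕ.* 2) ≡ signℕ k
  cos-k*2 zero    = ≡.refl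
  cos-k*2 (suc k) = cong ⊝_ (cos-k*2 k)

  sin-k*2 : ∀ k → sinℕ (k ℕ.* 2) ≡ 0ℤ
  sin-k*2 zero    = ≡.refl
  sin-k*2 (suc k) = cong ⊝_ (sin-k*2 k)

  fourthℕ : ℕ → ℤ
  fourthℕ 0 = 1ℤ
  fourthℕ 1 = 0ℤ
  fourthℕ 2 = 0ℤ
  fourthℕ 3 = 0ℤ
  fourthℕ (suc (suc (suc (suc n)))) = fourthℕ n

  fourth-4*k : ∀ k n → fourthℕ (k ℕ.* 4 ℕ.+ n) ≡ fourthℕ n
  fourth-4*k zero    n = ≡.refl
  fourth-4*k (suc k) n = fourth-4*k k n

  -- Orthogonality on ℤ/4: 1 + iⁿ + (-1)ⁿ + (-i)ⁿ is 4 or 0. The outer 1ℤ and 0ℤ fit the shapes of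
  -- `one+ h` and of 4 `κ` + `δ`.
  fourth-tables : ∀ n → 1ℤ · (+ 2 · cosℕ n ∔ signℕ n) ∔ 1ℤ ≡ + 4 · fourthℕ n ∔ 0ℤ
  fourth-tables 0 = ≡.refl
  fourth-tables 1 = ≡.refl
  fourth-tables 2 = ≡.refl
  fourth-tables 3 = ≡.refl
  fourth-tables (suc (suc (suc (suc n))))
    rewrite ℤ.neg-involutive (signℕ n) | ℤ.neg-involutive (signℕ n) | ℤ.neg-involutive (cosℕ n) = fourth-tables n

open Tables

-- The recursion of order four and its generating functions.

module Recursion where
  open PowerSeries
  open import Data.Integer using (-_; _+_; _*_; _-_)
  open import Data.Integer.Solver using (module +-*-Solver)
  open +-*-Solver
  open ≡ using (refl)

  record Coords (X : Set) : Set where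
    constructor ⟨_,_,_,_⟩
    field e r a b : X

  open Coords public

  -- Multiplication by ρ + 2α in the basis E, ρ, α, β, once the Jacobi sum is known to be -ε s + 2 ε t i.
  step : (ε q s t : ℤ) → Coords ℤ → Coords ℤ
  step ε q s t ⟨ e , r , a , b ⟩ =
    ⟨ r + ε * a
    , q * e - s * a + + 2 * t * b
    , + 2 * q * e - + 2 * ε * s * r - ε * s * a + + 2 * ε * t * b
    , + 4 * ε * t * r + + 2 * ε * t * a + ε * s * b ⟩

  -- The start is ρ + 2 α, so entry n belongs to its (n + 1)-fold convolution power.
  coords : (ε q s t : ℤ) → ℕ → Coords ℤ
  coords ε q s t zero    = ⟨ 0ℤ , 1ℤ , + 2 , 0ℤ ⟩
  coords ε q s t (suc n) = step ε q s t (coords ε q s t n)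

  -- Evaluation at gⁱ, where E is -1 and ρ, α, β are given by the three tables.
  value : ℕ → Coords ℤ → ℤ
  value i ⟨ e , r , a , b ⟩ = - e + signℕ i * r + cosℕ i * a + sinℕ i * b

  -- The same functions in the syntax of the ring solver.
  module _ {k : ℕ} where
    private P = Polynomial k

    stepₚ : (ε q s t : P) → Coords P → Coords P
    stepₚ ε q s t ⟨ e , r , a , b ⟩ =
      ⟨ r :+ ε :* a
      , q :* e :- s :* a :+ con (+ 2) :* t :* b
      , con (+ 2) :* q :* e :- con (+ 2) :* ε :* s :* r :- ε :* s :* a :+ con (+ 2) :* ε :* t :* b
      , con (+ 4) :* ε :* t :* r :+ con (+ 2) :* ε :* t :* a :+ ε :* s :* b ⟩

    coordsₚ : Coords P → (ε q s t : P) → ℕ → Coords P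
    coordsₚ v ε q s t zero    = v
    coordsₚ v ε q s t (suc n) = stepₚ ε q s t (coordsₚ v ε q s t n)

    start : Coords P
    start = ⟨ con 0ℤ , con 1ℤ , con (+ 2) , con 0ℤ ⟩

    valueₚ : ℕ → Coords P → P
    valueₚ i ⟨ e , r , a , b ⟩ = :- e :+ con (signℕ i) :* r :+ con (cosℕ i) :* a :+ con (sinℕ i) :* b

    shiftₚ : (ℕ → P) → ℕ → P
    shiftₚ f zero    = con 0ℤ
    shiftₚ f (suc n) = f n

    _⊛ₚ_ : List P → (ℕ → P) → ℕ → P
    ([]     ⊛ₚ f) n         = con 0ℤ
    ((a ∷ as) ⊛ₚ f) zero    = a :* f zero
    ((a ∷ as) ⊛ₚ f) (suc n) = a :* f (suc n) :+ (as ⊛ₚ f) n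

    norm : P → P → P
    norm s t = s :* s :+ con (+ 4) :* (t :* t)

    D₁ D₂ : (q s : P) → List P
    D₁ q s = con 1ℤ ∷ con 0ℤ ∷ :- (con (+ 6) :* q) ∷ con (+ 8) :* q :* s
      ∷ (q :* q :- con (+ 4) :* q :* s :* s) ∷ []
    D₂ q s = con 1ℤ ∷ con 0ℤ ∷ con (+ 2) :* q ∷ con (+ 8) :* q :* s
      ∷ (con (+ 9) :* q :* q :- con (+ 4) :* q :* s :* s) ∷ []

    lhs : (D : (q s : P) → List P) → ℤ → ℕ → P → P → ℕ → P
    lhs D ε i s t = D (norm s t) s ⊛ₚ shiftₚ (λ n → valueₚ i (coordsₚ start (con ε) (norm s t) s t n))

    charPoly : (D : (q s : P) → List P) → ℤ → (Coords P → P) → (s t e r a b : P) → P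
    charPoly D ε f s t e r a b =
      (D (norm s t) s ⊛ₚ λ n → f (coordsₚ ⟨ e , r , a , b ⟩ (con ε) (norm s t) s t n)) 4

    :2 :3 :4 :6 :8 :16 : P
    :2 = con (+ 2)
    :3 = con (+ 3)
    :4 = con (+ 4)
    :6 = con (+ 6)
    :8 = con (+ 8)
    :16 = con (+ 16)

  norm-ℤ : ℤ → ℤ → ℤ
  norm-ℤ s t = s * s + + 4 * (t * t)

  denom₁ denom₂ : (q s : ℤ) → List ℤ
  denom₁ q s = 0ℤ ∷ - (+ 6 * q) ∷ + 8 * q * s ∷ (q * q - + 4 * q * s * s) ∷ []
  denom₂ q s = 0ℤ ∷ + 2 * q ∷ + 8 * q * s ∷ (+ 9 * q * q - + 4 * q * s * s) ∷ []

  numer₁ numer₂ : ℕ → (q s t : ℤ) → List ℤ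
  numer₁ i q s t = (0ℤ ∷ 0ℤ ∷ 0ℤ ∷ + 6 * s ∷ (q - + 4 * s * s) ∷ []) +ₚ B₁ i q s t
  numer₂ i q s t = (0ℤ ∷ 0ℤ ∷ 0ℤ ∷ + 6 * s ∷ (+ 9 * q - + 4 * s * s) ∷ []) +ₚ B₂ i q s t

  -- Shaped as the coefficient of degree 4 to which `_⊛ₚ_` unfolds for 1, 0, d₂, d₃, d₄. The entry 0
  -- reflects that the matrix of `step` has trace 0.
  lincomb : (d₂ d₃ d₄ x₄ x₃ x₂ x₁ x₀ : ℤ) → ℤ
  lincomb d₂ d₃ d₄ x₄ x₃ x₂ x₁ x₀ = 1ℤ * x₄ + (0ℤ * x₃ + (d₂ * x₂ + (d₃ * x₁ + d₄ * x₀)))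

  -- The recurrence is linear, so it passes from the four coordinates to every value. With the five
  -- vectors kept opaque, one large identity falls apart into one per coordinate.
  lincomb-value : ∀ d₂ d₃ d₄ sg c s v₄ v₃ v₂ v₁ v₀ →
    let val = λ v → - e v + sg * r v + c * a v + s * b v
        L = λ (f : Coords ℤ → ℤ) → lincomb d₂ d₃ d₄ (f v₄) (f v₃) (f v₂) (f v₁) (f v₀)
    in L e ≡ 0ℤ → L r ≡ 0ℤ → L a ≡ 0ℤ → L b ≡ 0ℤ →
       1ℤ * val v₄ + (0ℤ * val v₃ + (d₂ * val v₂ + (d₃ * val v₁ + (d₄ * val v₀ + 0ℤ)))) ≡ 0ℤ
  lincomb-value d₂ d₃ d₄ sg c s v₄ v₃ v₂ v₁ v₀ he hr ha hb = begin
    _  ≡⟨ collect d₂ d₃ d₄ sg c s (e v₄) (r v₄) (a v₄) (b v₄)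
        (e v₃) (r v₃) (a v₃) (b v₃) (e v₂) (r v₂) (a v₂) (b v₂) (e v₁) (r v₁) (a v₁) (b v₁) (e v₀) (r v₀) (a v₀) (b v₀) ⟩
    - L e + sg * L r + c * L a + s * L b  ≡⟨ cong₂ (λ x y → - x + sg * y + c * L a + s * L b) he hr ⟩
    - 0ℤ + sg * 0ℤ + c * L a + s * L b  ≡⟨ cong₂ (λ x y → - 0ℤ + sg * 0ℤ + c * x + s * y) ha hb ⟩
    - 0ℤ + sg * 0ℤ + c * 0ℤ + s * 0ℤ  ≡⟨ solve 3 (λ x y z → con 0ℤ :+ x :* con 0ℤ :+ y :* con 0ℤ :+ z :* con 0ℤ := con 0ℤ) refl sg c s ⟩
    0ℤ  ∎
    where
    open ≡-Reasoning
    L : (Coords ℤ → ℤ) → ℤ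
    L f = lincomb d₂ d₃ d₄ (f v₄) (f v₃) (f v₂) (f v₁) (f v₀)
    collect : ∀ d₂ d₃ d₄ sg c s e₄ r₄ a₄ b₄ e₃ r₃ a₃ b₃ e₂ r₂ a₂ b₂ e₁ r₁ a₁ b₁ e₀ r₀ a₀ b₀ →
      let val = λ e r a b → - e + sg * r + c * a + s * b in
      1ℤ * val e₄ r₄ a₄ b₄ + (0ℤ * val e₃ r₃ a₃ b₃ + (d₂ * val e₂ r₂ a₂ b₂ + (d₃ * val e₁ r₁ a₁ b₁ + (d₄ * val e₀ r₀ a₀ b₀ + 0ℤ))))
      ≡ - lincomb d₂ d₃ d₄ e₄ e₃ e₂ e₁ e₀ + sg * lincomb d₂ d₃ d₄ r₄ r₃ r₂ r₁ r₀
        + c * lincomb d₂ d₃ d₄ a₄ a₃ a₂ a₁ a₀ + s * lincomb d₂ d₃ d₄ b₄ b₃ b₂ b₁ b₀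
    collect = solve 26 (λ d₂ d₃ d₄ sg c s e₄ r₄ a₄ b₄ e₃ r₃ a₃ b₃ e₂ r₂ a₂ b₂ e₁ r₁ a₁ b₁ e₀ r₀ a₀ b₀ →
      let val = λ e r a b → :- e :+ sg :* r :+ c :* a :+ s :* b
          lin = λ x₄ x₃ x₂ x₁ x₀ → con 1ℤ :* x₄ :+ (con 0ℤ :* x₃ :+ (d₂ :* x₂ :+ (d₃ :* x₁ :+ d₄ :* x₀))) in
      con 1ℤ :* val e₄ r₄ a₄ b₄ :+ (con 0ℤ :* val e₃ r₃ a₃ b₃ :+ (d₂ :* val e₂ r₂ a₂ b₂ :+ (d₃ :* val e₁ r₁ a₁ b₁ :+ (d₄ :* val e₀ r₀ a₀ b₀ :+ con 0ℤ))))
      := :- lin e₄ e₃ e₂ e₁ e₀ :+ sg :* lin r₄ r₃ r₂ r₁ r₀ :+ c :* lin a₄ a₃ a₂ a₁ a₀ :+ s :* lin b₄ b₃ b₂ b₁ b₀) refl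

  -- One coordinate of the Cayley-Hamilton identity for `step 1ℤ`. It depends on q = s² + 4t²: the
  -- sum of the principal 2 by 2 minors is -3q - 3(s² + 4t²), which has to be -6q.
  Annihilates₁ : (Coords ℤ → ℤ) → Set
  Annihilates₁ f = ∀ s t e₀ r₀ a₀ b₀ →
    let q = norm-ℤ s t
        S = step 1ℤ q s t
        v = ⟨ e₀ , r₀ , a₀ , b₀ ⟩
    in lincomb (- (+ 6 * q)) (+ 8 * q * s) (q * q - + 4 * q * s * s) (f (S (S (S (S v))))) (f (S (S (S v)))) (f (S (S v))) (f (S v)) (f v) ≡ 0ℤ

  charPoly₁-e : Annihilates₁ e
  charPoly₁-e = solve 6 (λ s t e₀ r a b → charPoly D₁ 1ℤ e s t e₀ r a b := con 0ℤ) refl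

  charPoly₁-r : Annihilates₁ r
  charPoly₁-r = solve 6 (λ s t e r₀ a b → charPoly D₁ 1ℤ r s t e r₀ a b := con 0ℤ) refl

  charPoly₁-a : Annihilates₁ a
  charPoly₁-a = solve 6 (λ s t e r a₀ b → charPoly D₁ 1ℤ a s t e r a₀ b := con 0ℤ) refl

  charPoly₁-b : Annihilates₁ b
  charPoly₁-b = solve 6 (λ s t e r a b₀ → charPoly D₁ 1ℤ b s t e r a b₀ := con 0ℤ) refl

  recurrence₁ : ∀ i s t n → let q = norm-ℤ s t in
    ((1ℤ ∷ denom₁ q s) ⊛ shift (λ n → value i (coords 1ℤ q s t n))) (5 ℕ.+ n) ≡ 0ℤ
  recurrence₁ i s t n = lincomb-value (- (+ 6 * q)) (+ 8 * q * s) (q * q - + 4 * q * s * s) (signℕ i) (cosℕ i) (sinℕ i)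
      (S (S (S (S v)))) (S (S (S v))) (S (S v)) (S v) v
      (charPoly₁-e s t (e v) (r v) (a v) (b v)) (charPoly₁-r s t (e v) (r v) (a v) (b v))
      (charPoly₁-a s t (e v) (r v) (a v) (b v)) (charPoly₁-b s t (e v) (r v) (a v) (b v))
    where
    q = norm-ℤ s t
    S = step 1ℤ q s t
    v = coords 1ℤ q s t n

  Annihilates₂ : (Coords ℤ → ℤ) → Set
  Annihilates₂ f = ∀ s t e₀ r₀ a₀ b₀ →
    let q = norm-ℤ s t
        S = step -1ℤ q s t
        v = ⟨ e₀ , r₀ , a₀ , b₀ ⟩
    in lincomb (+ 2 * q) (+ 8 * q * s) (+ 9 * q * q - + 4 * q * s * s) (f (S (S (S (S v))))) (f (S (S (S v)))) (f (S (S v))) (f (S v)) (f v) ≡ 0ℤ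

  charPoly₂-e : Annihilates₂ e
  charPoly₂-e = solve 6 (λ s t e₀ r a b → charPoly D₂ -1ℤ e s t e₀ r a b := con 0ℤ) refl

  charPoly₂-r : Annihilates₂ r
  charPoly₂-r = solve 6 (λ s t e r₀ a b → charPoly D₂ -1ℤ r s t e r₀ a b := con 0ℤ) refl

  charPoly₂-a : Annihilates₂ a
  charPoly₂-a = solve 6 (λ s t e r a₀ b → charPoly D₂ -1ℤ a s t e r a₀ b := con 0ℤ) refl

  charPoly₂-b : Annihilates₂ b
  charPoly₂-b = solve 6 (λ s t e r a b₀ → charPoly D₂ -1ℤ b s t e r a b₀ := con 0ℤ) refl

  recurrence₂ : ∀ i s t n → let q = norm-ℤ s t in
    ((1ℤ ∷ denom₂ q s) ⊛ shift (λ n → value i (coords -1ℤ q s t n))) (5 ℕ.+ n) ≡ 0ℤ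
  recurrence₂ i s t n = lincomb-value (+ 2 * q) (+ 8 * q * s) (+ 9 * q * q - + 4 * q * s * s) (signℕ i) (cosℕ i) (sinℕ i)
      (S (S (S (S v)))) (S (S (S v))) (S (S v)) (S v) v
      (charPoly₂-e s t (e v) (r v) (a v) (b v)) (charPoly₂-r s t (e v) (r v) (a v) (b v))
      (charPoly₂-a s t (e v) (r v) (a v) (b v)) (charPoly₂-b s t (e v) (r v) (a v) (b v))
    where
    q = norm-ℤ s t
    S = step -1ℤ q s t
    v = coords -1ℤ q s t n

  -- After clearing the denominator, the recurrence kills everything from degree 5 on, and degrees 0
  -- to 4 are the numerator. The bound on `i` is there because `B₁` reads every index above 2 as 3.
  rational₁ : ∀ i s t → let q = norm-ℤ s t in i ℕ.< 4 →
    shift (λ n → value i (coords 1ℤ q s t n)) ≗ numer₁ i q s t ⁄ (1ℤ ∷ denom₁ q s)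
  rational₁ i s t i<4 = ⁄-unique (numer₁ i (norm-ℤ s t) s t) (denom₁ (norm-ℤ s t) s) (eqs i i<4)
    where
    eqs : ∀ i → i ℕ.< 4 → let q = norm-ℤ s t in
      ((1ℤ ∷ denom₁ q s) ⊛ shift (λ n → value i (coords 1ℤ q s t n))) ≗ coeff (numer₁ i q s t)
    eqs 0 _ 0 = refl
    -- The `con 0ℤ :+` reproduces the addition that `+ₚ` performs in this degree.
    eqs 0 _ 1 = solve 2 (λ s t → lhs D₁ 1ℤ 0 s t 1 := con 0ℤ :+ con (+ 3)) refl s t
    eqs 0 _ 2 = solve 2 (λ s t → lhs D₁ 1ℤ 0 s t 2 := con 0ℤ :+ (:- (:6 :* s :+ :3))) refl s t
    eqs 0 _ 3 = solve 2 (λ s t → let q = norm s t in lhs D₁ 1ℤ 0 s t 3 := con (+ 6) :* s :+ (:- q :+ :4 :* s :* s)) refl s t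
    eqs 0 _ 4 = solve 2 (λ s t → let q = norm s t in lhs D₁ 1ℤ 0 s t 4 := q :- :4 :* s :* s) refl s t
    eqs 0 _ (suc (suc (suc (suc (suc n))))) = recurrence₁ 0 s t n
    eqs 1 _ 0 = refl
    eqs 1 _ 1 = solve 2 (λ s t → lhs D₁ 1ℤ 1 s t 1 := con 0ℤ :+ con -1ℤ) refl s t
    eqs 1 _ 2 = solve 2 (λ s t → lhs D₁ 1ℤ 1 s t 2 := con 0ℤ :+ (:2 :* s :+ :8 :* t :- :3)) refl s t
    eqs 1 _ 3 = solve 2 (λ s t → let q = norm s t in lhs D₁ 1ℤ 1 s t 3 := con (+ 6) :* s :+ (:- q :- :8 :* s :* t)) refl s t
    eqs 1 _ 4 = solve 2 (λ s t → let q = norm s t in lhs D₁ 1ℤ 1 s t 4 := q :- :4 :* s :* s) refl s t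
    eqs 1 _ (suc (suc (suc (suc (suc n))))) = recurrence₁ 1 s t n
    eqs 2 _ 0 = refl
    eqs 2 _ 1 = solve 2 (λ s t → lhs D₁ 1ℤ 2 s t 1 := con 0ℤ :+ con -1ℤ) refl s t
    eqs 2 _ 2 = solve 2 (λ s t → lhs D₁ 1ℤ 2 s t 2 := con 0ℤ :+ (:2 :* s :- :3)) refl s t
    eqs 2 _ 3 = solve 2 (λ s t → let q = norm s t in lhs D₁ 1ℤ 2 s t 3 := con (+ 6) :* s :+ (:- q :+ :16 :* t :* t)) refl s t
    eqs 2 _ 4 = solve 2 (λ s t → let q = norm s t in lhs D₁ 1ℤ 2 s t 4 := q :- :4 :* s :* s) refl s t
    eqs 2 _ (suc (suc (suc (suc (suc n))))) = recurrence₁ 2 s t n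
    eqs 3 _ 0 = refl
    eqs 3 _ 1 = solve 2 (λ s t → lhs D₁ 1ℤ 3 s t 1 := con 0ℤ :+ con -1ℤ) refl s t
    eqs 3 _ 2 = solve 2 (λ s t → lhs D₁ 1ℤ 3 s t 2 := con 0ℤ :+ (:2 :* s :- :8 :* t :- :3)) refl s t
    eqs 3 _ 3 = solve 2 (λ s t → let q = norm s t in lhs D₁ 1ℤ 3 s t 3 := con (+ 6) :* s :+ (:- q :+ :8 :* s :* t)) refl s t
    eqs 3 _ 4 = solve 2 (λ s t → let q = norm s t in lhs D₁ 1ℤ 3 s t 4 := q :- :4 :* s :* s) refl s t
    eqs 3 _ (suc (suc (suc (suc (suc n))))) = recurrence₁ 3 s t n
    eqs (suc (suc (suc (suc i)))) (ℕ.s≤s (ℕ.s≤s (ℕ.s≤s (ℕ.s≤s ()))))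

  rational₂ : ∀ i s t → let q = norm-ℤ s t in i ℕ.< 4 →
    shift (λ n → value i (coords -1ℤ q s t n)) ≗ numer₂ i q s t ⁄ (1ℤ ∷ denom₂ q s)
  rational₂ i s t i<4 = ⁄-unique (numer₂ i (norm-ℤ s t) s t) (denom₂ (norm-ℤ s t) s) (eqs i i<4)
    where
    eqs : ∀ i → i ℕ.< 4 → let q = norm-ℤ s t in
      ((1ℤ ∷ denom₂ q s) ⊛ shift (λ n → value i (coords -1ℤ q s t n))) ≗ coeff (numer₂ i q s t)
    eqs 0 _ 0 = refl
    eqs 0 _ 1 = solve 2 (λ s t → lhs D₂ -1ℤ 0 s t 1 := con 0ℤ :+ con (+ 3)) refl s t
    eqs 0 _ 2 = solve 2 (λ s t → lhs D₂ -1ℤ 0 s t 2 := con 0ℤ :+ (:2 :* s :+ con 1ℤ)) refl s t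
    eqs 0 _ 3 = solve 2 (λ s t → let q = norm s t in lhs D₂ -1ℤ 0 s t 3 := con (+ 6) :* s :+ (:3 :* q :- :4 :* s :* s)) refl s t
    eqs 0 _ 4 = solve 2 (λ s t → let q = norm s t in lhs D₂ -1ℤ 0 s t 4 := con (+ 9) :* q :- :4 :* s :* s) refl s t
    eqs 0 _ (suc (suc (suc (suc (suc n))))) = recurrence₂ 0 s t n
    eqs 1 _ 0 = refl
    eqs 1 _ 1 = solve 2 (λ s t → lhs D₂ -1ℤ 1 s t 1 := con 0ℤ :+ con -1ℤ) refl s t
    eqs 1 _ 2 = solve 2 (λ s t → lhs D₂ -1ℤ 1 s t 2 := con 0ℤ :+ (:2 :* s :- :8 :* t :+ con 1ℤ)) refl s t
    eqs 1 _ 3 = solve 2 (λ s t → let q = norm s t in lhs D₂ -1ℤ 1 s t 3 := con (+ 6) :* s :+ (:3 :* q :+ :8 :* s :* t)) refl s t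
    eqs 1 _ 4 = solve 2 (λ s t → let q = norm s t in lhs D₂ -1ℤ 1 s t 4 := con (+ 9) :* q :- :4 :* s :* s) refl s t
    eqs 1 _ (suc (suc (suc (suc (suc n))))) = recurrence₂ 1 s t n
    eqs 2 _ 0 = refl
    eqs 2 _ 1 = solve 2 (λ s t → lhs D₂ -1ℤ 2 s t 1 := con 0ℤ :+ con -1ℤ) refl s t
    eqs 2 _ 2 = solve 2 (λ s t → lhs D₂ -1ℤ 2 s t 2 := con 0ℤ :+ (con (- + 6) :* s :+ con 1ℤ)) refl s t
    eqs 2 _ 3 = solve 2 (λ s t → let q = norm s t in lhs D₂ -1ℤ 2 s t 3 := con (+ 6) :* s :+ (con (- + 5) :* q :- :16 :* t :* t)) refl s t
    eqs 2 _ 4 = solve 2 (λ s t → let q = norm s t in lhs D₂ -1ℤ 2 s t 4 := con (+ 9) :* q :- :4 :* s :* s) refl s t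
    eqs 2 _ (suc (suc (suc (suc (suc n))))) = recurrence₂ 2 s t n
    eqs 3 _ 0 = refl
    eqs 3 _ 1 = solve 2 (λ s t → lhs D₂ -1ℤ 3 s t 1 := con 0ℤ :+ con -1ℤ) refl s t
    eqs 3 _ 2 = solve 2 (λ s t → lhs D₂ -1ℤ 3 s t 2 := con 0ℤ :+ (:2 :* s :+ :8 :* t :+ con 1ℤ)) refl s t
    eqs 3 _ 3 = solve 2 (λ s t → let q = norm s t in lhs D₂ -1ℤ 3 s t 3 := con (+ 6) :* s :+ (:3 :* q :- :8 :* s :* t)) refl s t
    eqs 3 _ 4 = solve 2 (λ s t → let q = norm s t in lhs D₂ -1ℤ 3 s t 4 := con (+ 9) :* q :- :4 :* s :* s) refl s t
    eqs 3 _ (suc (suc (suc (suc (suc n))))) = recurrence₂ 3 s t n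
    eqs (suc (suc (suc (suc i)))) (ℕ.s≤s (ℕ.s≤s (ℕ.s≤s (ℕ.s≤s ()))))

-- Central binomials modulo p, and sums of two squares.

module NumberTheory where
  open import Data.Nat using (_+_; _*_; _^_; _∸_; _<_; _≤_)
  open ≡ using (sym; trans; refl)

  module _ {p : ℕ} (pr : Prime p) where
    private
      instance
        p≢0 : NonZero p
        p≢0 = prime⇒nonZero pr

    1<p : 1 < p
    1<p = ℕ.nonTrivial⇒n>1 p {{prime⇒nonTrivial pr}}

    p∤1 : p ∤ 1
    p∤1 p∣1 = ℕ.<⇒≱ 1<p (∣⇒≤ p∣1)

    ∤-* : ∀ {m n} → p ∤ m → p ∤ n → p ∤ m * n
    ∤-* {m} {n} p∤m p∤n p∣mn = [ p∤m , p∤n ]′ (euclidsLemma m n pr p∣mn)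

    ∤⇒coprime : ∀ {n} → p ∤ n → Coprime p n
    ∤⇒coprime p∤n (d∣p , d∣n) with prime⇒irreducible pr d∣p
    ... | inj₁ d≡1 = d≡1
    ... | inj₂ d≡p = ⊥-elim (p∤n (subst (_∣ _) d≡p d∣n))

    p∤n*p+r : ∀ n r → suc r < p → p ∤ n * p + suc r
    p∤n*p+r n r r<p p∣ = ℕ.<⇒≱ r<p (∣⇒≤ (∣m+n∣m⇒∣n p∣ (n∣m*n n)))

    -- Among the factors of (n p + r)! the multiples of p contribute pⁿ n!, and `u` collects the
    -- others.
    factorial-split : ∀ n r → r < p → ∃ λ u → p ∤ u × (n * p + r) ! ≡ p ^ n * n ! * u
    factorial-split zero    zero    _   = 1 , p∤1 , refl
    -- Only the factor (n + 1) p is new; it is absorbed by pⁿ⁺¹ (n + 1)! and leaves `u` alone.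
    factorial-split (suc n) zero    _   with factorial-split n (ℕ.pred p) (ℕ.≤-reflexive (ℕ.suc-pred p))
    ... | u , p∤u , eq = u , p∤u , (begin
      (suc n * p + 0) !  ≡⟨ cong _! [1+n]p≡ ⟩
      suc (n * p + ℕ.pred p) * (n * p + ℕ.pred p) !  ≡⟨ cong₂ ℕ._*_ (trans (sym [1+n]p≡) (ℕ.+-identityʳ (suc n * p))) eq ⟩
      suc n * p * (p ^ n * n ! * u)  ≡⟨ lem (suc n) p (p ^ n) (n !) u ⟩
      p * p ^ n * (suc n * n !) * u  ∎)
      where
      open ≡-Reasoning
      lem : ∀ n p q f u → n * p * (q * f * u) ≡ p * q * (n * f) * u
      lem = ℕ-Solver.solve-∀
      [1+n]p≡ : suc n * p + 0 ≡ suc (n * p + ℕ.pred p)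
      [1+n]p≡ = begin
        p + n * p + 0  ≡⟨ ℕ.+-identityʳ _ ⟩
        p + n * p  ≡⟨ ℕ.+-comm p (n * p) ⟩
        n * p + p  ≡⟨ cong (_+_ (n * p)) (ℕ.suc-pred p) ⟨
        n * p + suc (ℕ.pred p)  ≡⟨ ℕ.+-suc (n * p) (ℕ.pred p) ⟩
        suc (n * p + ℕ.pred p)  ∎
    factorial-split n       (suc r) r<p with factorial-split n r (ℕ.<-trans (ℕ.n<1+n r) r<p)
    ... | u , p∤u , eq = (n * p + suc r) * u , ∤-* (p∤n*p+r n r r<p) p∤u , (begin
      (n * p + suc r) !  ≡⟨ cong _! (ℕ.+-suc (n * p) r) ⟩
      suc (n * p + r) * (n * p + r) !  ≡⟨ cong₂ ℕ._*_ (sym (ℕ.+-suc (n * p) r)) eq ⟩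
      (n * p + suc r) * (p ^ n * n ! * u)  ≡⟨ lem (n * p + suc r) (p ^ n * n !) u ⟩
      p ^ n * n ! * ((n * p + suc r) * u)  ∎)
      where
      open ≡-Reasoning
      lem : ∀ x y u → x * (y * u) ≡ y * (x * u)
      lem = ℕ-Solver.solve-∀

    centralBinomial : ∀ k → ((k + k) C k) * (k ! * k !) ≡ (k + k) !
    centralBinomial k = begin
      ((k + k) C k) * (k ! * k !)  ≡⟨ cong (λ j → ((k + k) C k) * (k ! * j !)) (ℕ.m+n∸m≡n k k) ⟨
      ((k + k) C k) * (k ! * (k + k ∸ k) !)  ≡⟨ cong (_* (k ! * (k + k ∸ k) !)) (nCk≡n!/k![n-k]! (ℕ.m≤m+n k k)) ⟩
      ((k + k) ! / (k ! * (k + k ∸ k) !)) * (k ! * (k + k ∸ k) !)  ≡⟨ m/n*n≡m (k![n∸k]!∣n! (ℕ.m≤m+n k k)) ⟩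
      (k + k) !  ∎
      where
      open ≡-Reasoning
      instance
        _ = k ℕ.!* (k + k ∸ k) !≢0

    -- All digits of k = (pᵐ - 1) / 4 in base p equal (p - 1) / 4, so k + k is computed without carries.
    p∤centralBinomial : ∀ k₁ → p ≡ 1 + k₁ * 4 → ∀ m k → p ^ m ≡ 1 + k * 4 → p ∤ ((k + k) C k)
    p∤centralBinomial k₁ p≡ zero    zero eq = p∤1
    p∤centralBinomial k₁ p≡ (suc m) K    eq p∣C = [ p∤centralBinomial k₁ p≡ m k eq′ , proj₁ (proj₂ split₂) ]′ (euclidsLemma ((k + k) C k) u₂ pr
        (subst (p ∣_) C-relation (∣m⇒∣m*n (u₁ * u₁) p∣C)))
      where
      open ≡-Reasoning
      r = p ^ m % 4
      k = p ^ m / 4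
      p^m%4≡1 : ∀ m → p ^ m % 4 ≡ 1
      p^m%4≡1 zero    = refl
      p^m%4≡1 (suc m) = trans (%-distribˡ-* p (p ^ m) 4) (cong₂ (λ x y → x * y % 4) (trans (cong (_% 4) p≡) ([m+kn]%n≡m%n 1 k₁ 4)) (p^m%4≡1 m))
      eq′ : p ^ m ≡ 1 + k * 4
      eq′ = trans (m≡m%n+[m/n]*n (p ^ m) 4) (cong (_+ k * 4) (p^m%4≡1 m))
      K≡ : K ≡ k * p + k₁
      K≡ = ℕ.*-cancelʳ-≡ K (k * p + k₁) 4 (ℕ.+-cancelˡ-≡ 1 _ _ (begin
        1 + K * 4  ≡⟨ eq ⟨
        p * p ^ m  ≡⟨ cong (p ℕ.*_) eq′ ⟩
        p * (1 + k * 4)  ≡⟨ lem₁ p k ⟩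
        p + (k * p) * 4  ≡⟨ cong (_+ (k * p) * 4) p≡ ⟩
        1 + k₁ * 4 + (k * p) * 4  ≡⟨ lem₂ k₁ (k * p) ⟩
        1 + (k * p + k₁) * 4  ∎))
        where
        lem₁ : ∀ p k → p * (1 + k * 4) ≡ p + (k * p) * 4
        lem₁ = ℕ-Solver.solve-∀
        lem₂ : ∀ x y → 1 + x * 4 + y * 4 ≡ 1 + (y + x) * 4
        lem₂ = ℕ-Solver.solve-∀
      k₁+k₁<p : k₁ + k₁ < p
      k₁+k₁<p = subst (suc (k₁ + k₁) ≤_) (trans (lem k₁) (sym p≡)) (ℕ.m≤m+n (suc (k₁ + k₁)) (k₁ + k₁))
        where
        lem : ∀ x → suc (x + x) + (x + x) ≡ 1 + x * 4
        lem = ℕ-Solver.solve-∀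
      split₁ = factorial-split k k₁ (ℕ.≤-<-trans (ℕ.m≤m+n k₁ k₁) k₁+k₁<p)
      split₂ = factorial-split (k + k) (k₁ + k₁) k₁+k₁<p
      u₁ = proj₁ split₁
      u₂ = proj₁ split₂
      P = p ^ k
      -- In the quotient of the factorial splittings the powers of p cancel, because 2 k₁ < p: the
      -- two central binomials agree up to factors prime to p.
      C-relation : ((K + K) C K) * (u₁ * u₁) ≡ ((k + k) C k) * u₂
      C-relation = ℕ.*-cancelʳ-≡ _ _ (P * k ! * (P * k !)) {{D≢0}} (begin
        ((K + K) C K) * (u₁ * u₁) * (P * k ! * (P * k !))  ≡⟨ lem₁ (((K + K) C K)) u₁ (P * k !) ⟩
        ((K + K) C K) * ((P * k ! * u₁) * (P * k ! * u₁))  ≡⟨ cong (λ x → ((K + K) C K) * (x * x)) K! ⟨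
        ((K + K) C K) * (K ! * K !)  ≡⟨ centralBinomial K ⟩
        (K + K) !  ≡⟨ cong _! (trans (cong (λ x → x + x) K≡) (lem₂ k p k₁)) ⟩
        ((k + k) * p + (k₁ + k₁)) !  ≡⟨ proj₂ (proj₂ split₂) ⟩
        p ^ (k + k) * (k + k) ! * u₂  ≡⟨ cong₂ (λ x y → x * y * u₂) (ℕ.^-distribˡ-+-* p k k) (sym (centralBinomial k)) ⟩
        P * P * (((k + k) C k) * (k ! * k !)) * u₂  ≡⟨ lem₃ P ((k + k) C k) (k !) u₂ ⟩
        ((k + k) C k) * u₂ * (P * k ! * (P * k !))  ∎)
        where
        K! : K ! ≡ P * k ! * u₁
        K! = trans (cong _! K≡) (proj₂ (proj₂ split₁))
        D≢0 : NonZero (P * k ! * (P * k !))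
        D≢0 = ℕ.m*n≢0 (P * k !) (P * k !) {{d}} {{d}}
          where
          d = ℕ.m*n≢0 P (k !) {{ℕ.m^n≢0 p k}} {{ℕ._!≢0 k}}
        lem₁ : ∀ c u d → c * (u * u) * (d * d) ≡ c * ((d * u) * (d * u))
        lem₁ = ℕ-Solver.solve-∀
        lem₂ : ∀ k p r → (k * p + r) + (k * p + r) ≡ (k + k) * p + (r + r)
        lem₂ = ℕ-Solver.solve-∀
        lem₃ : ∀ P c f u → P * P * (c * (f * f)) * u ≡ c * u * (P * f * (P * f))
        lem₃ = ℕ-Solver.solve-∀

    p^m∣x*y⇒p^m∣x : ∀ m {x y} → p ∤ y → p ^ m ∣ x * y → p ^ m ∣ x
    p^m∣x*y⇒p^m∣x zero    {x} p∤y _ = 1∣ x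
    p^m∣x*y⇒p^m∣x (suc m) {x} {y} p∤y p^∣xy with euclidsLemma x y pr (∣-trans (m∣m*n (p ^ m)) p^∣xy)
    ... | inj₂ p∣y = ⊥-elim (p∤y p∣y)
    ... | inj₁ (divides x′ refl) = subst (p ^ suc m ∣_) (ℕ.*-comm p x′) (*-monoʳ-∣ p
          (p^m∣x*y⇒p^m∣x m p∤y (*-cancelˡ-∣ p (subst (p ^ suc m ∣_) (lem x′ p y) p^∣xy))))
      where
      lem : ∀ x p y → x * p * y ≡ p * (x * y)
      lem = ℕ-Solver.solve-∀

  -- Fermat's descent: replace a by an even residue; then a² + 1 = n k with k < n and k ≡ 3 (mod 4).
  3mod4∤a²+1 : ∀ n → n % 4 ≡ 3 → ∀ a → n ∤ a * a + 1
  3mod4∤a²+1 = <-rec (λ n → n % 4 ≡ 3 → ∀ a → n ∤ a * a + 1) step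
    where
    step : ∀ n → (∀ {k} → k < n → k % 4 ≡ 3 → ∀ a → k ∤ a * a + 1) → n % 4 ≡ 3 → ∀ a → n ∤ a * a + 1
    step n@(suc n′) rec n%4≡3 a n∣ = by-parity (r / 2) (r % 2) (m≡m%n+[m/n]*n r 2) (m%n<n r 2)
      where
      r = a % n
      lemᵣ : ∀ r d n → (r + d * n) * (r + d * n) + 1 ≡ (r * d + d * r + d * d * n) * n + (r * r + 1)
      lemᵣ = ℕ-Solver.solve-∀
      n∣r²+1 : n ∣ r * r + 1
      n∣r²+1 = ∣m+n∣m⇒∣n (subst (n ∣_) (trans (cong (λ x → x * x + 1) (m≡m%n+[m/n]*n a n)) (lemᵣ r (a / n) n)) n∣)
        (n∣m*n (r * (a / n) + (a / n) * r + (a / n) * (a / n) * n))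
      even-case : ∀ d → d * 2 < n → n ∤ d * 2 * (d * 2) + 1
      even-case d x<n (divides k eq) = rec k<n k%4≡3 (d * 2) (subst (k ∣_) (sym eq) (m∣m*n n))
        where
        x = d * 2
        k<n : k < n
        k<n = ℕ.*-cancelʳ-< n k n (ℕ.≤-<-trans (ℕ.≤-reflexive (sym eq)) (ℕ.≤-<-trans
          (ℕ.+-monoˡ-≤ 1 (ℕ.*-mono-≤ (ℕ.≤-pred x<n) (ℕ.≤-pred x<n))) (bound n′ n′≢0)))
          where
          n′≢0 : 0 < n′
          n′≢0 = ℕ.≤-pred (ℕ.≤∧≢⇒< (s≤s z≤n) (λ { refl → 1≢3 n%4≡3 }))
            where
            1≢3 : ¬ (1 ≡ 3)
            1≢3 ()
          bound : ∀ n′ → 0 < n′ → n′ * n′ + 1 < suc n′ * suc n′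
          bound n′ 0<n′ = subst (n′ * n′ + 1 <_) (lem n′) (ℕ.m<m+n (n′ * n′ + 1) (ℕ.<-≤-trans 0<n′ (ℕ.m≤m+n n′ n′)))
            where
            lem : ∀ n → n * n + 1 + (n + n) ≡ suc n * suc n
            lem = ℕ-Solver.solve-∀
        -- Evenness of x makes x² + 1 congruent to 1 modulo 4.
        3k%4≡1 : (k % 4) * 3 % 4 ≡ 1
        3k%4≡1 = begin
          (k % 4) * 3 % 4  ≡⟨ cong (λ x → (k % 4) * x % 4) n%4≡3 ⟨
          (k % 4) * (n % 4) % 4  ≡⟨ %-distribˡ-* k n 4 ⟨
          k * n % 4  ≡⟨ cong (_% 4) eq ⟨
          (d * 2 * (d * 2) + 1) % 4  ≡⟨ cong (_% 4) (lem d) ⟩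
          (1 + d * d * 4) % 4  ≡⟨ [m+kn]%n≡m%n 1 (d * d) 4 ⟩
          1  ∎
          where
          open ≡-Reasoning
          lem : ∀ d → d * 2 * (d * 2) + 1 ≡ 1 + d * d * 4
          lem = ℕ-Solver.solve-∀
        k%4≡3 : k % 4 ≡ 3
        k%4≡3 = only-3 (k % 4) (m%n<n k 4) 3k%4≡1
          where
          only-3 : ∀ r → r < 4 → r * 3 % 4 ≡ 1 → r ≡ 3
          only-3 0 _ ()
          only-3 1 _ ()
          only-3 2 _ ()
          only-3 3 _ _ = refl
          only-3 (suc (suc (suc (suc r)))) (s≤s (s≤s (s≤s (s≤s ())))) _
      by-parity : ∀ d c → r ≡ c + d * 2 → c < 2 → ⊥
      by-parity d 0 r≡ _ = even-case d (subst (_< n) r≡ (m%n<n a n)) (subst (λ x → n ∣ x * x + 1) r≡ n∣r²+1)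
      -- For odd r the residue n - r is taken instead: it is even since n is odd, and its square is
      -- r² modulo n.
      by-parity d 1 r≡ _ = even-case e (subst (_< n) b≡ b<n) (subst (λ x → n ∣ x * x + 1) b≡ n∣b²+1)
        where
        b = n ∸ r
        b+r≡n : b + r ≡ n
        b+r≡n = ℕ.m∸n+n≡m (ℕ.<⇒≤ (m%n<n a n))
        b<n : b < n
        b<n = subst (b <_) b+r≡n (ℕ.m<m+n b (subst (0 <_) (sym r≡) (s≤s z≤n)))
        n∣b²+1 : n ∣ b * b + 1
        n∣b²+1 = ∣m+n∣m⇒∣n (subst (n ∣_) swap (∣m∣n⇒∣m+n (n∣m*n b) n∣r²+1)) (n∣m*n r)
          where
          lem : ∀ b r → b * (b + r) + (r * r + 1) ≡ r * (b + r) + (b * b + 1)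
          lem = ℕ-Solver.solve-∀
          swap : b * n + (r * r + 1) ≡ r * n + (b * b + 1)
          swap = subst (λ n → b * n + (r * r + 1) ≡ r * n + (b * b + 1)) b+r≡n (lem b r)
        e = b / 2
        b≡ : b ≡ e * 2
        b≡ = even (b % 2) (m≡m%n+[m/n]*n b 2) (m%n<n b 2)
          where
          n≡ : n ≡ 3 + (n / 4) * 4
          n≡ = trans (m≡m%n+[m/n]*n n 4) (cong (_+ (n / 4) * 4) n%4≡3)
          even : ∀ c → b ≡ c + e * 2 → c < 2 → b ≡ e * 2
          even 0 eq _ = eq
          even 1 eq _ = ⊥-elim (odd≢even (e + d + 1) (1 + (n / 4) * 2) (begin
            (e + d + 1) * 2  ≡⟨ lem₁ e d ⟩
            (1 + e * 2) + (1 + d * 2)  ≡⟨ cong₂ ℕ._+_ eq r≡ ⟨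
            b + r  ≡⟨ trans b+r≡n n≡ ⟩
            3 + (n / 4) * 4  ≡⟨ lem₂ (n / 4) ⟩
            1 + (1 + (n / 4) * 2) * 2  ∎))
            where
            open ≡-Reasoning
            lem₁ : ∀ e d → (e + d + 1) * 2 ≡ (1 + e * 2) + (1 + d * 2)
            lem₁ = ℕ-Solver.solve-∀
            lem₂ : ∀ x → 3 + x * 4 ≡ 1 + (1 + x * 2) * 2
            lem₂ = ℕ-Solver.solve-∀
            odd≢even : ∀ x y → ¬ (x * 2 ≡ 1 + y * 2)
            odd≢even zero    y       ()
            odd≢even (suc x) zero    ()
            odd≢even (suc x) (suc y) eq = odd≢even x y (ℕ.suc-injective (ℕ.suc-injective eq))
          even (suc (suc c)) _ (s≤s (s≤s ()))
      by-parity d (suc (suc c)) _ (s≤s (s≤s ()))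

  module _ {p : ℕ} (pr : Prime p) where
    private
      instance
        p≢0 : NonZero p
        p≢0 = prime⇒nonZero pr

    -- Otherwise Bézout gives v y ≡ ±1 modulo p, and p divides (x v)² + 1. The two Bézout forms are
    -- the two signs.
    p∣x²+y²⇒p∣y : p % 4 ≡ 3 → ∀ x y → p ∣ x * x + y * y → p ∣ y
    p∣x²+y²⇒p∣y p%4≡3 x y p∣ with p ∣? y
    ... | yes p∣y = p∣y
    ... | no  p∤y with coprime-Bézout (∤⇒coprime pr p∤y)
    ...   | Bézout.-+ u v eq = ⊥-elim (3mod4∤a²+1 p p%4≡3 (x * v)
      (∣m+n∣m⇒∣n (subst (p ∣_) rearrange (∣n⇒∣m*n (v * v) p∣)) (n∣m*n (u + u + u * u * p))))
      where
      open ≡-Reasoning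
      lem₁ : ∀ x y v → v * v * (x * x + y * y) ≡ x * v * (x * v) + (v * y) * (v * y)
      lem₁ = ℕ-Solver.solve-∀
      lem₂ : ∀ z u p → z + (1 + u * p) * (1 + u * p) ≡ (u + u + u * u * p) * p + (z + 1)
      lem₂ = ℕ-Solver.solve-∀
      rearrange : v * v * (x * x + y * y) ≡ (u + u + u * u * p) * p + (x * v * (x * v) + 1)
      rearrange = trans (lem₁ x y v) (trans (cong (λ z → x * v * (x * v) + z * z) (sym eq)) (lem₂ (x * v * (x * v)) u p))
    ...   | Bézout.+- u v eq = ⊥-elim (3mod4∤a²+1 p p%4≡3 (x * v)
      (∣m+n∣m⇒∣n (subst (p ∣_) rearrange (∣m∣n⇒∣m+n (∣n⇒∣m*n (v * v) p∣) (n∣m*n u))) (∣n⇒∣m*n (v * y) (n∣m*n u))))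
      where
      lem : ∀ x y v → v * v * (x * x + y * y) + (1 + v * y) ≡ (v * y) * (1 + v * y) + (x * v * (x * v) + 1)
      lem = ℕ-Solver.solve-∀
      rearrange : v * v * (x * x + y * y) + u * p ≡ (v * y) * (u * p) + (x * v * (x * v) + 1)
      rearrange = subst (λ w → v * v * (x * x + y * y) + w ≡ (v * y) * w + (x * v * (x * v) + 1)) eq (lem x y v)

    -- p divides both x and y, so p² cancels again and again until a representation of 1 is left.
    p^2j-two-squares : p % 4 ≡ 3 → ∀ j x y → x * x + y * y ≡ p ^ (j * 2) → x ≡ 0 ⊎ y ≡ 0
    p^2j-two-squares p%4≡3 zero    zero    y       eq = inj₁ refl
    p^2j-two-squares p%4≡3 zero    (suc x) zero    eq = inj₂ refl
    p^2j-two-squares p%4≡3 zero    (suc x) (suc y) eq = ⊥-elim (absurd (x + x * suc x) (y + y * suc y) eq)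
      where
      absurd : ∀ a b → ¬ (suc a + suc b ≡ 1)
      absurd a b eq rewrite ℕ.+-suc a b with eq
      ... | ()
    p^2j-two-squares p%4≡3 (suc j) x y eq = go p∣x p∣y
      where
      p∣y : p ∣ y
      p∣y = p∣x²+y²⇒p∣y p%4≡3 x y (subst (p ∣_) (sym eq) (m∣m*n (p * p ^ (j * 2))))
      p∣x : p ∣ x
      p∣x = p∣x²+y²⇒p∣y p%4≡3 y x (subst (p ∣_) (trans (sym eq) (ℕ.+-comm (x * x) (y * y))) (m∣m*n (p * p ^ (j * 2))))
      lem : ∀ p x y → p * (p * (x * x + y * y)) ≡ x * p * (x * p) + y * p * (y * p)
      lem = ℕ-Solver.solve-∀
      go : p ∣ x → p ∣ y → x ≡ 0 ⊎ y ≡ 0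
      go (divides x′ refl) (divides y′ refl) with p^2j-two-squares p%4≡3 j x′ y′
        (ℕ.*-cancelˡ-≡ _ _ p (ℕ.*-cancelˡ-≡ _ _ p (trans (lem p x′ y′) eq)))
      ... | inj₁ refl = inj₁ refl
      ... | inj₂ refl = inj₂ refl

  1+2y≢0 : ∀ y → ¬ (1ℤ ∔ + 2 · y ≡ 0ℤ)
  1+2y≢0 y eq = 1≢2n ∣ y ∣ (trans (cong ∣_∣ -1≡) (ℤ.abs-* (+ 2) y))
    where
    lem : ∀ y → -1ℤ ≡ + 2 · y ⊟ (1ℤ ∔ + 2 · y)
    lem = solve-∀
    -1≡ : -1ℤ ≡ + 2 · y
    -1≡ = trans (lem y) (trans (cong (λ z → + 2 · y ⊟ z) eq) (ℤ.+-identityʳ (+ 2 · y)))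
    1≢2n : ∀ n → ¬ (1 ≡ 2 * n)
    1≢2n zero ()
    1≢2n (suc n) eq with trans eq (ℕ.*-comm 2 (suc n))
    ... | ()

  abs-square : ∀ x → x · x ≡ + (∣ x ∣ * ∣ x ∣)
  abs-square (+ n)      = sym (ℤ.pos-* n n)
  abs-square -[1+ n ]   = refl

  1+4y≢0 : ∀ y → ¬ (1ℤ ∔ + 4 · y ≡ 0ℤ)
  1+4y≢0 y eq = 1+2y≢0 (+ 2 · y) (trans (lem y) eq)
    where
    lem : ∀ y → 1ℤ ∔ + 2 · (+ 2 · y) ≡ 1ℤ ∔ + 4 · y
    lem = solve-∀

  -- a = -s is impossible because a + s is 2 modulo 4.
  1mod4-square-injective : ∀ {a s} z w → a ≡ 1ℤ ∔ + 4 · z → s ≡ 1ℤ ∔ + 4 · w → a · a ≡ s · s → a ≡ s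
  1mod4-square-injective {a} {s} z w a≡ s≡ a²≡s² with ℤ.i*j≡0⇒i≡0∨j≡0 (a ⊟ s) product≡0
    where
    lem : ∀ a s → (a ⊟ s) · (a ∔ s) ≡ a · a ⊟ s · s
    lem = solve-∀
    product≡0 : (a ⊟ s) · (a ∔ s) ≡ 0ℤ
    product≡0 = trans (lem a s) (ℤ.i≡j⇒i-j≡0 a²≡s²)
  ... | inj₁ a-s≡0 = ℤ.i-j≡0⇒i≡j a s a-s≡0
  ... | inj₂ a+s≡0 = ⊥-elim (1+2y≢0 (z ∔ w) (ℤ.*-cancelˡ-≡ (+ 2) (1ℤ ∔ + 2 · (z ∔ w)) 0ℤ
      (trans (trans (lem z w) (sym (cong₂ _∔_ a≡ s≡))) a+s≡0)))
    where
    lem : ∀ z w → + 2 · (1ℤ ∔ + 2 · (z ∔ w)) ≡ (1ℤ ∔ + 4 · z) ∔ (1ℤ ∔ + 4 · w)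
    lem = solve-∀

  module _ {p : ℕ} (pr : Prime p) where
    private
      instance
        p≢0 : NonZero p
        p≢0 = prime⇒nonZero pr

    -- (a u - b s) (a u + b s) = q (a² - s²) forces q ∣ a u - b s, while (a u - b s)² + (a s + b u)² = q²
    -- with a s + b u odd, so a u - b s = 0.
    two-squares-unique : ∀ m {a b s t} z w → a ≡ 1ℤ ∔ + 4 · z → s ≡ 1ℤ ∔ + 4 · w →
      a · a ∔ b · b ≡ + (p ^ m) → s · s ∔ + 2 · t · (+ 2 · t) ≡ + (p ^ m) →
      p ∤ ∣ a · (+ 2 · t) ∔ b · s ∣ → a ≡ s × b ≡ + 2 · t
    two-squares-unique m {a} {b} {s} {t} z w a≡ s≡ ab≡ su≡ p∤ = a≡s , b≡u
      where
      open ≡-Reasoning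
      u = + 2 · t
      q = + (p ^ m)
      d = a · u ⊟ b · s
      y = a · s ∔ b · u
      instance
        q≢0 : NonZero (p ^ m)
        q≢0 = ℕ.m^n≢0 p m

      product : d · (a · u ∔ b · s) ≡ q · (a · a ⊟ s · s)
      product = begin
        d · (a · u ∔ b · s)  ≡⟨ lem a b s u ⟩
        (s · s ∔ u · u) · (a · a) ⊟ (a · a ∔ b · b) · (s · s)  ≡⟨ cong₂ (λ v v′ → v · (a · a) ⊟ v′ · (s · s)) su≡ ab≡ ⟩
        q · (a · a) ⊟ q · (s · s)  ≡⟨ lem′ q (a · a) (s · s) ⟩
        q · (a · a ⊟ s · s)  ∎
        where
        lem : ∀ a b s u → (a · u ⊟ b · s) · (a · u ∔ b · s) ≡ (s · s ∔ u · u) · (a · a) ⊟ (a · a ∔ b · b) · (s · s)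
        lem = solve-∀
        lem′ : ∀ q x y → q · x ⊟ q · y ≡ q · (x ⊟ y)
        lem′ = solve-∀

      q∣d : p ^ m ∣ ∣ d ∣
      q∣d = p^m∣x*y⇒p^m∣x pr m p∤ (subst (p ^ m ∣_)
        (trans (sym (ℤ.abs-* q (a · a ⊟ s · s))) (trans (cong ∣_∣ (sym product)) (ℤ.abs-* d (a · u ∔ b · s))))
        (m∣m*n ∣ a · a ⊟ s · s ∣))

      y≢0 : ¬ (y ≡ 0ℤ)
      y≢0 y≡0 = 1+2y≢0 (+ 2 · (z ∔ w) ∔ + 8 · z · w ∔ b · t)
        (trans (lem z w b t) (trans (cong₂ (λ x x′ → x · x′ ∔ b · u) (sym a≡) (sym s≡)) y≡0))
        where
        lem : ∀ z w b t → 1ℤ ∔ + 2 · (+ 2 · (z ∔ w) ∔ + 8 · z · w ∔ b · t)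
          ≡ (1ℤ ∔ + 4 · z) · (1ℤ ∔ + 4 · w) ∔ b · (+ 2 · t)
        lem = solve-∀

      norm : ∣ d ∣ * ∣ d ∣ + ∣ y ∣ * ∣ y ∣ ≡ p ^ m * p ^ m
      norm = ℤ.+-injective (begin
        + (∣ d ∣ * ∣ d ∣ + ∣ y ∣ * ∣ y ∣)  ≡⟨ cong₂ _∔_ (abs-square d) (abs-square y) ⟨
        d · d ∔ y · y  ≡⟨ lem a b s u ⟩
        (a · a ∔ b · b) · (s · s ∔ u · u)  ≡⟨ cong₂ _·_ ab≡ su≡ ⟩
        q · q  ≡⟨ ℤ.pos-* (p ^ m) (p ^ m) ⟨
        + (p ^ m * p ^ m)  ∎)
        where
        lem : ∀ a b s u → (a · u ⊟ b · s) · (a · u ⊟ b · s) ∔ (a · s ∔ b · u) · (a · s ∔ b · u)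
          ≡ (a · a ∔ b · b) · (s · s ∔ u · u)
        lem = solve-∀

      d≡0 : d ≡ 0ℤ
      d≡0 with ∣ d ∣ in eq
      ... | zero  = ℤ.∣i∣≡0⇒i≡0 eq
      ... | suc n = ⊥-elim (ℕ.<⇒≱ (subst (∣ d ∣ * ∣ d ∣ <_) norm (ℕ.m<m+n (∣ d ∣ * ∣ d ∣) y²>0)) (ℕ.*-mono-≤ q≤d q≤d))
        where
        q≤d : p ^ m ≤ ∣ d ∣
        q≤d = ∣⇒≤ {{subst NonZero (sym eq) _}} q∣d
        y²>0 : 0 < ∣ y ∣ * ∣ y ∣
        y²>0 = ℕ.n≢0⇒n>0 (λ y²≡0 → y≢0 (ℤ.∣i∣≡0⇒i≡0 ([ (λ e → e) , (λ e → e) ]′ (ℕ.m*n≡0⇒m≡0∨n≡0 ∣ y ∣ y²≡0))))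

      a²≡s² : a · a ≡ s · s
      a²≡s² = ℤ.i-j≡0⇒i≡j _ _ (ℤ.*-cancelˡ-≡ q (a · a ⊟ s · s) 0ℤ (begin
        q · (a · a ⊟ s · s)  ≡⟨ product ⟨
        d · (a · u ∔ b · s)  ≡⟨ cong (_· (a · u ∔ b · s)) d≡0 ⟩
        0ℤ · (a · u ∔ b · s)  ≡⟨ ℤ.*-zeroˡ (a · u ∔ b · s) ⟩
        0ℤ  ≡⟨ ℤ.*-zeroʳ q ⟨
        q · 0ℤ  ∎))

      a≡s : a ≡ s
      a≡s = 1mod4-square-injective z w a≡ s≡ a²≡s²

      s≢0 : ¬ (s ≡ 0ℤ)
      s≢0 s≡0 = 1+4y≢0 w (trans (sym s≡) s≡0)

      b≡u : b ≡ u
      b≡u = ℤ.*-cancelˡ-≡ s b u {{ℤ.≢-nonZero s≢0}} (begin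
        s · b  ≡⟨ ℤ.*-comm s b ⟩
        b · s  ≡⟨ ℤ.i-j≡0⇒i≡j (a · u) (b · s) d≡0 ⟨
        a · u  ≡⟨ cong (_· u) a≡s ⟩
        s · u  ∎)

  x≡-x⇒x≡0 : ∀ x → x ≡ ⊝ x → x ≡ 0ℤ
  x≡-x⇒x≡0 (+ zero) _ = ≡.refl
  x≡-x⇒x≡0 (+ suc n) ()
  x≡-x⇒x≡0 ℤ.-[1+ n ] ()

open PowerSeries using (shift; coeff; ⁄-unique; geomPart-suc)
open Recursion using (Coords; ⟨_,_,_,_⟩; value; step; coords; norm-ℤ; numer₁; numer₂; denom₁; denom₂; rational₁; rational₂)
open NumberTheory

-- Field arithmetic, sums over the field, and its cyclic group of units.

module Field {c ℓ} (F : FiniteField c ℓ) where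
  open FiniteField F public hiding (zero)
  open RingProperties ring public using (-‿involutive; -0#≈0#; -‿distribʳ-*; -‿distribˡ-*; -1*x≈-x; +-cancelˡ; +-cancelʳ; -‿+-comm)
  open SetoidReasoning setoid

  infixr 8 _^_
  _^_ : Carrier → ℕ → Carrier
  _^_ = pow F

  ^-cong : ∀ {x y} n → x ≈ y → x ^ n ≈ y ^ n
  ^-cong zero    x≈y = refl
  ^-cong (suc n) x≈y = *-cong x≈y (^-cong n x≈y)

  ^-+ : ∀ x m n → x ^ (m ℕ.+ n) ≈ x ^ m * x ^ n
  ^-+ x zero    n = sym (*-identityˡ _)
  ^-+ x (suc m) n = trans (*-congˡ (^-+ x m n)) (sym (*-assoc _ _ _))

  1^ : ∀ n → 1# ^ n ≈ 1#
  1^ zero    = refl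
  1^ (suc n) = trans (*-identityˡ _) (1^ n)

  ^-* : ∀ x m n → x ^ (m ℕ.* n) ≈ (x ^ n) ^ m
  ^-* x zero    n = refl
  ^-* x (suc m) n = trans (^-+ x n (m ℕ.* n)) (*-congˡ (^-* x m n))

  *-swap : ∀ a b c d → (a * b) * (c * d) ≈ (a * c) * (b * d)
  *-swap a b c d = begin
    (a * b) * (c * d)  ≈⟨ *-assoc a b (c * d) ⟩
    a * (b * (c * d))  ≈⟨ *-congˡ (*-assoc b c d) ⟨
    a * ((b * c) * d)  ≈⟨ *-congˡ (*-congʳ (*-comm b c)) ⟩
    a * ((c * b) * d)  ≈⟨ *-congˡ (*-assoc c b d) ⟩
    a * (c * (b * d))  ≈⟨ *-assoc a c (b * d) ⟨
    (a * c) * (b * d)  ∎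

  ^-distrib-* : ∀ x y n → (x * y) ^ n ≈ x ^ n * y ^ n
  ^-distrib-* x y zero    = sym (*-identityˡ _)
  ^-distrib-* x y (suc n) = trans (*-congˡ (^-distrib-* x y n)) (*-swap x y (x ^ n) (y ^ n))

  1≉0 : ¬ (1# ≈ 0#)
  1≉0 = 0≉1 ∘ sym

  *-cancelˡ : ∀ x {y z} → ¬ (x ≈ 0#) → x * y ≈ x * z → y ≈ z
  *-cancelˡ x {y} {z} x≉0 xy≈xz with inverse x x≉0
  ... | x⁻¹ , xx⁻¹≈1 = begin
    y  ≈⟨ undo y ⟨
    x⁻¹ * (x * y)  ≈⟨ *-congˡ xy≈xz ⟩
    x⁻¹ * (x * z)  ≈⟨ undo z ⟩
    z  ∎
    where
    undo : ∀ w → x⁻¹ * (x * w) ≈ w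
    undo w = trans (sym (*-assoc _ _ _)) (trans (*-congʳ (trans (*-comm _ _) xx⁻¹≈1)) (*-identityˡ w))

  x*y≈0⇒ : ∀ x {y} → ¬ (x ≈ 0#) → x * y ≈ 0# → y ≈ 0#
  x*y≈0⇒ x x≉0 xy≈0 = *-cancelˡ x x≉0 (trans xy≈0 (sym (zeroʳ x)))

  *-≉0 : ∀ {x y} → ¬ (x ≈ 0#) → ¬ (y ≈ 0#) → ¬ (x * y ≈ 0#)
  *-≉0 x≉0 y≉0 = y≉0 ∘ x*y≈0⇒ _ x≉0

  ^-≉0 : ∀ {x} n → ¬ (x ≈ 0#) → ¬ (x ^ n ≈ 0#)
  ^-≉0 zero    x≉0 = 1≉0
  ^-≉0 (suc n) x≉0 = *-≉0 x≉0 (^-≉0 n x≉0)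

  x-y≈0⇒x≈y : ∀ {x y} → x - y ≈ 0# → x ≈ y
  x-y≈0⇒x≈y {x} {y} eq = +-cancelʳ (- y) x y (trans eq (sym (-‿inverseʳ y)))

  x-x≈0 : ∀ {x y} → x ≈ y → x - y ≈ 0#
  x-x≈0 {x} {y} eq = trans (+-congʳ eq) (-‿inverseʳ y)

  x+y-y≈x : ∀ x y → (x + y) - y ≈ x
  x+y-y≈x x y = trans (+-assoc x y (- y)) (trans (+-congˡ (-‿inverseʳ y)) (+-identityʳ x))

  x-y+y≈x : ∀ x y → (x - y) + y ≈ x
  x-y+y≈x x y = trans (+-assoc x (- y) y) (trans (+-congˡ (-‿inverseˡ y)) (+-identityʳ x))

  x-[x-y]≈y : ∀ x y → x - (x - y) ≈ y
  x-[x-y]≈y x y = begin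
    x - (x - y)  ≈⟨ +-congˡ (-‿+-comm x (- y)) ⟨
    x + (- x + - (- y))  ≈⟨ +-assoc x (- x) (- (- y)) ⟨
    (x - x) + - (- y)  ≈⟨ +-cong (-‿inverseʳ x) (-‿involutive y) ⟩
    0# + y  ≈⟨ +-identityˡ y ⟩
    y  ∎

  *-distribˡ-- : ∀ x y z → x * (y - z) ≈ x * y - x * z
  *-distribˡ-- x y z = trans (distribˡ x y (- z)) (+-congˡ (sym (-‿distribʳ-* x z)))

  -1# : Carrier
  -1# = - 1#

  -1≉0 : ¬ (-1# ≈ 0#)
  -1≉0 eq = 1≉0 (trans (sym (-‿involutive 1#)) (trans (-‿cong eq) -0#≈0#))

  index : Carrier → Fin size
  index x = proj₁ (enum-surj x)

  enum-index : ∀ x → enum (index x) ≈ x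
  enum-index x = proj₂ (enum-surj x)

  -- The ring of values is a parameter: counts and convolutions are summed in ℤ, reduced Jacobi sums
  -- in `F` itself.
  module Summation {a b} (R : CommutativeRing a b) where
    private module R = CommutativeRing R
    open SumProperties R.semiring public using (sum; sum-cong-≋; ∑-comm; ∑-distrib-+; sum-permute; *-distribˡ-sum)

    Congruent : (Carrier → R.Carrier) → Set _
    Congruent f = ∀ {x y} → x ≈ y → f x R.≈ f y

    ∑ : (Carrier → R.Carrier) → R.Carrier
    ∑ f = sum (λ i → f (enum i))

    -- Two enumerations differ by a permutation. Scaling, translation and reflection each give a new
    -- enumeration; so do the powers of a generator.
    ∑-enumeration : ∀ {m} (e : Fin m → Carrier) → (∀ i j → e i ≈ e j → i ≡ j) →
      (∀ x → ∃ λ i → e i ≈ x) → ∀ f → Congruent f → ∑ f R.≈ sum (λ i → f (e i))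
    ∑-enumeration e e-inj e-surj f f-cong = R.trans
      (sum-permute (λ i → f (enum i)) (permutation to from to∘from from∘to))
      (sum-cong-≋ (λ i → f-cong (enum-index (e i))))
      where
      to = λ i → index (e i)
      from = λ j → proj₁ (e-surj (enum j))
      to∘from : ∀ j → to (from j) ≡ j
      to∘from j = enum-inj _ _ (trans (enum-index _) (proj₂ (e-surj (enum j))))
      from∘to : ∀ i → from (to i) ≡ i
      from∘to i = e-inj _ _ (trans (proj₂ (e-surj _)) (enum-index (e i)))

    ∑-reindex : ∀ (σ τ : Carrier → Carrier) → (∀ {x y} → x ≈ y → σ x ≈ σ y) →
      (∀ {x y} → σ x ≈ σ y → x ≈ y) → (∀ x → σ (τ x) ≈ x) →
      ∀ f → Congruent f → ∑ f R.≈ ∑ (λ x → f (σ x))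
    ∑-reindex σ τ σ-cong σ-inj σ∘τ = ∑-enumeration (λ i → σ (enum i))
      (λ i j eq → enum-inj i j (σ-inj eq))
      (λ x → index (τ x) , trans (σ-cong (enum-index (τ x))) (σ∘τ x))

    ∑-scale : ∀ c → ¬ (c ≈ 0#) → ∀ f → Congruent f → ∑ f R.≈ ∑ (λ x → f (c * x))
    ∑-scale c c≉0 with inverse c c≉0
    ... | c⁻¹ , cc⁻¹≈1 = ∑-reindex (c *_) (c⁻¹ *_) *-congˡ (*-cancelˡ c c≉0)
      (λ x → trans (sym (*-assoc _ _ _)) (trans (*-congʳ cc⁻¹≈1) (*-identityˡ x)))

    ∑-translate : ∀ c f → Congruent f → ∑ f R.≈ ∑ (λ x → f (c + x))
    ∑-translate c = ∑-reindex (λ x → c + x) (λ x → - c + x) +-congˡ (λ {x} {y} → +-cancelˡ c x y)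
      (λ x → trans (sym (+-assoc _ _ _)) (trans (+-congʳ (-‿inverseʳ c)) (+-identityˡ x)))

    ∑-reflect : ∀ c f → Congruent f → ∑ f R.≈ ∑ (λ x → f (c - x))
    ∑-reflect c = ∑-reindex (λ x → c - x) (λ x → c - x) (λ eq → +-congˡ (-‿cong eq))
      (λ {x} {y} eq → trans (sym (-‿involutive x)) (trans (-‿cong (+-cancelˡ c (- x) (- y) eq)) (-‿involutive y)))
      (x-[x-y]≈y c)

    ∑-cong : ∀ {f g : Carrier → R.Carrier} → (∀ x → f x R.≈ g x) → ∑ f R.≈ ∑ g
    ∑-cong eq = sum-cong-≋ (λ i → eq (enum i))

    ∑-+ : ∀ f g → ∑ (λ x → f x R.+ g x) R.≈ ∑ f R.+ ∑ g
    ∑-+ f g = ∑-distrib-+ (λ i → f (enum i)) (λ i → g (enum i))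

    ∑-* : ∀ c f → ∑ (λ x → c R.* f x) R.≈ c R.* ∑ f
    ∑-* c f = R.sym (*-distribˡ-sum c (λ i → f (enum i)))

    ∑-swap : ∀ (f : Carrier → Carrier → R.Carrier) → ∑ (λ x → ∑ (λ y → f x y)) R.≈ ∑ (λ y → ∑ (λ x → f x y))
    ∑-swap f = ∑-comm (λ i j → f (enum i) (enum j))

  module Generator (g : Carrier) (gen : IsGenerator F g) where
    g≉0 : ¬ (g ≈ 0#)
    g≉0 = proj₁ gen

    log : ∀ x → ¬ (x ≈ 0#) → ℕ
    log x x≉0 = proj₁ (proj₂ gen x x≉0)

    g^log : ∀ x x≉0 → g ^ log x x≉0 ≈ x
    g^log x x≉0 = proj₂ (proj₂ gen x x≉0)

    ord : ℕ
    ord = size ℕ.∸ 1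

    size≡1+ord : size ≡ suc ord
    -- `index 0#` inhabits `Fin size` and so rules out size 0, which makes the truncated subtraction
    -- exact.
    size≡1+ord with size | index 0#
    ... | suc n | _ = ≡.refl

    ^-% : ∀ x d .{{_ : NonZero d}} → x ^ d ≈ 1# → ∀ i → x ^ i ≈ x ^ (i ℕ.% d)
    ^-% x d x^d≈1 i = begin
      x ^ i  ≡⟨ ≡.cong (x ^_) (m≡m%n+[m/n]*n i d) ⟩
      x ^ (i ℕ.% d ℕ.+ i ℕ./ d ℕ.* d)  ≈⟨ ^-+ x (i ℕ.% d) _ ⟩
      x ^ (i ℕ.% d) * x ^ (i ℕ./ d ℕ.* d)  ≈⟨ *-congˡ (trans (^-* x (i ℕ./ d) d) (trans (^-cong (i ℕ./ d) x^d≈1) (1^ (i ℕ./ d)))) ⟩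
      x ^ (i ℕ.% d) * 1#  ≈⟨ *-identityʳ _ ⟩
      x ^ (i ℕ.% d)  ∎

    -- Logarithms modulo d, with one extra place for 0, inject the field into d + 1 places.
    ord≤ : ∀ d .{{_ : NonZero d}} → g ^ d ≈ 1# → ord ℕ.≤ d
    ord≤ d g^d≈1 = ℕ.≤-pred (subst (ℕ._≤ suc d) size≡1+ord (injective⇒≤ {f = f} f-inj))
      where
      f : Fin size → Fin (suc d)
      f i with enum i ≟ 0#
      ... | yes _   = zero
      ... | no  x≉0 = suc (fromℕ< (m%n<n (log (enum i) x≉0) d))
      f-inj : ∀ {i j} → f i ≡ f j → i ≡ j
      f-inj {i} {j} eq with enum i ≟ 0# | enum j ≟ 0#
      ... | yes p  | yes p′ = enum-inj i j (trans p (sym p′))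
      ... | no  p  | no  p′ = enum-inj i j (begin
        enum i  ≈⟨ g^log (enum i) p ⟨
        g ^ log (enum i) p  ≈⟨ ^-% g d g^d≈1 (log (enum i) p) ⟩
        g ^ (log (enum i) p ℕ.% d)  ≡⟨ ≡.cong (g ^_) (fromℕ<-injective _ _ (m%n<n _ d) (m%n<n _ d) (suc-inj eq)) ⟩
        g ^ (log (enum j) p′ ℕ.% d)  ≈⟨ ^-% g d g^d≈1 (log (enum j) p′) ⟨
        g ^ log (enum j) p′  ≈⟨ g^log (enum j) p′ ⟩
        enum j  ∎)
        where
        suc-inj : ∀ {n} {i j : Fin n} → Fin.suc i ≡ suc j → i ≡ j
        suc-inj ≡.refl = ≡.refl

    g^[j-i]≈1 : ∀ {i j} → i ℕ.≤ j → g ^ i ≈ g ^ j → g ^ (j ℕ.∸ i) ≈ 1#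
    g^[j-i]≈1 {i} {j} i≤j eq = *-cancelˡ (g ^ i) (^-≉0 i g≉0) (begin
      g ^ i * g ^ (j ℕ.∸ i)  ≈⟨ ^-+ g i (j ℕ.∸ i) ⟨
      g ^ (i ℕ.+ (j ℕ.∸ i))  ≡⟨ ≡.cong (g ^_) (ℕ.m+[n∸m]≡n i≤j) ⟩
      g ^ j  ≈⟨ eq ⟨
      g ^ i  ≈⟨ *-identityʳ _ ⟨
      g ^ i * 1#  ∎)

    -- Pigeonhole on 0, g⁰, ..., g^ord: two of the powers agree, so g^d = 1 for some positive d up
    -- to `ord`, and `ord≤` forces equality.
    g^ord≈1 : g ^ ord ≈ 1#
    g^ord≈1 with pigeonhole (ℕ.n<1+n size) f
      where
      f : Fin (suc size) → Fin size
      f zero    = index 0#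
      f (suc i) = index (g ^ toℕ i)
    ... | zero  , suc j , _       , eq = ⊥-elim (^-≉0 (toℕ j) g≉0 (begin
      g ^ toℕ j  ≈⟨ enum-index _ ⟨
      enum (index (g ^ toℕ j)) ≡⟨ ≡.cong enum eq ⟨
      enum (index 0#)  ≈⟨ enum-index 0# ⟩
      0#  ∎))
    ... | suc i , suc j , s≤s i<j , eq = subst (λ n → g ^ n ≈ 1#) (ℕ.≤-antisym d≤ (ord≤ d {{ℕ.>-nonZero (ℕ.m<n⇒0<n∸m i<j)}} g^d≈1)) g^d≈1
      where
      d = toℕ j ℕ.∸ toℕ i
      g^d≈1 : g ^ d ≈ 1#
      g^d≈1 = g^[j-i]≈1 (ℕ.<⇒≤ i<j) (begin
        g ^ toℕ i  ≈⟨ enum-index _ ⟨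
        enum (index (g ^ toℕ i)) ≡⟨ ≡.cong enum eq ⟩
        enum (index (g ^ toℕ j)) ≈⟨ enum-index _ ⟩
        g ^ toℕ j  ∎)
      d≤ : d ℕ.≤ ord
      d≤ = ℕ.≤-trans (ℕ.m∸n≤m (toℕ j) (toℕ i)) (ℕ.≤-pred (subst (toℕ j ℕ.<_) size≡1+ord (toℕ<n j)))

    ord-nonZero : NonZero ord
    ord-nonZero with ord in eq
    ... | suc _ = _
    ... | zero  = ⊥-elim (1≉0 (trans (sym (enum-index 1#)) (trans
      (reflexive (≡.cong enum (all-equal (subst (ℕ._≤ 1) (≡.sym (≡.trans size≡1+ord (≡.cong suc eq))) ℕ.≤-refl) (index 1#) (index 0#)))) (enum-index 0#))))
      where
      all-equal : ∀ {n} → n ℕ.≤ 1 → (i j : Fin n) → i ≡ j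
      all-equal (s≤s z≤n) zero zero = ≡.refl

    ^-injective-< : ∀ {i j} → i ℕ.< ord → j ℕ.< ord → g ^ i ≈ g ^ j → i ≡ j
    ^-injective-< {i} {j} i< j< eq with ℕ.<-cmp i j
    ... | tri≈ _ i≡j _ = i≡j
    ... | tri< i<j _ _ = ⊥-elim (ℕ.<⇒≱ (ℕ.≤-<-trans (ℕ.m∸n≤m j i) j<) (ord≤ _ {{ℕ.>-nonZero (ℕ.m<n⇒0<n∸m i<j)}} (g^[j-i]≈1 (ℕ.<⇒≤ i<j) eq)))
    ... | tri> _ _ j<i = ⊥-elim (ℕ.<⇒≱ (ℕ.≤-<-trans (ℕ.m∸n≤m i j) i<) (ord≤ _ {{ℕ.>-nonZero (ℕ.m<n⇒0<n∸m j<i)}} (g^[j-i]≈1 (ℕ.<⇒≤ j<i) (sym eq))))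

    -- `IsGenerator` promises an exponent without a bound; this is its residue modulo `ord`. The 0
    -- at zero is a default, masked by `lift`.
    exponent : Carrier → ℕ
    exponent x with x ≟ 0#
    ... | yes _   = 0
    ... | no  x≉0 = (log x x≉0 ℕ.% ord) {{ord-nonZero}}

    exponent<ord : ∀ x → exponent x ℕ.< ord
    exponent<ord x with x ≟ 0#
    ... | yes _   = ℕ.>-nonZero⁻¹ ord {{ord-nonZero}}
    ... | no  x≉0 = m%n<n (log x x≉0) ord {{ord-nonZero}}

    g^exponent : ∀ {x} → ¬ (x ≈ 0#) → g ^ exponent x ≈ x
    g^exponent {x} x≉0′ with x ≟ 0#
    ... | yes x≈0 = ⊥-elim (x≉0′ x≈0)
    ... | no  x≉0 = trans (sym (^-% g ord {{ord-nonZero}} g^ord≈1 (log x x≉0))) (g^log x x≉0)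

    -- This second enumeration turns sums over the field into sums over exponents.
    enum′ : Fin (suc ord) → Carrier
    enum′ zero    = 0#
    enum′ (suc j) = g ^ toℕ j

    enum′-inj : ∀ i j → enum′ i ≈ enum′ j → i ≡ j
    enum′-inj zero    zero    _  = ≡.refl
    enum′-inj zero    (suc j) eq = ⊥-elim (^-≉0 (toℕ j) g≉0 (sym eq))
    enum′-inj (suc i) zero    eq = ⊥-elim (^-≉0 (toℕ i) g≉0 eq)
    enum′-inj (suc i) (suc j) eq = ≡.cong suc (toℕ-injective (^-injective-< (toℕ<n i) (toℕ<n j) eq))

    enum′-surj : ∀ x → ∃ λ i → enum′ i ≈ x
    enum′-surj x with x ≟ 0#
    ... | yes x≈0 = zero , sym x≈0
    ... | no  x≉0 = suc (fromℕ< (exponent<ord x)) ,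
      trans (reflexive (≡.cong (g ^_) (toℕ-fromℕ< (exponent<ord x)))) (g^exponent x≉0)

    g^-periodic : ∀ {i j} → g ^ i ≈ g ^ j → (i ℕ.% ord) {{ord-nonZero}} ≡ (j ℕ.% ord) {{ord-nonZero}}
    g^-periodic {i} {j} eq = ^-injective-< (m%n<n i ord {{ord-nonZero}}) (m%n<n j ord {{ord-nonZero}})
      (trans (sym (^-% g ord {{ord-nonZero}} g^ord≈1 i)) (trans eq (^-% g ord {{ord-nonZero}} g^ord≈1 j)))

-- Convolution of integer-valued functions, and characters as lifted tables.

module Convolution {c ℓ} (F : FiniteField c ℓ) (g : FiniteField.Carrier F) (gen : IsGenerator F g) where
  open Field F public
  open Generator g gen public
  open Summation ℤ.+-*-commutativeRing public
  open ≡-Reasoning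

  Q : ℤ
  Q = + size

  Q≡1+ord : Q ≡ 1ℤ ∔ + ord
  Q≡1+ord = cong +_ size≡1+ord

  ∑-cyclic : ∀ f → Congruent f → ∑ f ≡ f 0# ∔ sum {ord} (λ j → f (g ^ toℕ j))
  ∑-cyclic f f-cong = ∑-enumeration enum′ enum′-inj enum′-surj f f-cong

  sum-const : ∀ n x → sum {n} (λ _ → x) ≡ + n · x
  sum-const zero    x = ≡.sym (ℤ.*-zeroˡ x)
  sum-const (suc n) x = ≡.trans (cong (_∔_ x) (sum-const n x)) (≡.sym (ℤ.suc-* (+ n) x))

  ∑-const : ∀ x → ∑ (λ _ → x) ≡ Q · x
  ∑-const = sum-const size

  ∑-constant-off-zero : ∀ f → Congruent f → ∀ r → (∀ {x} → ¬ (x ≈ 0#) → f x ≡ r) → ∑ f ≡ f 0# ∔ + ord · r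
  ∑-constant-off-zero f f-cong r eq = ≡.trans (∑-cyclic f f-cong)
    (cong (_∔_ (f 0#)) (≡.trans (sum-cong-≋ {ord} (λ j → eq (^-≉0 (toℕ j) g≉0))) (sum-const ord r)))

  infixl 7 _⋆_
  _⋆_ : (Carrier → ℤ) → (Carrier → ℤ) → Carrier → ℤ
  (f ⋆ h) x = ∑ (λ a → f a · h (x - a))

  ⋆-congruent : ∀ f {h} → Congruent h → Congruent (f ⋆ h)
  ⋆-congruent f h-cong x≈y = ∑-cong (λ a → cong (f a ·_) (h-cong (+-congʳ {x = - a} x≈y)))

  *-congruent : ∀ {f h} → Congruent f → Congruent h → Congruent (λ x → f x · h x)
  *-congruent f-cong h-cong x≈y = cong₂ _·_ (f-cong x≈y) (h-cong x≈y)

  ⋆-comm : ∀ {f h} → Congruent f → Congruent h → ∀ x → (f ⋆ h) x ≡ (h ⋆ f) x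
  ⋆-comm {f} {h} f-cong h-cong x = ≡.trans
    (∑-reflect x (λ a → f a · h (x - a)) (*-congruent f-cong (λ eq → h-cong (+-congˡ (-‿cong eq)))))
    (∑-cong (λ a → ≡.trans (ℤ.*-comm (f (x - a)) (h (x - (x - a)))) (cong (_· f (x - a)) (h-cong (x-[x-y]≈y x a)))))

  ⋆-congˡ : ∀ {f f′} → f ≗ f′ → ∀ h x → (f ⋆ h) x ≡ (f′ ⋆ h) x
  ⋆-congˡ eq h x = ∑-cong (λ a → cong (_· h (x - a)) (eq a))

  ⋆-congʳ : ∀ f {h h′} → h ≗ h′ → ∀ x → (f ⋆ h) x ≡ (f ⋆ h′) x
  ⋆-congʳ f eq x = ∑-cong (λ a → cong (f a ·_) (eq (x - a)))

  ⋆-linearʳ : ∀ f k h h′ x → (f ⋆ (λ y → k · h y ∔ h′ y)) x ≡ k · (f ⋆ h) x ∔ (f ⋆ h′) x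
  ⋆-linearʳ f k h h′ x = begin
    ∑ (λ a → f a · (k · h (x - a) ∔ h′ (x - a)))  ≡⟨ ∑-cong (λ a → lem k (f a) (h (x - a)) (h′ (x - a))) ⟩
    ∑ (λ a → k · (f a · h (x - a)) ∔ f a · h′ (x - a))  ≡⟨ ∑-+ (λ a → k · (f a · h (x - a))) (λ a → f a · h′ (x - a)) ⟩
    ∑ (λ a → k · (f a · h (x - a))) ∔ (f ⋆ h′) x  ≡⟨ cong (_∔ (f ⋆ h′) x) (∑-* k (λ a → f a · h (x - a))) ⟩
    k · (f ⋆ h) x ∔ (f ⋆ h′) x  ∎
    where
    lem : ∀ k x y z → x · (k · y ∔ z) ≡ k · (x · y) ∔ x · z
    lem = solve-∀

  ⋆-linearˡ : ∀ k f f′ h x → ((λ y → k · f y ∔ f′ y) ⋆ h) x ≡ k · (f ⋆ h) x ∔ (f′ ⋆ h) x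
  ⋆-linearˡ k f f′ h x = begin
    ∑ (λ a → (k · f a ∔ f′ a) · h (x - a))  ≡⟨ ∑-cong (λ a → lem k (f a) (f′ a) (h (x - a))) ⟩
    ∑ (λ a → k · (f a · h (x - a)) ∔ f′ a · h (x - a))  ≡⟨ ∑-+ (λ a → k · (f a · h (x - a))) (λ a → f′ a · h (x - a)) ⟩
    ∑ (λ a → k · (f a · h (x - a))) ∔ (f′ ⋆ h) x  ≡⟨ cong (_∔ (f′ ⋆ h) x) (∑-* k (λ a → f a · h (x - a))) ⟩
    k · (f ⋆ h) x ∔ (f′ ⋆ h) x  ∎
    where
    lem : ∀ k x y z → (k · x ∔ y) · z ≡ k · (x · z) ∔ y · z
    lem = solve-∀

  ⋆-scaleʳ : ∀ f k h x → (f ⋆ (λ y → k · h y)) x ≡ k · (f ⋆ h) x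
  ⋆-scaleʳ f k h x = ≡.trans (∑-cong (λ a → lem k (f a) (h (x - a)))) (∑-* k (λ a → f a · h (x - a)))
    where
    lem : ∀ k x y → x · (k · y) ≡ k · (x · y)
    lem = solve-∀

  ⋆-scaleˡ : ∀ k f h x → ((λ y → k · f y) ⋆ h) x ≡ k · (f ⋆ h) x
  ⋆-scaleˡ k f h x = ≡.trans (∑-cong (λ a → ℤ.*-assoc k (f a) (h (x - a)))) (∑-* k (λ a → f a · h (x - a)))

  ∑-*ʳ : ∀ f k → ∑ (λ x → f x · k) ≡ ∑ f · k
  ∑-*ʳ f k = ≡.trans (∑-cong (λ x → ℤ.*-comm (f x) k)) (≡.trans (∑-* k f) (ℤ.*-comm k (∑ f)))

  ⋆-assoc : ∀ f {h h′} → Congruent h → Congruent h′ → ∀ x → ((f ⋆ h) ⋆ h′) x ≡ (f ⋆ (h ⋆ h′)) x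
  ⋆-assoc f {h} {h′} h-cong h′-cong x = begin
    ∑ (λ a → ∑ (λ b → f b · h (a - b)) · h′ (x - a))  ≡⟨ ∑-cong (λ a → ∑-*ʳ (λ b → f b · h (a - b)) (h′ (x - a))) ⟨
    ∑ (λ a → ∑ (λ b → f b · h (a - b) · h′ (x - a)))  ≡⟨ ∑-swap (λ a b → f b · h (a - b) · h′ (x - a)) ⟩
    ∑ (λ b → ∑ (λ a → f b · h (a - b) · h′ (x - a)))  ≡⟨ ∑-cong (λ b → ∑-cong (λ a → ℤ.*-assoc (f b) (h (a - b)) (h′ (x - a)))) ⟩
    ∑ (λ b → ∑ (λ a → f b · (h (a - b) · h′ (x - a))))  ≡⟨ ∑-cong (λ b → ∑-* (f b) (λ a → h (a - b) · h′ (x - a))) ⟩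
    ∑ (λ b → f b · ∑ (λ a → h (a - b) · h′ (x - a)))  ≡⟨ ∑-cong (λ b → cong (f b ·_) (inner b)) ⟩
    ∑ (λ b → f b · (h ⋆ h′) (x - b))  ∎
    where
    inner : ∀ b → ∑ (λ a → h (a - b) · h′ (x - a)) ≡ (h ⋆ h′) (x - b)
    inner b = ≡.trans
      (∑-translate b (λ a → h (a - b) · h′ (x - a))
        (*-congruent (λ eq → h-cong (+-congʳ eq)) (λ eq → h′-cong (+-congˡ (-‿cong eq)))))
      (∑-cong (λ a → cong₂ _·_
        (h-cong (trans (+-congʳ (+-comm b a)) (x+y-y≈x a b)))
        (h′-cong (trans (+-congˡ (sym (-‿+-comm b a))) (sym (+-assoc x (- b) (- a)))))))

  ∑-⋆ : ∀ f {h} → Congruent h → ∑ (f ⋆ h) ≡ ∑ f · ∑ h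
  ∑-⋆ f {h} h-cong = begin
    ∑ (λ x → ∑ (λ a → f a · h (x - a)))  ≡⟨ ∑-swap (λ x a → f a · h (x - a)) ⟩
    ∑ (λ a → ∑ (λ x → f a · h (x - a)))  ≡⟨ ∑-cong (λ a → ∑-* (f a) (λ x → h (x - a))) ⟩
    ∑ (λ a → f a · ∑ (λ x → h (x - a)))  ≡⟨ ∑-cong (λ a → cong (f a ·_) (≡.sym (shifted a))) ⟩
    ∑ (λ a → f a · ∑ h)  ≡⟨ ∑-*ʳ f (∑ h) ⟩
    ∑ f · ∑ h  ∎
    where
    shifted : ∀ a → ∑ h ≡ ∑ (λ x → h (x - a))
    shifted a = ≡.trans (∑-translate (- a) h h-cong) (∑-cong (λ x → h-cong (+-comm (- a) x)))

  δ : Carrier → ℤ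
  δ x with x ≟ 0#
  ... | yes _ = 1ℤ
  ... | no  _ = 0ℤ

  δ-zero : ∀ {x} → x ≈ 0# → δ x ≡ 1ℤ
  δ-zero {x} x≈0 with x ≟ 0#
  ... | yes _   = ≡.refl
  ... | no  x≉0 = ⊥-elim (x≉0 x≈0)

  δ-nonzero : ∀ {x} → ¬ (x ≈ 0#) → δ x ≡ 0ℤ
  δ-nonzero {x} x≉0 with x ≟ 0#
  ... | yes x≈0 = ⊥-elim (x≉0 x≈0)
  ... | no  _   = ≡.refl

  δ-cong : Congruent δ
  δ-cong {x} {y} x≈y with y ≟ 0#
  ... | yes y≈0 = δ-zero (trans x≈y y≈0)
  ... | no  y≉0 = δ-nonzero (λ x≈0 → y≉0 (trans (sym x≈y) x≈0))

  δ-⋆ : ∀ {f} → Congruent f → ∀ x → (δ ⋆ f) x ≡ f x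
  δ-⋆ {f} f-cong x = begin
    (δ ⋆ f) x  ≡⟨ ∑-constant-off-zero (λ a → δ a · f (x - a))
                                                (*-congruent δ-cong (λ eq → f-cong (+-congˡ (-‿cong eq)))) 0ℤ
                                                (λ {a} a≉0 → ≡.trans (cong (_· f (x - a)) (δ-nonzero a≉0)) (ℤ.*-zeroˡ (f (x - a)))) ⟩
    δ 0# · f (x - 0#) ∔ + ord · 0ℤ  ≡⟨ cong₂ _∔_ (cong₂ _·_ (δ-zero refl) (f-cong (trans (+-congˡ -0#≈0#) (+-identityʳ x)))) (ℤ.*-zeroʳ (+ ord)) ⟩
    1ℤ · f x ∔ 0ℤ  ≡⟨ lem (f x) ⟩
    f x  ∎
    where
    lem : ∀ x → 1ℤ · x ∔ 0ℤ ≡ x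
    lem = solve-∀

  E : Carrier → ℤ
  E x = Q · δ x ∔ -1ℤ

  E-cong : Congruent E
  E-cong eq = cong (λ z → Q · z ∔ -1ℤ) (δ-cong eq)

  E-zero : E 0# ≡ + ord
  E-zero = ≡.trans (cong₂ (λ u v → u · v ∔ -1ℤ) Q≡1+ord (δ-zero refl)) (lem (+ ord))
    where
    lem : ∀ x → (1ℤ ∔ x) · 1ℤ ∔ -1ℤ ≡ x
    lem = solve-∀

  E-nonzero : ∀ {x} → ¬ (x ≈ 0#) → E x ≡ -1ℤ
  E-nonzero x≉0 = ≡.trans (cong (λ z → Q · z ∔ -1ℤ) (δ-nonzero x≉0)) (cong (_∔ -1ℤ) (ℤ.*-zeroʳ Q))

  const-⋆ : ∀ k {f} → Congruent f → ∀ x → ((λ _ → k) ⋆ f) x ≡ k · ∑ f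
  const-⋆ k {f} f-cong x = ≡.trans (∑-* k (λ a → f (x - a))) (cong (k ·_) (≡.sym (∑-reflect x f f-cong)))

  -- E is Q times the unit of the convolution algebra of sum-zero functions.
  E-⋆ : ∀ {f} → Congruent f → ∑ f ≡ 0ℤ → ∀ x → (E ⋆ f) x ≡ Q · f x
  E-⋆ {f} f-cong ∑f≡0 x = begin
    (E ⋆ f) x  ≡⟨ ⋆-linearˡ Q δ (λ _ → -1ℤ) f x ⟩
    Q · (δ ⋆ f) x ∔ ((λ _ → -1ℤ) ⋆ f) x  ≡⟨ cong₂ (λ u v → Q · u ∔ v) (δ-⋆ f-cong x) (≡.trans (const-⋆ -1ℤ f-cong x) (cong (-1ℤ ·_) ∑f≡0)) ⟩
    Q · f x ∔ 0ℤ  ≡⟨ ℤ.+-identityʳ _ ⟩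
    Q · f x  ∎

  -- Substitute a = x b. For characters, x then factors out and a convolution at 1 remains, that is,
  -- a Jacobi sum.
  ⋆-at-nonzero : ∀ {f h} → Congruent f → Congruent h → ∀ {x} → ¬ (x ≈ 0#) →
    (f ⋆ h) x ≡ ∑ (λ b → f (x * b) · h (x * (1# - b)))
  ⋆-at-nonzero {f} {h} f-cong h-cong {x} x≉0 = ≡.trans
    (∑-scale x x≉0 (λ a → f a · h (x - a)) (*-congruent f-cong (λ eq → h-cong (+-congˡ (-‿cong eq)))))
    (∑-cong (λ b → cong (f (x * b) ·_) (h-cong (trans (+-congʳ (sym (*-identityʳ x))) (sym (*-distribˡ-- x 1# b))))))

  -- Negation becomes multiplication by `-1#`, to which the multiplicativity of a character applies.
  ⋆-at-zero : ∀ f {h} → Congruent h → (f ⋆ h) 0# ≡ ∑ (λ a → f a · h (-1# * a))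
  ⋆-at-zero f h-cong = ∑-cong (λ a → cong (f a ·_) (h-cong (trans (+-identityˡ _) (sym (-1*x≈-x a)))))

  unless : ∀ {p} {P : Set p} → Dec P → ℤ → ℤ
  unless (yes _) v = 0ℤ
  unless (no  _) v = v

  -- A table read through the logarithm and extended by 0, the usual convention for a nontrivial
  -- multiplicative character.
  lift : (ℕ → ℤ) → Carrier → ℤ
  lift t x = unless (x ≟ 0#) (t (exponent x))

  lift-zero : ∀ t {x} → x ≈ 0# → lift t x ≡ 0ℤ
  lift-zero t {x} x≈0 = go (x ≟ 0#)
    where
    go : ∀ d → unless d (t (exponent x)) ≡ 0ℤ
    go (yes _)   = ≡.refl
    go (no  x≉0) = ⊥-elim (x≉0 x≈0)

  lift-nonzero : ∀ t {x} → ¬ (x ≈ 0#) → lift t x ≡ t (exponent x)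
  lift-nonzero t {x} x≉0 = go (x ≟ 0#)
    where
    go : ∀ d → unless d (t (exponent x)) ≡ t (exponent x)
    go (yes x≈0) = ⊥-elim (x≉0 x≈0)
    go (no  _)   = ≡.refl

  lift-cong : ∀ t → Congruent (lift t)
  lift-cong t {x} {y} x≈y = go (y ≟ 0#)
    where
    go : Dec (y ≈ 0#) → lift t x ≡ lift t y
    go (yes y≈0) = ≡.trans (lift-zero t (trans x≈y y≈0)) (≡.sym (lift-zero t y≈0))
    go (no  y≉0) = begin
      lift t x  ≡⟨ lift-nonzero t x≉0 ⟩
      t (exponent x)  ≡⟨ cong t (^-injective-< (exponent<ord x) (exponent<ord y)
                            (trans (g^exponent x≉0) (trans x≈y (sym (g^exponent y≉0))))) ⟩
      t (exponent y)  ≡⟨ lift-nonzero t y≉0 ⟨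
      lift t y  ∎
      where
      x≉0 = λ x≈0 → y≉0 (trans (sym x≈y) x≈0)

  Periodic : (ℕ → ℤ) → Set
  Periodic t = ∀ n → t (ord ℕ.+ n) ≡ t n

  periodic-% : ∀ {t} → Periodic t → ∀ i → t i ≡ t ((i ℕ.% ord) {{ord-nonZero}})
  periodic-% {t} per i = ≡.trans (cong t (≡.trans (m≡m%n+[m/n]*n i ord {{ord-nonZero}}) (ℕ.+-comm r (d ℕ.* ord)))) (go d r)
    where
    r = (i ℕ.% ord) {{ord-nonZero}}
    d = (i ℕ./ ord) {{ord-nonZero}}
    go : ∀ m n → t (m ℕ.* ord ℕ.+ n) ≡ t n
    go zero    n = ≡.refl
    go (suc m) n = ≡.trans (cong t (ℕ.+-assoc ord (m ℕ.* ord) n)) (≡.trans (per _) (go m n))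

  -- Periodicity makes the value independent of the exponent chosen for `x`.
  lift-g^ : ∀ {t} → Periodic t → ∀ {x} i → x ≈ g ^ i → lift t x ≡ t i
  lift-g^ {t} per {x} i x≈g^i = begin
    lift t x  ≡⟨ lift-nonzero t x≉0 ⟩
    t (exponent x)  ≡⟨ periodic-% per (exponent x) ⟩
    t ((exponent x ℕ.% ord) {{ord-nonZero}})  ≡⟨ cong t (g^-periodic (trans (g^exponent x≉0) x≈g^i)) ⟩
    t ((i ℕ.% ord) {{ord-nonZero}})  ≡⟨ periodic-% per i ⟨
    t i  ∎
    where
    x≉0 = λ x≈0 → ^-≉0 i g≉0 (trans (sym x≈g^i) x≈0)

  zero-or-power : ∀ x → (x ≈ 0#) ⊎ ∃ λ i → x ≈ g ^ i
  zero-or-power x with x ≟ 0#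
  ... | yes x≈0 = inj₁ x≈0
  ... | no  x≉0 = inj₂ (exponent x , sym (g^exponent x≉0))

  nonzero-power : ∀ {x} → ¬ (x ≈ 0#) → ∃ λ i → x ≈ g ^ i
  nonzero-power {x} x≉0 = exponent x , sym (g^exponent x≉0)

-- From counting tuples to convolution powers.

module Counting {c ℓ} (F : FiniteField c ℓ) (g : FiniteField.Carrier F) (gen : IsGenerator F g) where
  open Convolution F g gen public
  open ≡-Reasoning

  count : ∀ {a p} {A : Set a} {P : A → Set p} → Decidable P → List A → ℕ
  count P? xs = length (filter P? xs)

  count-map : ∀ {a b p} {A : Set a} {B : Set b} {P : B → Set p} (P? : Decidable P) (f : A → B) xs →
    count P? (map f xs) ≡ count (λ x → P? (f x)) xs
  count-map P? f []       = ≡.refl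
  count-map P? f (x ∷ xs) with P? (f x)
  ... | yes _ = cong suc (count-map P? f xs)
  ... | no  _ = count-map P? f xs

  count-⇔ : ∀ {a p q} {A : Set a} {P : A → Set p} {R : A → Set q} (P? : Decidable P) (R? : Decidable R) →
    (∀ x → P x → R x) → (∀ x → R x → P x) → ∀ xs → count P? xs ≡ count R? xs
  count-⇔ P? R? to from []       = ≡.refl
  count-⇔ P? R? to from (x ∷ xs) with P? x | R? x
  ... | yes _ | yes _ = cong suc (count-⇔ P? R? to from xs)
  ... | no  _ | no  _ = count-⇔ P? R? to from xs
  ... | yes p | no ¬r = ⊥-elim (¬r (to x p))
  ... | no ¬p | yes r = ⊥-elim (¬p (from x r))

  count-concatMap : ∀ {a b p} {A : Set a} {B : Set b} {P : B → Set p} (P? : Decidable P) (f : A → List B) {n} (h : Fin n → A) →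
    + count P? (concatMap f (tabulate h)) ≡ sum (λ i → + count P? (f (h i)))
  count-concatMap P? f {zero}  h = ≡.refl
  count-concatMap P? f {suc n} h = begin
    + count P? (f (h zero) ++ concatMap f (tabulate (h ∘ suc)))
      ≡⟨ cong (+_ ∘ length) (filter-++ P? (f (h zero)) (concatMap f (tabulate (h ∘ suc)))) ⟩
    + length (filter P? (f (h zero)) ++ filter P? (concatMap f (tabulate (h ∘ suc))))
      ≡⟨ cong +_ (length-++ (filter P? (f (h zero)))) ⟩
    + count P? (f (h zero)) ∔ + count P? (concatMap f (tabulate (h ∘ suc)))
      ≡⟨ cong (_∔_ (+ count P? (f (h zero)))) (count-concatMap P? f (h ∘ suc)) ⟩
    sum (λ i → + count P? (f (h i)))  ∎

  N-zero : ∀ x → + N F 0 x ≡ δ x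
  N-zero x with 0# ≟ x
  ... | yes 0≈x = ≡.sym (δ-zero (sym 0≈x))
  ... | no  0≉x = ≡.sym (δ-nonzero (0≉x ∘ sym))

  N-suc : ∀ n x → + N F (suc n) x ≡ ∑ (λ y → + N F n (x - y ^ 4))
  N-suc n x = ≡.trans
    (count-concatMap (λ v → sumPow4 F v ≟ x) (λ i → map (i ∷_) (tuples F n)) (λ i → i))
    (sum-cong-≋ (λ i → cong +_ (≡.trans
      (count-map (λ v → sumPow4 F v ≟ x) (i ∷_) (tuples F n))
      (count-⇔ (λ v → sumPow4 F (i ∷ v) ≟ x) (λ v → sumPow4 F v ≟ (x - enum i ^ 4)) (to i) (from i) (tuples F n)))))
    where
    to : ∀ i v → enum i ^ 4 + sumPow4 F v ≈ x → sumPow4 F v ≈ x - enum i ^ 4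
    to i v eq = sym (trans (+-congʳ (trans (sym eq) (+-comm _ _))) (x+y-y≈x (sumPow4 F v) (enum i ^ 4)))
    from : ∀ i v → sumPow4 F v ≈ x - enum i ^ 4 → enum i ^ 4 + sumPow4 F v ≈ x
    from i v eq = trans (+-congˡ eq) (trans (+-comm _ _) (x-y+y≈x x (enum i ^ 4)))

  N-cong : ∀ n → Congruent (λ x → + N F n x)
  N-cong n {x} {y} x≈y = cong +_ (count-⇔ (λ v → sumPow4 F v ≟ x) (λ v → sumPow4 F v ≟ y)
    (λ v eq → trans eq x≈y) (λ v eq → trans eq (sym x≈y)) (tuples F n))

  -- The summand lives on ℕ, so that a sum can be cut into blocks by arithmetic on the index.
  range : ℕ → (ℕ → ℤ) → ℤ
  range n G = sum {n} (λ i → G (toℕ i))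

  range-+ : ∀ m n G → range (m ℕ.+ n) G ≡ range m G ∔ range n (λ j → G (m ℕ.+ j))
  range-+ zero    n G = ≡.sym (ℤ.+-identityˡ _)
  range-+ (suc m) n G = ≡.trans (cong (_∔_ (G 0)) (range-+ m n (G ∘ suc))) (≡.sym (ℤ.+-assoc (G 0) _ _))

  range-cong : ∀ n {G H : ℕ → ℤ} → (∀ j → G j ≡ H j) → range n G ≡ range n H
  range-cong n eq = sum-cong-≋ {n} (λ i → eq (toℕ i))

  range-blocks : ∀ k d G → range (k ℕ.* d) G ≡ range k (λ j → range d (λ i → G (j ℕ.* d ℕ.+ i)))
  range-blocks zero    d G = ≡.refl
  range-blocks (suc k) d G = ≡.trans (range-+ d (k ℕ.* d) G) (cong (_∔_ (range d G))
    (≡.trans (range-blocks k d (λ j → G (d ℕ.+ j)))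
      (range-cong k (λ j → range-cong d (λ i → cong G (≡.sym (ℕ.+-assoc d (j ℕ.* d) i)))))))

  range-periodic : ∀ m k G → (∀ j → G (k ℕ.+ j) ≡ G j) → range (m ℕ.* k) G ≡ + m · range k G
  range-periodic zero    k G per = ≡.sym (ℤ.*-zeroˡ (range k G))
  range-periodic (suc m) k G per = begin
    range (k ℕ.+ m ℕ.* k) G  ≡⟨ range-+ k (m ℕ.* k) G ⟩
    range k G ∔ range (m ℕ.* k) (λ j → G (k ℕ.+ j))  ≡⟨ cong (_∔_ (range k G)) (≡.trans (range-cong (m ℕ.* k) per) (range-periodic m k G per)) ⟩
    range k G ∔ + m · range k G  ≡⟨ ℤ.suc-* (+ m) (range k G) ⟨
    + suc m · range k G  ∎

  range-* : ∀ n x G → range n (λ j → x · G j) ≡ x · range n G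
  range-* n x G = ≡.sym (*-distribˡ-sum {n} x (λ i → G (toℕ i)))

  -- w a is the number of d-th roots of a.
  ∑-power : ∀ d k → .{{NonZero d}} → ord ≡ k ℕ.* d → ∀ w → Congruent w → w 0# ≡ 1ℤ →
    (∀ j (H : ℕ → ℤ) → range d (λ i → w (g ^ (j ℕ.* d ℕ.+ i)) · H i) ≡ + d · H 0) →
    ∀ f → Congruent f → ∑ (λ y → f (y ^ d)) ≡ ∑ (λ a → w a · f a)
  ∑-power d@(suc d′) k ord≡ w w-cong w-zero w-block f f-cong = begin
    ∑ (λ y → f (y ^ d))  ≡⟨ ∑-cyclic (λ y → f (y ^ d)) (λ eq → f-cong (^-cong d eq)) ⟩
    f (0# ^ d) ∔ range ord (λ j → f ((g ^ j) ^ d))  ≡⟨ cong₂ _∔_ (f-cong (zeroˡ (0# ^ d′))) left ⟩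
    f 0# ∔ + d · range k (λ j → f (g ^ (j ℕ.* d)))  ≡⟨ cong₂ _∔_ (≡.trans (≡.sym (ℤ.*-identityˡ (f 0#))) (cong (_· f 0#) (≡.sym w-zero))) (≡.sym right) ⟩
    w 0# · f 0# ∔ range ord (λ j → w (g ^ j) · f (g ^ j))  ≡⟨ ∑-cyclic (λ a → w a · f a) (*-congruent w-cong f-cong) ⟨
    ∑ (λ a → w a · f a)  ∎
    where
    wraps : ∀ j → g ^ ((k ℕ.+ j) ℕ.* d) ≈ g ^ (j ℕ.* d)
    wraps j = trans (reflexive (cong (g ^_) (ℕ.*-distribʳ-+ d k j)))
      (trans (^-+ g (k ℕ.* d) (j ℕ.* d)) (trans (*-congʳ (subst (λ n → g ^ n ≈ 1#) ord≡ g^ord≈1)) (*-identityˡ _)))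
    -- For y = gʲ the d-th power has exponent j d, which modulo `ord` = k d runs d times through the
    -- multiples of d.
    left : range ord (λ j → f ((g ^ j) ^ d)) ≡ + d · range k (λ j → f (g ^ (j ℕ.* d)))
    left = begin
      range ord (λ j → f ((g ^ j) ^ d))  ≡⟨ range-cong ord (λ j → f-cong (trans (sym (^-* g d j)) (reflexive (cong (g ^_) (ℕ.*-comm d j))))) ⟩
      range ord (λ j → f (g ^ (j ℕ.* d)))  ≡⟨ cong (λ n → range n (λ j → f (g ^ (j ℕ.* d)))) (≡.trans ord≡ (ℕ.*-comm k d)) ⟩
      range (d ℕ.* k) (λ j → f (g ^ (j ℕ.* d)))  ≡⟨ range-periodic d k (λ j → f (g ^ (j ℕ.* d))) (λ j → f-cong (wraps j)) ⟩
      + d · range k (λ j → f (g ^ (j ℕ.* d)))  ∎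
    -- Each block of d consecutive exponents contains one d-th power, and `w-block` puts the whole
    -- weight d on it.
    right : range ord (λ j → w (g ^ j) · f (g ^ j)) ≡ + d · range k (λ j → f (g ^ (j ℕ.* d)))
    right = begin
      range ord (λ j → w (g ^ j) · f (g ^ j))  ≡⟨ cong (λ n → range n (λ j → w (g ^ j) · f (g ^ j))) ord≡ ⟩
      range (k ℕ.* d) (λ j → w (g ^ j) · f (g ^ j))  ≡⟨ range-blocks k d (λ j → w (g ^ j) · f (g ^ j)) ⟩
      range k (λ j → range d (λ i → w (g ^ (j ℕ.* d ℕ.+ i)) · f (g ^ (j ℕ.* d ℕ.+ i))))
        ≡⟨ range-cong k (λ j → w-block j (λ i → f (g ^ (j ℕ.* d ℕ.+ i)))) ⟩
      range k (λ j → + d · f (g ^ (j ℕ.* d ℕ.+ 0)))  ≡⟨ range-* k (+ d) (λ j → f (g ^ (j ℕ.* d ℕ.+ 0))) ⟩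
      + d · range k (λ j → f (g ^ (j ℕ.* d ℕ.+ 0)))  ≡⟨ cong (+ d ·_) (range-cong k (λ j → cong (λ n → f (g ^ n)) (ℕ.+-identityʳ (j ℕ.* d)))) ⟩
      + d · range k (λ j → f (g ^ (j ℕ.* d)))  ∎

  -- Written as k · f ∔ f′ so that ⋆-linearˡ applies.
  one+ : (Carrier → ℤ) → Carrier → ℤ
  one+ h a = 1ℤ · h a ∔ 1ℤ

  -- Indexed from the first power: the zeroth would be `δ`, which is not sum-zero and does not fit
  -- qⁿ⁻¹ + hⁿ.
  convPower : (Carrier → ℤ) → ℕ → Carrier → ℤ
  convPower h zero    = h
  convPower h (suc n) = h ⋆ convPower h n

  module _ (h : Carrier → ℤ) (h-cong : Congruent h) (∑h≡0 : ∑ h ≡ 0ℤ)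
    (∑-fourth : ∀ f → Congruent f → ∑ (λ y → f (y ^ 4)) ≡ ∑ (λ a → one+ h a · f a)) where

    convPower-cong : ∀ n → Congruent (convPower h n)
    convPower-cong zero    = h-cong
    convPower-cong (suc n) = ⋆-congruent h (convPower-cong n)

    ∑-convPower : ∀ n → ∑ (convPower h n) ≡ 0ℤ
    ∑-convPower zero    = ∑h≡0
    ∑-convPower (suc n) = ≡.trans (∑-⋆ h (convPower-cong n)) (≡.trans (cong (_· ∑ (convPower h n)) ∑h≡0) (ℤ.*-zeroˡ (∑ (convPower h n))))

    N-⋆ : ∀ n x → + N F (suc n) x ≡ (one+ h ⋆ (λ y → + N F n y)) x
    N-⋆ n x = ≡.trans (N-suc n x) (∑-fourth (λ a → + N F n (x - a)) (λ eq → N-cong n (+-congˡ (-‿cong eq))))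

    -- Convolution with the constant 1 replaces a function by its total. It therefore kills the
    -- powers of h and multiplies constants by q, so no cross terms remain.
    N-formula : ∀ n x → + N F (suc n) x ≡ Q ℤ.^ n ∔ convPower h n x
    N-formula zero    x = begin
      + N F 1 x  ≡⟨ N-⋆ 0 x ⟩
      (one+ h ⋆ (λ y → + N F 0 y)) x  ≡⟨ ⋆-congʳ (one+ h) N-zero x ⟩
      (one+ h ⋆ δ) x  ≡⟨ ⋆-comm (λ eq → cong (λ z → 1ℤ · z ∔ 1ℤ) (h-cong eq)) δ-cong x ⟩
      (δ ⋆ one+ h) x  ≡⟨ δ-⋆ (λ eq → cong (λ z → 1ℤ · z ∔ 1ℤ) (h-cong eq)) x ⟩
      1ℤ · h x ∔ 1ℤ  ≡⟨ lem (h x) ⟩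
      1ℤ ∔ h x  ∎
      where
      lem : ∀ x → 1ℤ · x ∔ 1ℤ ≡ 1ℤ ∔ x
      lem = solve-∀
    N-formula (suc n) x = begin
      + N F (suc (suc n)) x  ≡⟨ N-⋆ (suc n) x ⟩
      (one+ h ⋆ (λ y → + N F (suc n) y)) x  ≡⟨ ⋆-linearˡ 1ℤ h (λ _ → 1ℤ) (λ y → + N F (suc n) y) x ⟩
      1ℤ · (h ⋆ (λ y → + N F (suc n) y)) x ∔ ((λ _ → 1ℤ) ⋆ (λ y → + N F (suc n) y)) x
        ≡⟨ cong₂ (λ u v → 1ℤ · u ∔ v) h-part 1-part ⟩
      1ℤ · convPower h (suc n) x ∔ Q ℤ.^ suc n  ≡⟨ lem (convPower h (suc n) x) (Q ℤ.^ suc n) ⟩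
      Q ℤ.^ suc n ∔ convPower h (suc n) x  ∎
      where
      lem : ∀ x y → 1ℤ · x ∔ y ≡ y ∔ x
      lem = solve-∀
      split : ∀ y → + N F (suc n) y ≡ 1ℤ · convPower h n y ∔ Q ℤ.^ n
      split y = ≡.trans (N-formula n y) (≡.sym (lem (convPower h n y) (Q ℤ.^ n)))
      h-part : (h ⋆ (λ y → + N F (suc n) y)) x ≡ convPower h (suc n) x
      h-part = begin
        (h ⋆ (λ y → + N F (suc n) y)) x  ≡⟨ ⋆-congʳ h split x ⟩
        (h ⋆ (λ y → 1ℤ · convPower h n y ∔ Q ℤ.^ n)) x  ≡⟨ ⋆-linearʳ h 1ℤ (convPower h n) (λ _ → Q ℤ.^ n) x ⟩
        1ℤ · convPower h (suc n) x ∔ (h ⋆ (λ _ → Q ℤ.^ n)) x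
          ≡⟨ cong (_∔_ (1ℤ · convPower h (suc n) x)) (≡.trans (∑-*ʳ h (Q ℤ.^ n)) (≡.trans (cong (_· Q ℤ.^ n) ∑h≡0) (ℤ.*-zeroˡ (Q ℤ.^ n)))) ⟩
        1ℤ · convPower h (suc n) x ∔ 0ℤ  ≡⟨ ≡.trans (ℤ.+-identityʳ _) (ℤ.*-identityˡ _) ⟩
        convPower h (suc n) x  ∎
      1-part : ((λ _ → 1ℤ) ⋆ (λ y → + N F (suc n) y)) x ≡ Q ℤ.^ suc n
      1-part = begin
        ((λ _ → 1ℤ) ⋆ (λ y → + N F (suc n) y)) x  ≡⟨ const-⋆ 1ℤ (N-cong (suc n)) x ⟩
        1ℤ · ∑ (λ y → + N F (suc n) y)  ≡⟨ ℤ.*-identityˡ _ ⟩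
        ∑ (λ y → + N F (suc n) y)  ≡⟨ ∑-cong split ⟩
        ∑ (λ y → 1ℤ · convPower h n y ∔ Q ℤ.^ n)  ≡⟨ ∑-+ (λ y → 1ℤ · convPower h n y) (λ _ → Q ℤ.^ n) ⟩
        ∑ (λ y → 1ℤ · convPower h n y) ∔ ∑ (λ _ → Q ℤ.^ n) ≡⟨ cong₂ _∔_ (≡.trans (∑-* 1ℤ (convPower h n)) (cong (1ℤ ·_) (∑-convPower n))) (∑-const (Q ℤ.^ n)) ⟩
        0ℤ ∔ Q · Q ℤ.^ n  ≡⟨ ℤ.+-identityˡ _ ⟩
        Q ℤ.^ suc n  ∎

-- The quadratic character.

module Quadratic {c ℓ} (F : FiniteField c ℓ) (g : FiniteField.Carrier F) (gen : IsGenerator F g)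
  (k : ℕ) (ord≡ : FiniteField.size F ℕ.∸ 1 ≡ k ℕ.* 2) where
  open Counting F g gen public
  open ≡-Reasoning

  k≢0 : ¬ (k ≡ 0)
  k≢0 ≡.refl = ℕ.≢-nonZero⁻¹ ord {{ord-nonZero}} ord≡

  -- The square is 1, and g^k is not 1 because k is smaller than the order; a field leaves only -1.
  g^k≈-1 : g ^ k ≈ -1#
  g^k≈-1 = trans (sym (+-identityˡ _)) (trans (+-congʳ (sym (-‿inverseˡ 1#)))
    (trans (+-assoc -1# 1# (g ^ k)) (trans (+-congˡ 1+g^k≈0) (+-identityʳ -1#))))
    where
    g^k≉1 : ¬ (g ^ k - 1# ≈ 0#)
    g^k≉1 eq = ℕ.<⇒≱ (subst (k ℕ.<_) (≡.trans (≡.trans (ℕ.+-comm k k) (cong (k ℕ.+_) (≡.sym (ℕ.+-identityʳ k)))) (≡.trans (ℕ.*-comm 2 k) (≡.sym ord≡)))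
        (ℕ.m<m+n k (ℕ.n≢0⇒n>0 k≢0))) (ord≤ k {{ℕ.≢-nonZero k≢0}} (x-y≈0⇒x≈y eq))
    square : (g ^ k - 1#) * (1# + g ^ k) ≈ 0#
    square = trans (distribʳ (1# + g ^ k) (g ^ k) -1#) (trans (+-cong
        (trans (distribˡ (g ^ k) 1# (g ^ k)) (+-cong (*-identityʳ _) (trans (sym (^-+ g k k)) g^[k+k]≈1)))
        (trans (-1*x≈-x (1# + g ^ k)) (-‿cong (+-comm 1# (g ^ k))))) (-‿inverseʳ (g ^ k + 1#)))
      where
      g^[k+k]≈1 : g ^ (k ℕ.+ k) ≈ 1#
      g^[k+k]≈1 = trans (reflexive (cong (g ^_) (≡.trans (cong (k ℕ.+_) (≡.sym (ℕ.+-identityʳ k))) (≡.trans (ℕ.*-comm 2 k) (≡.sym ord≡))))) g^ord≈1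
    1+g^k≈0 : 1# + g ^ k ≈ 0#
    1+g^k≈0 = x*y≈0⇒ (g ^ k - 1#) g^k≉1 square

  ρ : Carrier → ℤ
  ρ = lift signℕ

  sign-periodic : Periodic signℕ
  sign-periodic n = ≡.trans (cong (λ m → signℕ (m ℕ.+ n)) ord≡) (sign-2*k k n)

  ρ-cong : Congruent ρ
  ρ-cong = lift-cong signℕ

  ρ-power : ∀ {x} i → x ≈ g ^ i → ρ x ≡ signℕ i
  ρ-power = lift-g^ sign-periodic

  ρ-* : ∀ x y → ρ (x * y) ≡ ρ x · ρ y
  ρ-* x y with zero-or-power x | zero-or-power y
  ... | inj₁ x≈0 | _ = ≡.trans (lift-zero signℕ (trans (*-congʳ x≈0) (zeroˡ y)))
    (≡.sym (≡.trans (cong (_· ρ y) (lift-zero signℕ x≈0)) (ℤ.*-zeroˡ (ρ y))))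
  ... | inj₂ _ | inj₁ y≈0 = ≡.trans (lift-zero signℕ (trans (*-congˡ y≈0) (zeroʳ x)))
    (≡.sym (≡.trans (cong (ρ x ·_) (lift-zero signℕ y≈0)) (ℤ.*-zeroʳ (ρ x))))
  ... | inj₂ (i , x≈) | inj₂ (j , y≈) = ≡.trans (ρ-power (i ℕ.+ j) (trans (*-cong x≈ y≈) (sym (^-+ g i j))))
    (≡.trans (sign-+ i j) (≡.sym (cong₂ _·_ (ρ-power i x≈) (ρ-power j y≈))))

  ρ² : ∀ {x} → ¬ (x ≈ 0#) → ρ x · ρ x ≡ 1ℤ
  ρ² x≉0 with nonzero-power x≉0
  ... | i , x≈ = ≡.trans (cong (λ z → z · z) (ρ-power i x≈)) (sign² i)

  ρ-[-1] : ρ -1# ≡ signℕ k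
  ρ-[-1] = ρ-power k (sym g^k≈-1)

  -- The substitution of g x for x changes the sign of every term.
  ∑-ρ : ∑ ρ ≡ 0ℤ
  ∑-ρ = x≡-x⇒x≡0 (∑ ρ) (begin
    ∑ ρ  ≡⟨ ∑-scale g g≉0 ρ ρ-cong ⟩
    ∑ (λ x → ρ (g * x))  ≡⟨ ∑-cong (λ x → ≡.trans (ρ-* g x) (cong (_· ρ x) (ρ-power 1 (sym (*-identityʳ g))))) ⟩
    ∑ (λ x → -1ℤ · ρ x)  ≡⟨ ∑-* -1ℤ ρ ⟩
    -1ℤ · ∑ ρ  ≡⟨ ℤ.-1*i≡-i (∑ ρ) ⟩
    ⊝ ∑ ρ  ∎)

  ∑-ρ² : ∑ (λ a → ρ a · ρ a) ≡ + ord
  ∑-ρ² = ≡.trans (∑-constant-off-zero (λ a → ρ a · ρ a) (*-congruent ρ-cong ρ-cong) 1ℤ ρ²)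
    (≡.trans (cong₂ (λ u v → u · u ∔ v) (lift-zero signℕ refl) (ℤ.*-identityʳ (+ ord))) (ℤ.+-identityˡ (+ ord)))

  ρ⋆ρ-zero : (ρ ⋆ ρ) 0# ≡ ρ -1# · + ord
  ρ⋆ρ-zero = begin
    (ρ ⋆ ρ) 0#  ≡⟨ ⋆-at-zero ρ ρ-cong ⟩
    ∑ (λ a → ρ a · ρ (-1# * a))  ≡⟨ ∑-cong (λ a → ≡.trans (cong (ρ a ·_) (ρ-* -1# a)) (lem (ρ a) (ρ -1#))) ⟩
    ∑ (λ a → ρ -1# · (ρ a · ρ a))  ≡⟨ ∑-* (ρ -1#) (λ a → ρ a · ρ a) ⟩
    ρ -1# · ∑ (λ a → ρ a · ρ a)  ≡⟨ cong (ρ -1# ·_) ∑-ρ² ⟩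
    ρ -1# · + ord  ∎
    where
    lem : ∀ x y → x · (y · x) ≡ y · (x · x)
    lem = solve-∀

  -- The vanishing total ties the value off 0 to the value at 0, so the constant `v` is determined
  -- without evaluating the Jacobi sum behind it.
  off-zero-value : ∀ f → Congruent f → ∑ f ≡ 0ℤ → ∀ u {v} → f 0# ≡ u · + ord →
    (∀ {x} → ¬ (x ≈ 0#) → f x ≡ v) → ∀ x → f x ≡ u · E x
  off-zero-value f f-cong ∑f≡0 u {v} f0 fv x = go (x ≟ 0#)
    where
    v≡ : v ≡ u · -1ℤ
    v≡ = ℤ.*-cancelˡ-≡ (+ ord) v (u · -1ℤ) {{ord-nonZero}} (begin
      + ord · v  ≡⟨ lem₁ u v (+ ord) ⟩
      (u · + ord ∔ + ord · v) ∔ + ord · (u · -1ℤ)  ≡⟨ cong (_∔ + ord · (u · -1ℤ)) total ⟩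
      0ℤ ∔ + ord · (u · -1ℤ)  ≡⟨ ℤ.+-identityˡ _ ⟩
      + ord · (u · -1ℤ)  ∎)
      where
      lem₁ : ∀ u v w → w · v ≡ (u · w ∔ w · v) ∔ w · (u · -1ℤ)
      lem₁ = solve-∀
      total : u · + ord ∔ + ord · v ≡ 0ℤ
      total = ≡.trans (cong (_∔ + ord · v) (≡.sym f0)) (≡.trans (≡.sym (∑-constant-off-zero f f-cong v fv)) ∑f≡0)
    go : Dec (x ≈ 0#) → f x ≡ u · E x
    go (yes x≈0) = ≡.trans (f-cong x≈0) (≡.trans f0 (cong (u ·_) (≡.sym (≡.trans (E-cong x≈0) E-zero))))
    go (no  x≉0) = ≡.trans (fv x≉0) (≡.trans v≡ (cong (u ·_) (≡.sym (E-nonzero x≉0))))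

  ρ⋆ρ : ∀ x → (ρ ⋆ ρ) x ≡ ρ -1# · E x
  ρ⋆ρ = off-zero-value (ρ ⋆ ρ) (⋆-congruent ρ ρ-cong)
    (≡.trans (∑-⋆ ρ ρ-cong) (≡.trans (cong (_· ∑ ρ) ∑-ρ) (ℤ.*-zeroˡ (∑ ρ)))) (ρ -1#) ρ⋆ρ-zero at-nonzero
    where
    lem : ∀ a b c → (a · b) · (a · c) ≡ (a · a) · (b · c)
    lem = solve-∀
    at-nonzero : ∀ {x} → ¬ (x ≈ 0#) → (ρ ⋆ ρ) x ≡ ∑ (λ b → ρ b · ρ (1# - b))
    at-nonzero {x} x≉0 = ≡.trans (⋆-at-nonzero ρ-cong ρ-cong x≉0) (∑-cong λ b → begin
      ρ (x * b) · ρ (x * (1# - b))  ≡⟨ cong₂ _·_ (ρ-* x b) (ρ-* x (1# - b)) ⟩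
      (ρ x · ρ b) · (ρ x · ρ (1# - b))  ≡⟨ lem (ρ x) (ρ b) (ρ (1# - b)) ⟩
      (ρ x · ρ x) · (ρ b · ρ (1# - b))  ≡⟨ cong (_· (ρ b · ρ (1# - b))) (ρ² x≉0) ⟩
      1ℤ · (ρ b · ρ (1# - b))  ≡⟨ ℤ.*-identityˡ _ ⟩
      ρ b · ρ (1# - b)  ∎)

  ∑-square : ∀ f → Congruent f → ∑ (λ y → f (y ^ 2)) ≡ ∑ (λ a → one+ ρ a · f a)
  ∑-square = ∑-power 2 k ord≡ (one+ ρ) (λ eq → cong (λ z → 1ℤ · z ∔ 1ℤ) (ρ-cong eq))
    (cong (λ z → 1ℤ · z ∔ 1ℤ) (lift-zero signℕ refl)) block
    where
    lem : ∀ u v → (1ℤ · 1ℤ ∔ 1ℤ) · u ∔ ((1ℤ · -1ℤ ∔ 1ℤ) · v ∔ 0ℤ) ≡ + 2 · u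
    lem = solve-∀
    block : ∀ j (H : ℕ → ℤ) → range 2 (λ i → (1ℤ · ρ (g ^ (j ℕ.* 2 ℕ.+ i)) ∔ 1ℤ) · H i) ≡ + 2 · H 0
    block j H = ≡.trans (cong₂ (λ u v → (1ℤ · u ∔ 1ℤ) · H 0 ∔ ((1ℤ · v ∔ 1ℤ) · H 1 ∔ 0ℤ))
      (≡.trans (ρ-power (j ℕ.* 2 ℕ.+ 0) refl) (sign-2*k j 0)) (≡.trans (ρ-power (j ℕ.* 2 ℕ.+ 1) refl) (sign-2*k j 1))) (lem (H 0) (H 1))

-- The case q ≡ 3 (mod 4).

module Case3mod4 {c ℓ} (F : FiniteField c ℓ) (g : FiniteField.Carrier F) (gen : IsGenerator F g)
  (k : ℕ) (ord≡ : FiniteField.size F ℕ.∸ 1 ≡ suc (k ℕ.* 2) ℕ.* 2) where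
  open Quadratic F g gen (suc (k ℕ.* 2)) ord≡
  open ≡-Reasoning

  ρ-[-1]≡-1 : ρ -1# ≡ -1ℤ
  ρ-[-1]≡-1 = ≡.trans ρ-[-1] (cong ⊝_ (≡.trans (cong signℕ (≡.sym (ℕ.+-identityʳ (k ℕ.* 2)))) (sign-2*k k 0)))

  -- As -1 is not a square, squaring permutes the squares.
  ∑-fourth : ∀ f → Congruent f → ∑ (λ y → f (y ^ 4)) ≡ ∑ (λ a → one+ ρ a · f a)
  ∑-fourth f f-cong = begin
    ∑ (λ y → f (y ^ 4))  ≡⟨ ∑-cong (λ y → f-cong (^-* y 2 2)) ⟩
    ∑ (λ y → f ((y ^ 2) ^ 2))  ≡⟨ ∑-square (λ y → f (y ^ 2)) sq-cong ⟩
    ∑ (λ a → (1ℤ · ρ a ∔ 1ℤ) · f (a ^ 2))  ≡⟨ ∑-cong (λ a → lem₁ (ρ a) (f (a ^ 2))) ⟩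
    ∑ (λ a → ρ a · f (a ^ 2) ∔ f (a ^ 2))  ≡⟨ ∑-+ (λ a → ρ a · f (a ^ 2)) (λ a → f (a ^ 2)) ⟩
    ∑ (λ a → ρ a · f (a ^ 2)) ∔ ∑ (λ a → f (a ^ 2))  ≡⟨ cong (_∔ ∑ (λ a → f (a ^ 2))) odd-part ⟩
    0ℤ ∔ ∑ (λ a → f (a ^ 2))  ≡⟨ ℤ.+-identityˡ _ ⟩
    ∑ (λ a → f (a ^ 2))  ≡⟨ ∑-square f f-cong ⟩
    ∑ (λ a → one+ ρ a · f a)  ∎
    where
    sq-cong : Congruent (λ y → f (y ^ 2))
    sq-cong eq = f-cong (^-cong 2 eq)
    lem₁ : ∀ x y → (1ℤ · x ∔ 1ℤ) · y ≡ x · y ∔ y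
    lem₁ = solve-∀
    [-1]²≈1 : -1# ^ 2 ≈ 1#
    [-1]²≈1 = trans (*-congˡ (*-identityʳ -1#)) (trans (-1*x≈-x -1#) (-‿involutive 1#))
    [-a]² : ∀ a → (-1# * a) ^ 2 ≈ a ^ 2
    [-a]² a = trans (^-distrib-* -1# a 2) (trans (*-congʳ [-1]²≈1) (*-identityˡ (a ^ 2)))
    -- The substitution of -a for a fixes a² and flips ρ, since ρ(-1) = -1.
    odd-part : ∑ (λ a → ρ a · f (a ^ 2)) ≡ 0ℤ
    odd-part = x≡-x⇒x≡0 _ (begin
      ∑ (λ a → ρ a · f (a ^ 2))  ≡⟨ ∑-scale -1# -1≉0 (λ a → ρ a · f (a ^ 2)) (*-congruent ρ-cong sq-cong) ⟩
      ∑ (λ a → ρ (-1# * a) · f ((-1# * a) ^ 2))  ≡⟨ ∑-cong (λ a → ≡.trans (cong₂ _·_ (≡.trans (ρ-* -1# a) (cong (_· ρ a) ρ-[-1]≡-1)) (f-cong ([-a]² a))) (ℤ.*-assoc -1ℤ (ρ a) (f (a ^ 2)))) ⟩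
      ∑ (λ a → -1ℤ · (ρ a · f (a ^ 2)))  ≡⟨ ∑-* -1ℤ (λ a → ρ a · f (a ^ 2)) ⟩
      -1ℤ · ∑ (λ a → ρ a · f (a ^ 2))  ≡⟨ ℤ.-1*i≡-i _ ⟩
      ⊝ ∑ (λ a → ρ a · f (a ^ 2))  ∎)

  -- ρ ⋆ ρ = -E, and E acts as q: two further factors ρ amount to -q, which is the denominator 1 + q
  -- x².
  convPower-2 : ∀ n x → convPower ρ (suc (suc n)) x ≡ ⊝ (Q · convPower ρ n x)
  convPower-2 n x = begin
    (ρ ⋆ (ρ ⋆ convPower ρ n)) x  ≡⟨ ⋆-assoc ρ ρ-cong (w-cong n) x ⟨
    ((ρ ⋆ ρ) ⋆ convPower ρ n) x  ≡⟨ ⋆-congˡ (λ y → ≡.trans (ρ⋆ρ y) (cong (_· E y) ρ-[-1]≡-1)) (convPower ρ n) x ⟩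
    ((λ y → -1ℤ · E y) ⋆ convPower ρ n) x  ≡⟨ ⋆-scaleˡ -1ℤ E (convPower ρ n) x ⟩
    -1ℤ · (E ⋆ convPower ρ n) x  ≡⟨ cong (-1ℤ ·_) (E-⋆ (w-cong n) (∑-convPower ρ ρ-cong ∑-ρ ∑-fourth n) x) ⟩
    -1ℤ · (Q · convPower ρ n x)  ≡⟨ ℤ.-1*i≡-i _ ⟩
    ⊝ (Q · convPower ρ n x)  ∎
    where
    w-cong = convPower-cong ρ ρ-cong ∑-ρ ∑-fourth

  -- The series depends on the point only through its values of ρ and E, so the three cases of the
  -- statement are one computation.
  genSeries-3mod4 : ∀ x u v → ρ x ≡ u → ⊝ E x ≡ v → genSeries F x ≗ series3mod4 Q u v
  genSeries-3mod4 x u v ρx≡u Ex≡v n = ≡.trans (split n) (cong₂ _∔_ (geomPart-suc Q n) (⁄-unique (0ℤ ∷ u ∷ v ∷ []) (0ℤ ∷ Q ∷ []) eqs n))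
    where
    w : Series
    w = shift (λ n → convPower ρ n x)
    split : ∀ n → genSeries F x n ≡ shift (Q ℤ.^_) n ∔ w n
    split zero    = ≡.refl
    split (suc n) = N-formula ρ ρ-cong ∑-ρ ∑-fourth n x
    lem₁ : ∀ x → 1ℤ · x ∔ 0ℤ · 0ℤ ≡ x
    lem₁ = solve-∀
    lem₂ : ∀ q x y → 1ℤ · (-1ℤ · x) ∔ (0ℤ · y ∔ q · 0ℤ) ≡ ⊝ x
    lem₂ = solve-∀
    lem₃ : ∀ q x y → 1ℤ · ⊝ (q · x) ∔ (0ℤ · y ∔ (q · x ∔ 0ℤ)) ≡ 0ℤ
    lem₃ = solve-∀
    eqs : ((1ℤ ∷ 0ℤ ∷ Q ∷ []) ⊛ w) ≗ coeff (0ℤ ∷ u ∷ v ∷ [])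
    eqs 0 = ≡.refl
    eqs 1 = ≡.trans (lem₁ (ρ x)) ρx≡u
    eqs 2 = ≡.trans (cong (λ z → 1ℤ · z ∔ (0ℤ · ρ x ∔ Q · 0ℤ)) (≡.trans (ρ⋆ρ x) (cong (_· E x) ρ-[-1]≡-1)))
      (≡.trans (lem₂ Q (E x) (ρ x)) Ex≡v)
    eqs (suc (suc (suc n))) = ≡.trans
      (cong (λ z → 1ℤ · z ∔ (0ℤ · convPower ρ (suc n) x ∔ (Q · convPower ρ n x ∔ 0ℤ))) (convPower-2 n x))
      (lem₃ Q (convPower ρ n x) (convPower ρ (suc n) x))

  ρ-square : ∀ {x} → ¬ (x ≈ 0#) → IsSquare F x → ρ x ≡ 1ℤ
  ρ-square {x} x≉0 (y , y²≈x) = ≡.trans (ρ-cong (sym y²≈x)) (≡.trans (ρ-* y y)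
    (ρ² (λ y≈0 → x≉0 (trans (sym y²≈x) (trans (*-congʳ y≈0) (zeroˡ y))))))

  ρ-nonsquare : ∀ {x} → ¬ IsSquare F x → ρ x ≡ -1ℤ
  ρ-nonsquare {x} nsq = ≡.trans (ρ-power i x≈) (odd (i ℕ./ 2) (i ℕ.% 2) (m≡m%n+[m/n]*n i 2) (m%n<n i 2))
    where
    -- 0 is its own square, so a non-square is nonzero.
    x≉0 : ¬ (x ≈ 0#)
    x≉0 x≈0 = nsq (0# , trans (zeroˡ 0#) (sym x≈0))
    i = proj₁ (nonzero-power x≉0)
    x≈ = proj₂ (nonzero-power x≉0)
    odd : ∀ d r → i ≡ r ℕ.+ d ℕ.* 2 → r ℕ.< 2 → signℕ i ≡ -1ℤ
    odd d 0 eq _ = ⊥-elim (nsq (g ^ d , trans (sym (^-+ g d d)) (trans (reflexive (cong (g ^_)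
      (≡.trans (≡.trans (cong (d ℕ.+_) (≡.sym (ℕ.+-identityʳ d))) (ℕ.*-comm 2 d)) (≡.sym eq)))) (sym x≈))))
    odd d 1 eq _ = ≡.trans (cong signℕ (≡.trans eq (ℕ.+-comm 1 (d ℕ.* 2)))) (sign-2*k d 1)
    odd d (suc (suc r)) eq (s≤s (s≤s ()))

  -E-nonzero : ∀ {x} → ¬ (x ≈ 0#) → ⊝ E x ≡ 1ℤ
  -E-nonzero x≉0 = cong ⊝_ (E-nonzero x≉0)

  -E-zero : ∀ {x} → x ≈ 0# → ⊝ E x ≡ 1ℤ ⊟ Q
  -E-zero x≈0 = ≡.trans (cong ⊝_ (≡.trans (E-cong x≈0) E-zero)) (≡.trans (lem (+ ord)) (cong (_⊟_ 1ℤ) (≡.sym Q≡1+ord)))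
    where
    lem : ∀ x → ⊝ x ≡ 1ℤ ⊟ (1ℤ ∔ x)
    lem = solve-∀

-- The quartic character and its Jacobi sums.

module Quartic {c ℓ} (F : FiniteField c ℓ) (g : FiniteField.Carrier F) (gen : IsGenerator F g)
  (k : ℕ) (ord≡ : FiniteField.size F ℕ.∸ 1 ≡ k ℕ.* 4) where
  open Quadratic F g gen (k ℕ.* 2) (≡.trans ord≡ (≡.sym (ℕ.*-assoc k 2 2))) public
  open ≡-Reasoning

  α β : Carrier → ℤ
  α = lift cosℕ
  β = lift sinℕ

  cos-periodic : Periodic cosℕ
  cos-periodic n = ≡.trans (cong (λ m → cosℕ (m ℕ.+ n)) ord≡) (cos-4*k k n)

  sin-periodic : Periodic sinℕ
  sin-periodic n = ≡.trans (cong (λ m → sinℕ (m ℕ.+ n)) ord≡) (sin-4*k k n)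

  α-cong : Congruent α
  α-cong = lift-cong cosℕ

  β-cong : Congruent β
  β-cong = lift-cong sinℕ

  α-power : ∀ {x} i → x ≈ g ^ i → α x ≡ cosℕ i
  α-power = lift-g^ cos-periodic

  β-power : ∀ {x} i → x ≈ g ^ i → β x ≡ sinℕ i
  β-power = lift-g^ sin-periodic

  -- ρ, α and β jointly take five values: zeros at 0, and one triple for each power of i.
  character-induction : ∀ {p} (P : ℤ → ℤ → ℤ → Set p) → P 0ℤ 0ℤ 0ℤ →
    P 1ℤ 1ℤ 0ℤ → P -1ℤ 0ℤ 1ℤ → P 1ℤ -1ℤ 0ℤ → P -1ℤ 0ℤ -1ℤ → ∀ x → P (ρ x) (α x) (β x)
  character-induction P p p₀ p₁ p₂ p₃ x with zero-or-power x
  ... | inj₁ x≈0 rewrite lift-zero signℕ x≈0 | lift-zero cosℕ x≈0 | lift-zero sinℕ x≈0 = p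
  ... | inj₂ (i , x≈) rewrite ρ-power i x≈ | α-power i x≈ | β-power i x≈ = mod4-induction P p₀ p₁ p₂ p₃ i

  -- This and the next four identities are the components of χ² = ρ, of ρ χ = conj χ and of |χ|² =
  -- ρ².
  αβ≡0 : ∀ x → α x · β x ≡ 0ℤ
  αβ≡0 = character-induction (λ r a b → a · b ≡ 0ℤ) ≡.refl ≡.refl ≡.refl ≡.refl ≡.refl

  ρα≡α : ∀ x → ρ x · α x ≡ α x
  ρα≡α = character-induction (λ r a b → r · a ≡ a) ≡.refl ≡.refl ≡.refl ≡.refl ≡.refl

  ρβ≡-β : ∀ x → ρ x · β x ≡ ⊝ β x
  ρβ≡-β = character-induction (λ r a b → r · b ≡ ⊝ b) ≡.refl ≡.refl ≡.refl ≡.refl ≡.refl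

  α²-β²≡ρ : ∀ x → α x · α x ⊟ β x · β x ≡ ρ x
  α²-β²≡ρ = character-induction (λ r a b → a · a ⊟ b · b ≡ r) ≡.refl ≡.refl ≡.refl ≡.refl ≡.refl

  α²+β²≡ρ² : ∀ x → α x · α x ∔ β x · β x ≡ ρ x · ρ x
  α²+β²≡ρ² = character-induction (λ r a b → a · a ∔ b · b ≡ r · r) ≡.refl ≡.refl ≡.refl ≡.refl ≡.refl

  lift-* : ∀ t → Periodic t → (G : ℤ → ℤ → ℤ → ℤ → ℤ) → (∀ u v → G 0ℤ 0ℤ u v ≡ 0ℤ) → (∀ u v → G u v 0ℤ 0ℤ ≡ 0ℤ) →
    (∀ i j → t (i ℕ.+ j) ≡ G (cosℕ i) (sinℕ i) (cosℕ j) (sinℕ j)) → ∀ x y → lift t (x * y) ≡ G (α x) (β x) (α y) (β y)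
  lift-* t per G G-zeroˡ G-zeroʳ t-+ x y with zero-or-power x | zero-or-power y
  ... | inj₁ x≈0 | _ rewrite lift-zero cosℕ x≈0 | lift-zero sinℕ x≈0 =
    ≡.trans (lift-zero t (trans (*-congʳ x≈0) (zeroˡ y))) (≡.sym (G-zeroˡ (α y) (β y)))
  ... | inj₂ _ | inj₁ y≈0 rewrite lift-zero cosℕ y≈0 | lift-zero sinℕ y≈0 =
    ≡.trans (lift-zero t (trans (*-congˡ y≈0) (zeroʳ x))) (≡.sym (G-zeroʳ (α x) (β x)))
  ... | inj₂ (i , x≈) | inj₂ (j , y≈) rewrite α-power i x≈ | α-power j y≈ | β-power i x≈ | β-power j y≈ =
    ≡.trans (lift-g^ per (i ℕ.+ j) (trans (*-cong x≈ y≈) (sym (^-+ g i j)))) (t-+ i j)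

  -- The real part of χ(x y) = χ(x) χ(y). The minus sign sits on `β x` so that the right side has
  -- the form u · α y + v · β y that `⋆-bilinear` takes.
  α-* : ∀ x y → α (x * y) ≡ α x · α y ∔ (⊝ β x) · β y
  α-* = lift-* cosℕ cos-periodic (λ a b c d → a · c ∔ (⊝ b) · d) left right
    (λ i j → ≡.trans (cos-+ i j) (cong (_∔_ (cosℕ i · cosℕ j)) (ℤ.neg-distribˡ-* (sinℕ i) (sinℕ j))))
    where
    left : ∀ u v → 0ℤ · u ∔ (⊝ 0ℤ) · v ≡ 0ℤ
    left = solve-∀
    right : ∀ u v → u · 0ℤ ∔ (⊝ v) · 0ℤ ≡ 0ℤ
    right = solve-∀

  β-* : ∀ x y → β (x * y) ≡ α x · β y ∔ β x · α y
  β-* = lift-* sinℕ sin-periodic (λ a b c d → a · d ∔ b · c) left right sin-+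
    where
    left : ∀ u v → 0ℤ · v ∔ 0ℤ · u ≡ 0ℤ
    left = solve-∀
    right : ∀ u v → u · 0ℤ ∔ v · 0ℤ ≡ 0ℤ
    right = solve-∀

  ε : ℤ
  ε = signℕ k

  ρ-[-1]≡1 : ρ -1# ≡ 1ℤ
  ρ-[-1]≡1 = ≡.trans ρ-[-1] (≡.trans (cong signℕ (≡.sym (ℕ.+-identityʳ (k ℕ.* 2)))) (sign-2*k k 0))

  α-[-1] : α -1# ≡ ε
  α-[-1] = ≡.trans (α-power (k ℕ.* 2) (sym g^k≈-1)) (cos-k*2 k)

  β-[-1] : β -1# ≡ 0ℤ
  β-[-1] = ≡.trans (β-power (k ℕ.* 2) (sym g^k≈-1)) (sin-k*2 k)

  α-neg : ∀ x → α (-1# * x) ≡ ε · α x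
  α-neg x = ≡.trans (α-* -1# x) (≡.trans (cong₂ (λ u v → u · α x ∔ (⊝ v) · β x) α-[-1] β-[-1]) (lem ε (α x) (β x)))
    where
    lem : ∀ e u v → e · u ∔ (⊝ 0ℤ) · v ≡ e · u
    lem = solve-∀

  β-neg : ∀ x → β (-1# * x) ≡ ε · β x
  β-neg x = ≡.trans (β-* -1# x) (≡.trans (cong₂ (λ u v → u · β x ∔ v · α x) α-[-1] β-[-1]) (lem ε (α x) (β x)))
    where
    lem : ∀ e u v → e · v ∔ 0ℤ · u ≡ e · v
    lem = solve-∀

  ∑-lin : ∀ u f v h → ∑ (λ x → u · f x ∔ v · h x) ≡ u · ∑ f ∔ v · ∑ h
  ∑-lin u f v h = ≡.trans (∑-+ (λ x → u · f x) (λ x → v · h x)) (cong₂ _∔_ (∑-* u f) (∑-* v h))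

  -- Substituting g x multiplies χ by i, so its total T satisfies T = i T. This is the real part and
  -- the next lemma the imaginary part; together they give T = 0.
  ∑-α≡-∑-β : ∑ α ≡ ⊝ ∑ β
  ∑-α≡-∑-β = begin
    ∑ α  ≡⟨ ∑-scale g g≉0 α α-cong ⟩
    ∑ (λ x → α (g * x))  ≡⟨ ∑-cong (λ x → ≡.trans (α-* g x) (≡.trans (cong₂ (λ u v → u · α x ∔ (⊝ v) · β x) (α-power 1 g≈g^1) (β-power 1 g≈g^1)) (lem (α x) (β x)))) ⟩
    ∑ (λ x → -1ℤ · β x)  ≡⟨ ∑-* -1ℤ β ⟩
    -1ℤ · ∑ β  ≡⟨ ℤ.-1*i≡-i (∑ β) ⟩
    ⊝ ∑ β  ∎
    where
    g≈g^1 = sym (*-identityʳ g)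
    lem : ∀ u v → 0ℤ · u ∔ (⊝ 1ℤ) · v ≡ -1ℤ · v
    lem = solve-∀

  ∑-β≡∑-α : ∑ β ≡ ∑ α
  ∑-β≡∑-α = ≡.trans (∑-scale g g≉0 β β-cong)
    (∑-cong (λ x → ≡.trans (β-* g x) (≡.trans (cong₂ (λ u v → u · β x ∔ v · α x) (α-power 1 g≈g^1) (β-power 1 g≈g^1)) (lem (α x) (β x)))))
    where
    g≈g^1 = sym (*-identityʳ g)
    lem : ∀ u v → 0ℤ · v ∔ 1ℤ · u ≡ u
    lem = solve-∀

  ∑-α : ∑ α ≡ 0ℤ
  ∑-α = x≡-x⇒x≡0 (∑ α) (≡.trans ∑-α≡-∑-β (cong ⊝_ ∑-β≡∑-α))

  ∑-β : ∑ β ≡ 0ℤ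
  ∑-β = ≡.trans ∑-β≡∑-α ∑-α

  -- A + B i is the Jacobi sum J(ρ, χ) of the quartic character χ = α + β i.
  A B : ℤ
  A = (ρ ⋆ α) 1#
  B = (ρ ⋆ β) 1#

  ≗-off-zero : ∀ {f f′} → Congruent f → Congruent f′ → f 0# ≡ f′ 0# → (∀ {x} → ¬ (x ≈ 0#) → f x ≡ f′ x) → f ≗ f′
  ≗-off-zero f-cong f′-cong eq₀ eq x with x ≟ 0#
  ... | yes x≈0 = ≡.trans (f-cong x≈0) (≡.trans eq₀ (≡.sym (f′-cong x≈0)))
  ... | no  x≉0 = eq x≉0

  -- For x ≠ 0 the multiplication rules of both factors split off x, leaving four constants: the
  -- convolutions of the components at 1.
  ⋆-bilinear : ∀ {f h} f₁ f₂ h₁ h₂ → Congruent f → Congruent h → ∀ {x} → ¬ (x ≈ 0#) → ∀ u v u′ v′ →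
    (∀ b → f (x * b) ≡ u · f₁ b ∔ v · f₂ b) → (∀ b → h (x * b) ≡ u′ · h₁ b ∔ v′ · h₂ b) →
    (f ⋆ h) x ≡ ((u · u′) · (f₁ ⋆ h₁) 1# ∔ (u · v′) · (f₁ ⋆ h₂) 1#) ∔ ((v · u′) · (f₂ ⋆ h₁) 1# ∔ (v · v′) · (f₂ ⋆ h₂) 1#)
  ⋆-bilinear {f} {h} f₁ f₂ h₁ h₂ f-cong h-cong {x} x≉0 u v u′ v′ f≡ h≡ = begin
    (f ⋆ h) x ≡⟨ ⋆-at-nonzero f-cong h-cong x≉0 ⟩
    ∑ (λ b → f (x * b) · h (x * (1# - b)))
      ≡⟨ ∑-cong (λ b → ≡.trans (cong₂ _·_ (f≡ b) (h≡ (1# - b))) (lem u v u′ v′ (f₁ b) (f₂ b) (h₁ (1# - b)) (h₂ (1# - b)))) ⟩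
    ∑ (λ b → ((u · u′) · (f₁ b · h₁ (1# - b)) ∔ (u · v′) · (f₁ b · h₂ (1# - b))) ∔ ((v · u′) · (f₂ b · h₁ (1# - b)) ∔ (v · v′) · (f₂ b · h₂ (1# - b))))
      ≡⟨ ∑-+ (λ b → (u · u′) · (f₁ b · h₁ (1# - b)) ∔ (u · v′) · (f₁ b · h₂ (1# - b))) (λ b → (v · u′) · (f₂ b · h₁ (1# - b)) ∔ (v · v′) · (f₂ b · h₂ (1# - b))) ⟩
    _ ≡⟨ cong₂ _∔_ (∑-lin (u · u′) (λ b → f₁ b · h₁ (1# - b)) (u · v′) (λ b → f₁ b · h₂ (1# - b)))
                   (∑-lin (v · u′) (λ b → f₂ b · h₁ (1# - b)) (v · v′) (λ b → f₂ b · h₂ (1# - b))) ⟩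
    _ ∎
    where
    lem : ∀ u v u′ v′ y y′ z z′ → (u · y ∔ v · y′) · (u′ · z ∔ v′ · z′)
      ≡ ((u · u′) · (y · z) ∔ (u · v′) · (y · z′)) ∔ ((v · u′) · (y′ · z) ∔ (v · v′) · (y′ · z′))
    lem = solve-∀

  private
    ρ-zero : ρ 0# ≡ 0ℤ
    ρ-zero = lift-zero signℕ refl

    ρ-*′ : ∀ x y → ρ (x * y) ≡ ρ x · ρ y ∔ 0ℤ · ρ y
    ρ-*′ x y = ≡.trans (ρ-* x y) (lem (ρ x) (ρ y))
      where
      lem : ∀ u v → u · v ≡ u · v ∔ 0ℤ · v
      lem = solve-∀

    at-zero : ∀ f h → Congruent h → (∀ x → h (-1# * x) ≡ ε · h x) → (f ⋆ h) 0# ≡ ε · ∑ (λ a → f a · h a)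
    at-zero f h h-cong h-neg = ≡.trans (⋆-at-zero f h-cong) (≡.trans
      (∑-cong (λ a → ≡.trans (cong (f a ·_) (h-neg a)) (swap (f a) ε (h a)))) (∑-* ε (λ a → f a · h a)))
      where
      swap : ∀ r e b → r · (e · b) ≡ e · (r · b)
      swap = solve-∀

    span-cong : ∀ u v → Congruent (λ x → u · α x ∔ v · β x)
    span-cong u v eq = cong₂ (λ y z → u · y ∔ v · z) (α-cong eq) (β-cong eq)

    span-zero : ∀ u v → 0ℤ ≡ u · α 0# ∔ v · β 0#
    span-zero u v = ≡.trans (lem u v) (cong₂ (λ y z → u · y ∔ v · z) (≡.sym (lift-zero cosℕ refl)) (≡.sym (lift-zero sinℕ refl)))
      where
      lem : ∀ u v → 0ℤ ≡ u · 0ℤ ∔ v · 0ℤ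
      lem = solve-∀

    ∑ρα≡0 : ∑ (λ x → ρ x · α x) ≡ 0ℤ
    ∑ρα≡0 = ≡.trans (∑-cong ρα≡α) ∑-α

    ∑ρβ≡0 : ∑ (λ x → ρ x · β x) ≡ 0ℤ
    ∑ρβ≡0 = ≡.trans (∑-cong (λ x → ≡.trans (ρβ≡-β x) (≡.sym (ℤ.-1*i≡-i (β x))))) (≡.trans (∑-* -1ℤ β) (cong (-1ℤ ·_) ∑-β))

  -- ρ ⋆ χ = J ρ χ, and ρ χ is the conjugate of χ. This is the real part of (A + B i)(α - β i), and
  -- `ρ⋆β` is the imaginary part.
  ρ⋆α : ∀ x → (ρ ⋆ α) x ≡ A · α x ∔ B · β x
  ρ⋆α = ≗-off-zero (⋆-congruent ρ α-cong) (span-cong A B)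
    (≡.trans (at-zero ρ α α-cong α-neg) (≡.trans (cong (ε ·_) ∑ρα≡0) (≡.trans (ℤ.*-zeroʳ ε) (span-zero A B))))
    (λ {x} x≉0 → begin
      (ρ ⋆ α) x  ≡⟨ ⋆-bilinear ρ ρ α β ρ-cong α-cong x≉0 (ρ x) 0ℤ (α x) (⊝ β x) (ρ-*′ x) (α-* x) ⟩
      _  ≡⟨ lem (ρ x) (α x) (β x) A B ⟩
      A · (ρ x · α x) ∔ B · ⊝ (ρ x · β x)  ≡⟨ cong₂ (λ u v → A · u ∔ B · v) (ρα≡α x) (≡.trans (cong ⊝_ (ρβ≡-β x)) (ℤ.neg-involutive (β x))) ⟩
      A · α x ∔ B · β x  ∎)
    where
    lem : ∀ r a b A B → ((r · a) · A ∔ (r · ⊝ b) · B) ∔ ((0ℤ · a) · A ∔ (0ℤ · ⊝ b) · B) ≡ A · (r · a) ∔ B · ⊝ (r · b)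
    lem = solve-∀

  ρ⋆β : ∀ x → (ρ ⋆ β) x ≡ B · α x ∔ (⊝ A) · β x
  ρ⋆β = ≗-off-zero (⋆-congruent ρ β-cong) (span-cong B (⊝ A))
    (≡.trans (at-zero ρ β β-cong β-neg) (≡.trans (cong (ε ·_) ∑ρβ≡0) (≡.trans (ℤ.*-zeroʳ ε) (span-zero B (⊝ A)))))
    (λ {x} x≉0 → begin
      (ρ ⋆ β) x  ≡⟨ ⋆-bilinear ρ ρ β α ρ-cong β-cong x≉0 (ρ x) 0ℤ (α x) (β x) (ρ-*′ x) (β-* x) ⟩
      _  ≡⟨ lem (ρ x) (α x) (β x) A B ⟩
      B · (ρ x · α x) ∔ (⊝ A) · ⊝ (ρ x · β x)  ≡⟨ cong₂ (λ u v → B · u ∔ (⊝ A) · v) (ρα≡α x) (≡.trans (cong ⊝_ (ρβ≡-β x)) (ℤ.neg-involutive (β x))) ⟩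
      B · α x ∔ (⊝ A) · β x  ∎)
    where
    lem : ∀ r a b A B → ((r · a) · B ∔ (r · b) · A) ∔ ((0ℤ · a) · B ∔ (0ℤ · b) · A) ≡ B · (r · a) ∔ (⊝ A) · ⊝ (r · b)
    lem = solve-∀

  private
    -- J(χ, χ) is `W` + 2 `Z` i, and `X` + `Y` is the Jacobi sum of χ and its conjugate.
    X Y Z W : ℤ
    X = (α ⋆ α) 1#
    Y = (β ⋆ β) 1#
    Z = (α ⋆ β) 1#
    W = X ⊟ Y

    Z-sym : (β ⋆ α) 1# ≡ Z
    Z-sym = ⋆-comm β-cong α-cong 1#

    drop : ∀ {w} u v → w ≡ 0ℤ → u ∔ w · v ≡ u
    drop u v ≡.refl = ≡.trans (cong (_∔_ u) (ℤ.*-zeroˡ v)) (ℤ.+-identityʳ u)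

    α⋆α-nonzero : ∀ {x} → ¬ (x ≈ 0#) → (α ⋆ α) x ≡ (α x · α x) · X ∔ (β x · β x) · Y
    α⋆α-nonzero {x} x≉0 = ≡.trans (⋆-bilinear α β α β α-cong α-cong x≉0 (α x) (⊝ β x) (α x) (⊝ β x) (α-* x) (α-* x))
      (≡.trans (lem (α x) (β x) X Y Z ((β ⋆ α) 1#)) (drop _ (⊝ (Z ∔ (β ⋆ α) 1#)) (αβ≡0 x)))
      where
      lem : ∀ a b X Y Z Z′ → ((a · a) · X ∔ (a · ⊝ b) · Z) ∔ (((⊝ b) · a) · Z′ ∔ ((⊝ b) · ⊝ b) · Y) ≡ ((a · a) · X ∔ (b · b) · Y) ∔ (a · b) · ⊝ (Z ∔ Z′)
      lem = solve-∀

    β⋆β-nonzero : ∀ {x} → ¬ (x ≈ 0#) → (β ⋆ β) x ≡ (α x · α x) · Y ∔ (β x · β x) · X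
    β⋆β-nonzero {x} x≉0 = ≡.trans (⋆-bilinear β α β α β-cong β-cong x≉0 (α x) (β x) (α x) (β x) (β-* x) (β-* x))
      (≡.trans (lem (α x) (β x) X Y Z ((β ⋆ α) 1#)) (drop _ ((β ⋆ α) 1# ∔ Z) (αβ≡0 x)))
      where
      lem : ∀ a b X Y Z Z′ → ((a · a) · Y ∔ (a · b) · Z′) ∔ ((b · a) · Z ∔ (b · b) · X) ≡ ((a · a) · Y ∔ (b · b) · X) ∔ (a · b) · (Z′ ∔ Z)
      lem = solve-∀

    α⋆β-nonzero : ∀ {x} → ¬ (x ≈ 0#) → (α ⋆ β) x ≡ Z · ρ x
    α⋆β-nonzero {x} x≉0 = begin
      (α ⋆ β) x  ≡⟨ ⋆-bilinear α β β α α-cong β-cong x≉0 (α x) (⊝ β x) (α x) (β x) (α-* x) (β-* x) ⟩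
      _  ≡⟨ cong (λ z → ((α x · α x) · Z ∔ (α x · β x) · X) ∔ (((⊝ β x) · α x) · Y ∔ ((⊝ β x) · β x) · z)) Z-sym ⟩
      _  ≡⟨ lem (α x) (β x) X Y Z ⟩
      Z · (α x · α x ⊟ β x · β x) ∔ (α x · β x) · (X ⊟ Y)  ≡⟨ drop _ (X ⊟ Y) (αβ≡0 x) ⟩
      Z · (α x · α x ⊟ β x · β x)  ≡⟨ cong (Z ·_) (α²-β²≡ρ x) ⟩
      Z · ρ x  ∎
      where
      lem : ∀ a b X Y Z → ((a · a) · Z ∔ (a · b) · X) ∔ (((⊝ b) · a) · Y ∔ ((⊝ b) · b) · Z) ≡ Z · (a · a ⊟ b · b) ∔ (a · b) · (X ⊟ Y)
      lem = solve-∀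

    ∑-⋆-zero : ∀ f h → Congruent h → ∑ f ≡ 0ℤ → ∑ (f ⋆ h) ≡ 0ℤ
    ∑-⋆-zero f h h-cong ∑f≡0 = ≡.trans (∑-⋆ f h-cong) (≡.trans (cong (_· ∑ h) ∑f≡0) (ℤ.*-zeroˡ (∑ h)))

    -- The convolution of χ with its conjugate: their product is trivial on units, so the result is
    -- constant off 0; its total is 0 and its value at 0 is ε (q - 1).
    αα+ββ : ∀ x → (α ⋆ α) x ∔ (β ⋆ β) x ≡ ε · E x
    αα+ββ = off-zero-value (λ x → (α ⋆ α) x ∔ (β ⋆ β) x)
      (λ eq → cong₂ _∔_ (⋆-congruent α α-cong eq) (⋆-congruent β β-cong eq))
      (≡.trans (∑-+ (α ⋆ α) (β ⋆ β)) (cong₂ _∔_ (∑-⋆-zero α α α-cong ∑-α) (∑-⋆-zero β β β-cong ∑-β)))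
      ε {X ∔ Y} zero-value nonzero-value
      where
      zero-value : (α ⋆ α) 0# ∔ (β ⋆ β) 0# ≡ ε · + ord
      zero-value = begin
        (α ⋆ α) 0# ∔ (β ⋆ β) 0#  ≡⟨ cong₂ _∔_ (at-zero α α α-cong α-neg) (at-zero β β β-cong β-neg) ⟩
        ε · ∑ (λ a → α a · α a) ∔ ε · ∑ (λ a → β a · β a)  ≡⟨ ℤ.*-distribˡ-+ ε (∑ (λ a → α a · α a)) (∑ (λ a → β a · β a)) ⟨
        ε · (∑ (λ a → α a · α a) ∔ ∑ (λ a → β a · β a))  ≡⟨ cong (ε ·_) (∑-+ (λ a → α a · α a) (λ a → β a · β a)) ⟨
        ε · ∑ (λ a → α a · α a ∔ β a · β a)  ≡⟨ cong (ε ·_) (≡.trans (∑-cong α²+β²≡ρ²) ∑-ρ²) ⟩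
        ε · + ord  ∎
      lem : ∀ u v x y → (u · x ∔ v · y) ∔ (u · y ∔ v · x) ≡ (u ∔ v) · (x ∔ y)
      lem = solve-∀
      nonzero-value : ∀ {x} → ¬ (x ≈ 0#) → (α ⋆ α) x ∔ (β ⋆ β) x ≡ X ∔ Y
      nonzero-value {x} x≉0 = begin
        (α ⋆ α) x ∔ (β ⋆ β) x  ≡⟨ cong₂ _∔_ (α⋆α-nonzero x≉0) (β⋆β-nonzero x≉0) ⟩
        _  ≡⟨ lem (α x · α x) (β x · β x) X Y ⟩
        (α x · α x ∔ β x · β x) · (X ∔ Y)  ≡⟨ cong (_· (X ∔ Y)) (≡.trans (α²+β²≡ρ² x) (ρ² x≉0)) ⟩
        1ℤ · (X ∔ Y)  ≡⟨ ℤ.*-identityˡ (X ∔ Y) ⟩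
        X ∔ Y  ∎

    -- The real part of χ ⋆ χ = J(χ, χ) ρ. At 0 both sides vanish, since χ² = ρ sums to 0.
    αα-ββ : ∀ x → (α ⋆ α) x ⊟ (β ⋆ β) x ≡ W · ρ x
    αα-ββ = ≗-off-zero (λ eq → cong₂ _⊟_ (⋆-congruent α α-cong eq) (⋆-congruent β β-cong eq)) (λ eq → cong (W ·_) (ρ-cong eq))
      (begin
        (α ⋆ α) 0# ⊟ (β ⋆ β) 0#  ≡⟨ cong₂ _⊟_ (at-zero α α α-cong α-neg) (at-zero β β β-cong β-neg) ⟩
        ε · ∑ (λ a → α a · α a) ⊟ ε · ∑ (λ a → β a · β a)  ≡⟨ lem₁ ε (∑ (λ a → α a · α a)) (∑ (λ a → β a · β a)) ⟩
        ε · (1ℤ · ∑ (λ a → α a · α a) ∔ -1ℤ · ∑ (λ a → β a · β a))  ≡⟨ cong (ε ·_) (∑-lin 1ℤ (λ a → α a · α a) -1ℤ (λ a → β a · β a)) ⟨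
        ε · ∑ (λ a → 1ℤ · (α a · α a) ∔ -1ℤ · (β a · β a))  ≡⟨ cong (ε ·_) (≡.trans (∑-cong (λ a → ≡.trans (lem₂ (α a · α a) (β a · β a)) (α²-β²≡ρ a))) ∑-ρ) ⟩
        ε · 0ℤ  ≡⟨ ≡.trans (ℤ.*-zeroʳ ε) (≡.sym (ℤ.*-zeroʳ W)) ⟩
        W · 0ℤ  ≡⟨ cong (W ·_) ρ-zero ⟨
        W · ρ 0#  ∎)
      (λ {x} x≉0 → begin
        (α ⋆ α) x ⊟ (β ⋆ β) x  ≡⟨ cong₂ _⊟_ (α⋆α-nonzero x≉0) (β⋆β-nonzero x≉0) ⟩
        _  ≡⟨ lem (α x · α x) (β x · β x) X Y ⟩
        W · (α x · α x ⊟ β x · β x)  ≡⟨ cong (W ·_) (α²-β²≡ρ x) ⟩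
        W · ρ x  ∎)
      where
      lem : ∀ u v x y → (u · x ∔ v · y) ⊟ (u · y ∔ v · x) ≡ (x ⊟ y) · (u ⊟ v)
      lem = solve-∀
      lem₁ : ∀ e u v → e · u ⊟ e · v ≡ e · (1ℤ · u ∔ -1ℤ · v)
      lem₁ = solve-∀
      lem₂ : ∀ u v → 1ℤ · u ∔ -1ℤ · v ≡ u ⊟ v
      lem₂ = solve-∀

    α⋆β-Z : ∀ x → (α ⋆ β) x ≡ Z · ρ x
    α⋆β-Z = ≗-off-zero (⋆-congruent α β-cong) (λ eq → cong (Z ·_) (ρ-cong eq))
      (begin
        (α ⋆ β) 0#  ≡⟨ at-zero α β β-cong β-neg ⟩
        ε · ∑ (λ a → α a · β a)  ≡⟨ cong (ε ·_) (≡.trans (∑-cong αβ≡0) (≡.trans (∑-const 0ℤ) (ℤ.*-zeroʳ Q))) ⟩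
        ε · 0ℤ  ≡⟨ ≡.trans (ℤ.*-zeroʳ ε) (≡.sym (ℤ.*-zeroʳ Z)) ⟩
        Z · 0ℤ  ≡⟨ cong (Z ·_) ρ-zero ⟨
        Z · ρ 0#  ∎)
      α⋆β-nonzero

    2α⋆α : ∀ x → + 2 · (α ⋆ α) x ≡ ε · E x ∔ W · ρ x
    2α⋆α x = ≡.trans (lem ((α ⋆ α) x) ((β ⋆ β) x)) (cong₂ _∔_ (αα+ββ x) (αα-ββ x))
      where
      lem : ∀ u v → + 2 · u ≡ (u ∔ v) ∔ (u ⊟ v)
      lem = solve-∀

    2β⋆β : ∀ x → + 2 · (β ⋆ β) x ≡ ε · E x ⊟ W · ρ x
    2β⋆β x = ≡.trans (lem ((α ⋆ α) x) ((β ⋆ β) x)) (cong₂ _⊟_ (αα+ββ x) (αα-ββ x))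
      where
      lem : ∀ u v → + 2 · v ≡ (u ∔ v) ⊟ (u ⊟ v)
      lem = solve-∀

  ρ⋆ρ≡E : ∀ x → (ρ ⋆ ρ) x ≡ E x
  ρ⋆ρ≡E x = ≡.trans (ρ⋆ρ x) (≡.trans (cong (_· E x) ρ-[-1]≡1) (ℤ.*-identityˡ (E x)))

  ⋆-lin : ∀ f u h v h′ x → (f ⋆ (λ y → u · h y ∔ v · h′ y)) x ≡ u · (f ⋆ h) x ∔ v · (f ⋆ h′) x
  ⋆-lin f u h v h′ x = ≡.trans (⋆-linearʳ f u h (λ y → v · h′ y) x) (cong (_∔_ (u · (f ⋆ h) x)) (⋆-scaleʳ f v h′ x))

  α-one : α 1# ≡ 1ℤ
  α-one = α-power 0 refl

  β-one : β 1# ≡ 0ℤ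
  β-one = β-power 0 refl

  -- Convolving χ twice with ρ conjugates it twice and multiplies by J and by conj J; it is also E ⋆
  -- χ = q χ. The two are compared at 1, where χ = 1.
  A²+B²≡Q : A · A ∔ B · B ≡ Q
  A²+B²≡Q = begin
    A · A ∔ B · B  ≡⟨ lem A B ⟩
    A · (A · 1ℤ ∔ B · 0ℤ) ∔ B · (B · 1ℤ ∔ (⊝ A) · 0ℤ)
      ≡⟨ cong₂ (λ u v → A · (A · u ∔ B · v) ∔ B · (B · u ∔ (⊝ A) · v)) α-one β-one ⟨
    A · (A · α 1# ∔ B · β 1#) ∔ B · (B · α 1# ∔ (⊝ A) · β 1#)
      ≡⟨ cong₂ (λ u v → A · u ∔ B · v) (ρ⋆α 1#) (ρ⋆β 1#) ⟨
    A · (ρ ⋆ α) 1# ∔ B · (ρ ⋆ β) 1#  ≡⟨ ⋆-lin ρ A α B β 1# ⟨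
    (ρ ⋆ (λ y → A · α y ∔ B · β y)) 1#  ≡⟨ ⋆-congʳ ρ ρ⋆α 1# ⟨
    (ρ ⋆ (ρ ⋆ α)) 1#  ≡⟨ ⋆-assoc ρ ρ-cong α-cong 1# ⟨
    ((ρ ⋆ ρ) ⋆ α) 1#  ≡⟨ ⋆-congˡ ρ⋆ρ≡E α 1# ⟩
    (E ⋆ α) 1#  ≡⟨ E-⋆ α-cong ∑-α 1# ⟩
    Q · α 1#  ≡⟨ cong (Q ·_) α-one ⟩
    Q · 1ℤ  ≡⟨ ℤ.*-identityʳ Q ⟩
    Q  ∎
    where
    lem : ∀ A B → A · A ∔ B · B ≡ A · (A · 1ℤ ∔ B · 0ℤ) ∔ B · (B · 1ℤ ∔ (⊝ A) · 0ℤ)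
    lem = solve-∀

  private
    α⋆ρ : ∀ x → (α ⋆ ρ) x ≡ A · α x ∔ B · β x
    α⋆ρ x = ≡.trans (⋆-comm α-cong ρ-cong x) (ρ⋆α x)

    -- Evaluation at 0 isolates the coefficient of E, because ρ vanishes there. The next two lemmas
    -- use this to obtain J(χ, χ) = χ(-1) J(ρ, χ) by components.
    E-zero-* : ∀ u v → u · E 0# ∔ v · ρ 0# ≡ + ord · u
    E-zero-* u v = ≡.trans (cong₂ (λ y z → u · y ∔ v · z) E-zero ρ-zero) (lem u v (+ ord))
      where
      lem : ∀ u v w → u · w ∔ v · 0ℤ ≡ w · u
      lem = solve-∀

    -- Compare (α ⋆ α) ⋆ ρ with α ⋆ (α ⋆ ρ) at 0.
    W≡εA : W ≡ ε · A
    W≡εA = ℤ.*-cancelˡ-≡ (+ ord) W (ε · A) {{ord-nonZero}} (begin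
      + ord · W  ≡⟨ E-zero-* W (ε · Q) ⟨
      W · E 0# ∔ (ε · Q) · ρ 0#  ≡⟨ lem₁ ε Q W (ρ 0#) (E 0#) ⟩
      ε · (Q · ρ 0#) ∔ W · E 0#  ≡⟨ cong₂ (λ u v → ε · u ∔ W · v) (E-⋆ ρ-cong ∑-ρ 0#) (ρ⋆ρ≡E 0#) ⟨
      ε · (E ⋆ ρ) 0# ∔ W · (ρ ⋆ ρ) 0#  ≡⟨ ≡.trans (⋆-linearˡ ε E (λ y → W · ρ y) ρ 0#) (cong (_∔_ (ε · (E ⋆ ρ) 0#)) (⋆-scaleˡ W ρ ρ 0#)) ⟨
      ((λ y → ε · E y ∔ W · ρ y) ⋆ ρ) 0#  ≡⟨ ⋆-congˡ 2α⋆α ρ 0# ⟨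
      ((λ y → + 2 · (α ⋆ α) y) ⋆ ρ) 0#  ≡⟨ ⋆-scaleˡ (+ 2) (α ⋆ α) ρ 0# ⟩
      + 2 · ((α ⋆ α) ⋆ ρ) 0#  ≡⟨ cong (+ 2 ·_) (⋆-assoc α α-cong ρ-cong 0#) ⟩
      + 2 · (α ⋆ (α ⋆ ρ)) 0#  ≡⟨ cong (+ 2 ·_) (≡.trans (⋆-congʳ α α⋆ρ 0#) (⋆-lin α A α B β 0#)) ⟩
      + 2 · (A · (α ⋆ α) 0# ∔ B · (α ⋆ β) 0#)  ≡⟨ lem₂ A B ((α ⋆ α) 0#) ((α ⋆ β) 0#) ⟩
      A · (+ 2 · (α ⋆ α) 0#) ∔ (+ 2 · B) · (α ⋆ β) 0#  ≡⟨ cong₂ (λ u v → A · u ∔ (+ 2 · B) · v) (2α⋆α 0#) (α⋆β-Z 0#) ⟩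
      A · (ε · E 0# ∔ W · ρ 0#) ∔ (+ 2 · B) · (Z · ρ 0#)  ≡⟨ lem₃ A B W Z ε (E 0#) (ρ 0#) ⟩
      (ε · A) · E 0# ∔ (A · W ∔ + 2 · B · Z) · ρ 0#  ≡⟨ E-zero-* (ε · A) (A · W ∔ + 2 · B · Z) ⟩
      + ord · (ε · A)  ∎)
      where
      lem₁ : ∀ e q c r E → c · E ∔ (e · q) · r ≡ e · (q · r) ∔ c · E
      lem₁ = solve-∀
      lem₂ : ∀ a b x y → + 2 · (a · x ∔ b · y) ≡ a · (+ 2 · x) ∔ (+ 2 · b) · y
      lem₂ = solve-∀
      lem₃ : ∀ a b c z e E r → a · (e · E ∔ c · r) ∔ (+ 2 · b) · (z · r) ≡ (e · a) · E ∔ (a · c ∔ + 2 · b · z) · r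
      lem₃ = solve-∀

    -- Compare (β ⋆ α) ⋆ ρ with β ⋆ (α ⋆ ρ) at 0.
    2Z≡εB : + 2 · Z ≡ ε · B
    2Z≡εB = ℤ.*-cancelˡ-≡ (+ ord) (+ 2 · Z) (ε · B) {{ord-nonZero}} (begin
      + ord · (+ 2 · Z)  ≡⟨ E-zero-* (+ 2 · Z) 0ℤ ⟨
      (+ 2 · Z) · E 0# ∔ 0ℤ · ρ 0#  ≡⟨ lem₁ Z (E 0#) (ρ 0#) ⟩
      + 2 · (Z · E 0#)  ≡⟨ cong (λ u → + 2 · (Z · u)) (ρ⋆ρ≡E 0#) ⟨
      + 2 · (Z · (ρ ⋆ ρ) 0#)  ≡⟨ cong (+ 2 ·_) (⋆-scaleˡ Z ρ ρ 0#) ⟨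
      + 2 · ((λ y → Z · ρ y) ⋆ ρ) 0#  ≡⟨ cong (+ 2 ·_) (⋆-congˡ β⋆α ρ 0#) ⟨
      + 2 · ((β ⋆ α) ⋆ ρ) 0#  ≡⟨ cong (+ 2 ·_) (⋆-assoc β α-cong ρ-cong 0#) ⟩
      + 2 · (β ⋆ (α ⋆ ρ)) 0#  ≡⟨ cong (+ 2 ·_) (≡.trans (⋆-congʳ β α⋆ρ 0#) (⋆-lin β A α B β 0#)) ⟩
      + 2 · (A · (β ⋆ α) 0# ∔ B · (β ⋆ β) 0#)  ≡⟨ lem₂ A B ((β ⋆ α) 0#) ((β ⋆ β) 0#) ⟩
      (+ 2 · A) · (β ⋆ α) 0# ∔ B · (+ 2 · (β ⋆ β) 0#)  ≡⟨ cong₂ (λ u v → (+ 2 · A) · u ∔ B · v) (β⋆α 0#) (2β⋆β 0#) ⟩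
      (+ 2 · A) · (Z · ρ 0#) ∔ B · (ε · E 0# ⊟ W · ρ 0#)  ≡⟨ lem₃ A B W Z ε (E 0#) (ρ 0#) ⟩
      (ε · B) · E 0# ∔ (+ 2 · A · Z ⊟ B · W) · ρ 0#  ≡⟨ E-zero-* (ε · B) (+ 2 · A · Z ⊟ B · W) ⟩
      + ord · (ε · B)  ∎)
      where
      β⋆α : ∀ x → (β ⋆ α) x ≡ Z · ρ x
      β⋆α x = ≡.trans (⋆-comm β-cong α-cong x) (α⋆β-Z x)
      lem₁ : ∀ z E r → (+ 2 · z) · E ∔ 0ℤ · r ≡ + 2 · (z · E)
      lem₁ = solve-∀
      lem₂ : ∀ a b x y → + 2 · (a · x ∔ b · y) ≡ (+ 2 · a) · x ∔ b · (+ 2 · y)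
      lem₂ = solve-∀
      lem₃ : ∀ a b c z e E r → (+ 2 · a) · (z · r) ∔ b · (e · E ⊟ c · r) ≡ (e · b) · E ∔ (+ 2 · a · z ⊟ b · c) · r
      lem₃ = solve-∀

  2α⋆α≡ : ∀ x → + 2 · (α ⋆ α) x ≡ ε · E x ∔ (ε · A) · ρ x
  2α⋆α≡ x = ≡.trans (2α⋆α x) (cong (λ u → ε · E x ∔ u · ρ x) W≡εA)

  2α⋆β≡ : ∀ x → + 2 · (α ⋆ β) x ≡ (ε · B) · ρ x
  2α⋆β≡ x = ≡.trans (cong (+ 2 ·_) (α⋆β-Z x)) (≡.trans (≡.sym (ℤ.*-assoc (+ 2) Z (ρ x))) (cong (_· ρ x) 2Z≡εB))

  h : Carrier → ℤ
  h x = + 2 · α x ∔ ρ x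

  h-cong : Congruent h
  h-cong eq = cong₂ (λ u v → + 2 · u ∔ v) (α-cong eq) (ρ-cong eq)

  ∑-h : ∑ h ≡ 0ℤ
  ∑-h = ≡.trans (∑-+ (λ x → + 2 · α x) ρ) (cong₂ _∔_ (≡.trans (∑-* (+ 2) α) (cong (+ 2 ·_) ∑-α)) ∑-ρ)

  ∑-fourth : ∀ f → Congruent f → ∑ (λ y → f (y ^ 4)) ≡ ∑ (λ a → one+ h a · f a)
  ∑-fourth = ∑-power 4 k ord≡ (one+ h) (λ eq → cong (λ z → 1ℤ · z ∔ 1ℤ) (h-cong eq))
    (cong₂ (λ u v → 1ℤ · (+ 2 · u ∔ v) ∔ 1ℤ) (lift-zero cosℕ refl) (lift-zero signℕ refl)) block
    where
    lem : ∀ t u v w → (+ 4 · 1ℤ ∔ 0ℤ) · t ∔ ((+ 4 · 0ℤ ∔ 0ℤ) · u ∔ ((+ 4 · 0ℤ ∔ 0ℤ) · v ∔ ((+ 4 · 0ℤ ∔ 0ℤ) · w ∔ 0ℤ))) ≡ + 4 · t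
    lem = solve-∀
    weight : ∀ j i → 1ℤ · h (g ^ (j ℕ.* 4 ℕ.+ i)) ∔ 1ℤ ≡ + 4 · fourthℕ i ∔ 0ℤ
    weight j i = ≡.trans (cong₂ (λ u v → 1ℤ · (+ 2 · u ∔ v) ∔ 1ℤ) (α-power (j ℕ.* 4 ℕ.+ i) refl) (ρ-power (j ℕ.* 4 ℕ.+ i) refl))
      (≡.trans (fourth-tables (j ℕ.* 4 ℕ.+ i)) (cong (λ z → + 4 · z ∔ 0ℤ) (fourth-4*k j i)))
    block : ∀ j (H : ℕ → ℤ) → range 4 (λ i → (1ℤ · h (g ^ (j ℕ.* 4 ℕ.+ i)) ∔ 1ℤ) · H i) ≡ + 4 · H 0
    block j H = ≡.trans (range-cong 4 (λ i → cong (_· H i) (weight j i))) (lem (H 0) (H 1) (H 2) (H 3))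

  comb : Coords ℤ → Carrier → ℤ
  comb ⟨ e , r , a , b ⟩ x = e · E x ∔ (r · ρ x ∔ (a · α x ∔ b · β x))

  -- Convolution by h while A and B are still unknown; `step` is this map at A = -ε s, B = 2 ε t.
  stepJ : Coords ℤ → Coords ℤ
  stepJ ⟨ e , r , a , b ⟩ =
    ⟨ r ∔ ε · a
    , Q · e ∔ ε · A · a ∔ ε · B · b
    , + 2 · Q · e ∔ + 2 · A · r ∔ A · a ∔ B · b
    , + 2 · B · r ∔ B · a ⊟ A · b ⟩

  h⋆comb : ∀ v x → (h ⋆ comb v) x ≡ comb (stepJ v) x
  h⋆comb ⟨ e , r , a , b ⟩ x = begin
    (h ⋆ comb ⟨ e , r , a , b ⟩) x
      ≡⟨ ⋆-linearʳ h e E (λ y → r · ρ y ∔ (a · α y ∔ b · β y)) x ⟩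
    e · (h ⋆ E) x ∔ (h ⋆ (λ y → r · ρ y ∔ (a · α y ∔ b · β y))) x
      ≡⟨ cong (_∔_ (e · (h ⋆ E) x)) (≡.trans (⋆-linearʳ h r ρ (λ y → a · α y ∔ b · β y) x) (cong (_∔_ (r · (h ⋆ ρ) x)) (⋆-lin h a α b β x))) ⟩
    e · (h ⋆ E) x ∔ (r · (h ⋆ ρ) x ∔ (a · (h ⋆ α) x ∔ b · (h ⋆ β) x))
      ≡⟨ cong₂ _∔_ (cong (e ·_) h⋆E) (cong₂ _∔_ (cong (r ·_) h⋆ρ) (cong₂ _∔_ (cong (a ·_) h⋆α) (cong (b ·_) h⋆β))) ⟩
    e · (Q · (+ 2 · α x ∔ ρ x)) ∔ (r · (+ 2 · (A · α x ∔ B · β x) ∔ E x)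
      ∔ (a · ((ε · E x ∔ (ε · A) · ρ x) ∔ (A · α x ∔ B · β x))
      ∔ b · ((ε · B) · ρ x ∔ (B · α x ∔ (⊝ A) · β x))))
      ≡⟨ lem e r a b Q A B ε (E x) (ρ x) (α x) (β x) ⟩
    comb (stepJ ⟨ e , r , a , b ⟩) x ∎
    where
    h⋆E : (h ⋆ E) x ≡ Q · h x
    h⋆E = ≡.trans (⋆-comm h-cong E-cong x) (E-⋆ h-cong ∑-h x)
    h⋆ρ : (h ⋆ ρ) x ≡ + 2 · (A · α x ∔ B · β x) ∔ E x
    h⋆ρ = ≡.trans (⋆-linearˡ (+ 2) α ρ ρ x) (cong₂ (λ u v → + 2 · u ∔ v) (α⋆ρ x) (ρ⋆ρ≡E x))
    h⋆α : (h ⋆ α) x ≡ (ε · E x ∔ (ε · A) · ρ x) ∔ (A · α x ∔ B · β x)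
    h⋆α = ≡.trans (⋆-linearˡ (+ 2) α ρ α x) (cong₂ _∔_ (2α⋆α≡ x) (ρ⋆α x))
    h⋆β : (h ⋆ β) x ≡ (ε · B) · ρ x ∔ (B · α x ∔ (⊝ A) · β x)
    h⋆β = ≡.trans (⋆-linearˡ (+ 2) α ρ β x) (cong₂ _∔_ (2α⋆β≡ x) (ρ⋆β x))
    lem : ∀ e r a b q A B ε E ρ α β →
      e · (q · (+ 2 · α ∔ ρ)) ∔ (r · (+ 2 · (A · α ∔ B · β) ∔ E)
      ∔ (a · ((ε · E ∔ (ε · A) · ρ) ∔ (A · α ∔ B · β))
      ∔ b · ((ε · B) · ρ ∔ (B · α ∔ (⊝ A) · β))))
      ≡ (r ∔ ε · a) · E ∔ ((q · e ∔ ε · A · a ∔ ε · B · b) · ρ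
      ∔ ((+ 2 · q · e ∔ + 2 · A · r ∔ A · a ∔ B · b) · α
      ∔ (+ 2 · B · r ∔ B · a ⊟ A · b) · β))
    lem = solve-∀

  coordsJ : ℕ → Coords ℤ
  coordsJ zero    = ⟨ 0ℤ , 1ℤ , + 2 , 0ℤ ⟩
  coordsJ (suc n) = stepJ (coordsJ n)

  convPower-h : ∀ n x → convPower h n x ≡ comb (coordsJ n) x
  convPower-h zero    x = lem (E x) (ρ x) (α x) (β x)
    where
    lem : ∀ E ρ α β → + 2 · α ∔ ρ ≡ 0ℤ · E ∔ (1ℤ · ρ ∔ (+ 2 · α ∔ 0ℤ · β))
    lem = solve-∀
  convPower-h (suc n) x = ≡.trans (⋆-congʳ h (convPower-h n) x) (h⋆comb (coordsJ n) x)

  N-formula-quartic : ∀ n x → + N F (suc n) x ≡ Q ℤ.^ n ∔ comb (coordsJ n) x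
  N-formula-quartic n x = ≡.trans (N-formula h h-cong ∑-h ∑-fourth n x) (cong (_∔_ (Q ℤ.^ n)) (convPower-h n x))

  -- The indicator of the nonzero fourth powers.
  κ : Carrier → ℤ
  κ = lift fourthℕ

  fourth-periodic : Periodic fourthℕ
  fourth-periodic n = ≡.trans (cong (λ m → fourthℕ (m ℕ.+ n)) ord≡) (fourth-4*k k n)

  κ-power : ∀ {x} i → x ≈ g ^ i → κ x ≡ fourthℕ i
  κ-power = lift-g^ fourth-periodic

  κ-cong : Congruent κ
  κ-cong = lift-cong fourthℕ

  -- Both sides count fourth roots: four over a nonzero fourth power, one over 0.
  1+h≡4κ+δ : ∀ x → 1ℤ · h x ∔ 1ℤ ≡ + 4 · κ x ∔ δ x
  1+h≡4κ+δ x with zero-or-power x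
  ... | inj₁ x≈0 rewrite lift-zero signℕ x≈0 | lift-zero cosℕ x≈0 | lift-zero fourthℕ x≈0 | δ-zero x≈0 = ≡.refl
  ... | inj₂ (i , x≈) rewrite ρ-power i x≈ | α-power i x≈ | κ-power i x≈
    | δ-nonzero {x} (λ x≈0 → ^-≉0 i g≉0 (trans (sym x≈) x≈0)) = fourth-tables i

  -- The convolution square of 4 κ + δ: only κ ⋆ κ is unknown, and it carries the factor 16.
  N₂-mod-16 : ∀ x → + N F 2 x ≡ + 16 · (κ ⋆ κ) x ∔ (+ 8 · κ x ∔ δ x)
  N₂-mod-16 x = begin
    + N F 2 x  ≡⟨ N-⋆ h h-cong ∑-h ∑-fourth 1 x ⟩
    ((one+ h) ⋆ (λ y → + N F 1 y)) x  ≡⟨ ⋆-congˡ 1+h≡4κ+δ (λ y → + N F 1 y) x ⟩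
    (R ⋆ (λ y → + N F 1 y)) x  ≡⟨ ⋆-congʳ R (λ y → ≡.trans (N-formula h h-cong ∑-h ∑-fourth 0 y) (≡.trans (lem₀ (h y)) (1+h≡4κ+δ y))) x ⟩
    (R ⋆ R) x  ≡⟨ ⋆-linearˡ (+ 4) κ δ R x ⟩
    + 4 · (κ ⋆ R) x ∔ (δ ⋆ R) x  ≡⟨ cong₂ (λ u v → + 4 · u ∔ v) κ⋆R (δ-⋆ R-cong x) ⟩
    + 4 · (+ 4 · (κ ⋆ κ) x ∔ κ x) ∔ (+ 4 · κ x ∔ δ x)  ≡⟨ lem₁ ((κ ⋆ κ) x) (κ x) (δ x) ⟩
    + 16 · (κ ⋆ κ) x ∔ (+ 8 · κ x ∔ δ x)  ∎
    where
    R : Carrier → ℤ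
    R y = + 4 · κ y ∔ δ y
    R-cong : Congruent R
    R-cong eq = cong₂ (λ u v → + 4 · u ∔ v) (κ-cong eq) (δ-cong eq)
    κ⋆R : (κ ⋆ R) x ≡ + 4 · (κ ⋆ κ) x ∔ κ x
    κ⋆R = ≡.trans (⋆-linearʳ κ (+ 4) κ δ x) (cong (_∔_ (+ 4 · (κ ⋆ κ) x)) (≡.trans (⋆-comm κ-cong δ-cong x) (δ-⋆ κ-cong x)))
    lem₀ : ∀ x → 1ℤ ∔ x ≡ 1ℤ · x ∔ 1ℤ
    lem₀ = solve-∀
    lem₁ : ∀ u v w → + 4 · (+ 4 · u ∔ v) ∔ (+ 4 · v ∔ w) ≡ + 16 · u ∔ (+ 8 · v ∔ w)
    lem₁ = solve-∀

  comb-power : ∀ v {x} i → x ≈ g ^ i → comb v x ≡ value i v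
  comb-power ⟨ e , r , a , b ⟩ {x} i x≈ = begin
    e · E x ∔ (r · ρ x ∔ (a · α x ∔ b · β x))
      ≡⟨ cong₂ (λ u v → e · u ∔ (r · v ∔ (a · α x ∔ b · β x)))
           (E-nonzero (λ x≈0 → ^-≉0 i g≉0 (trans (sym x≈) x≈0))) (ρ-power i x≈) ⟩
    e · -1ℤ ∔ (r · signℕ i ∔ (a · α x ∔ b · β x))
      ≡⟨ cong₂ (λ u v → e · -1ℤ ∔ (r · signℕ i ∔ (a · u ∔ b · v))) (α-power i x≈) (β-power i x≈) ⟩
    e · -1ℤ ∔ (r · signℕ i ∔ (a · cosℕ i ∔ b · sinℕ i))
      ≡⟨ lem e r a b (signℕ i) (cosℕ i) (sinℕ i) ⟩
    value i ⟨ e , r , a , b ⟩  ∎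
    where
    lem : ∀ e r a b x y z → e · -1ℤ ∔ (r · x ∔ (a · y ∔ b · z)) ≡ ⊝ e ∔ x · r ∔ y · a ∔ z · b
    lem = solve-∀

  N₂-power : ∀ i → + N F 2 (g ^ i) ≡ Q · 1ℤ ∔ value i (coordsJ 1)
  N₂-power i = ≡.trans (N-formula-quartic 1 (g ^ i)) (cong (_∔_ (Q · 1ℤ)) (comb-power (coordsJ 1) i refl))

  N₂-power-mod-16 : ∀ i → Q · 1ℤ ∔ value i (coordsJ 1) ≡ + 16 · (κ ⋆ κ) (g ^ i) ∔ (+ 8 · fourthℕ i ∔ 0ℤ)
  N₂-power-mod-16 i = ≡.trans (≡.sym (N₂-power i)) (≡.trans (N₂-mod-16 (g ^ i))
    (cong₂ (λ u v → + 16 · (κ ⋆ κ) (g ^ i) ∔ (+ 8 · u ∔ v)) (κ-power i refl) (δ-nonzero (^-≉0 i g≉0))))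

  -- N_2 is taken at g², not a fourth power, so it is divisible by 16. There the multiple of A is 2
  -- ε - 4 = -2, which gives A modulo 4 once q is known modulo 8.
  A-mod-8-when-ε≡1 : ε ≡ 1ℤ → ∃ λ K → Q ≡ + 16 · K ∔ + 3 ∔ + 2 · A
  A-mod-8-when-ε≡1 ε≡1 = K , (begin
    Q  ≡⟨ lem₁ Q A ⟩
    f 1ℤ ∔ + 3 ∔ + 2 · A  ≡⟨ cong (λ e → f e ∔ + 3 ∔ + 2 · A) ε≡1 ⟨
    f ε ∔ + 3 ∔ + 2 · A  ≡⟨ cong (λ z → z ∔ + 3 ∔ + 2 · A) (≡.trans (lem₂ Q A B ε) (N₂-power-mod-16 2)) ⟩
    (+ 16 · K ∔ 0ℤ) ∔ + 3 ∔ + 2 · A  ≡⟨ cong (λ z → z ∔ + 3 ∔ + 2 · A) (ℤ.+-identityʳ (+ 16 · K)) ⟩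
    + 16 · K ∔ + 3 ∔ + 2 · A  ∎)
    where
    K = (κ ⋆ κ) (g ^ 2)
    f : ℤ → ℤ
    f ε = Q ⊟ 1ℤ ⊟ + 2 · ε ∔ + 2 · ε · A ⊟ + 4 · A
    lem₁ : ∀ Q A → Q ≡ (Q ⊟ 1ℤ ⊟ + 2 · 1ℤ ∔ + 2 · 1ℤ · A ⊟ + 4 · A) ∔ + 3 ∔ + 2 · A
    lem₁ = solve-∀
    lem₂ : ∀ Q A B ε → Q ⊟ 1ℤ ⊟ + 2 · ε ∔ + 2 · ε · A ⊟ + 4 · A ≡ Q · 1ℤ ∔ (⊝ (1ℤ ∔ ε · + 2) ∔ 1ℤ · (Q · 0ℤ ∔ ε · A · + 2 ∔ ε · B · 0ℤ)
      ∔ -1ℤ · (+ 2 · Q · 0ℤ ∔ + 2 · A · 1ℤ ∔ A · + 2 ∔ B · 0ℤ) ∔ 0ℤ · (+ 2 · B · 1ℤ ∔ B · + 2 ⊟ A · 0ℤ))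
    lem₂ = solve-∀

  -- Here N_2 is taken at 1, where the multiple of A is 2 ε + 4 = 2. The fourth power 1 contributes
  -- 8, and 7 is 8 - 1.
  A-mod-8-when-ε≡-1 : ε ≡ -1ℤ → ∃ λ K → Q ∔ + 2 · A ≡ + 16 · K ∔ + 7
  A-mod-8-when-ε≡-1 ε≡-1 = K , (begin
    Q ∔ + 2 · A  ≡⟨ lem₁ Q A ⟩
    f -1ℤ ⊟ 1ℤ  ≡⟨ cong (λ e → f e ⊟ 1ℤ) ε≡-1 ⟨
    f ε ⊟ 1ℤ  ≡⟨ cong (_⊟ 1ℤ) (≡.trans (lem₂ Q A B ε) (N₂-power-mod-16 0)) ⟩
    (+ 16 · K ∔ + 8) ⊟ 1ℤ  ≡⟨ ℤ.+-assoc (+ 16 · K) (+ 8) -1ℤ ⟩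
    + 16 · K ∔ + 7  ∎)
    where
    K = (κ ⋆ κ) (g ^ 0)
    f : ℤ → ℤ
    f ε = Q ⊟ 1ℤ ⊟ + 2 · ε ∔ + 2 · ε · A ∔ + 4 · A
    lem₁ : ∀ Q A → Q ∔ + 2 · A ≡ (Q ⊟ 1ℤ ⊟ + 2 · -1ℤ ∔ + 2 · -1ℤ · A ∔ + 4 · A) ⊟ 1ℤ
    lem₁ = solve-∀
    lem₂ : ∀ Q A B ε → Q ⊟ 1ℤ ⊟ + 2 · ε ∔ + 2 · ε · A ∔ + 4 · A ≡ Q · 1ℤ ∔ (⊝ (1ℤ ∔ ε · + 2) ∔ 1ℤ · (Q · 0ℤ ∔ ε · A · + 2 ∔ ε · B · 0ℤ)
      ∔ 1ℤ · (+ 2 · Q · 0ℤ ∔ + 2 · A · 1ℤ ∔ A · + 2 ∔ B · 0ℤ) ∔ 0ℤ · (+ 2 · B · 1ℤ ∔ B · + 2 ⊟ A · 0ℤ))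
    lem₂ = solve-∀

-- The homomorphism from ℤ to the field.

module Reduction {c ℓ} (F : FiniteField c ℓ) where
  open Field F
  open SetoidReasoning setoid

  ν : ℕ → Carrier
  ν = ℕtoF F

  φ : ℤ → Carrier
  φ = ℤtoF F

  ν-+ : ∀ m n → ν (m ℕ.+ n) ≈ ν m + ν n
  ν-+ zero    n = sym (+-identityˡ (ν n))
  ν-+ (suc m) n = trans (+-congˡ (ν-+ m n)) (sym (+-assoc 1# (ν m) (ν n)))

  ν-1 : ν 1 ≈ 1#
  ν-1 = +-identityʳ 1#

  ν-* : ∀ m n → ν (m ℕ.* n) ≈ ν m * ν n
  ν-* zero    n = sym (zeroˡ (ν n))
  ν-* (suc m) n = begin
    ν (n ℕ.+ m ℕ.* n)  ≈⟨ ν-+ n (m ℕ.* n) ⟩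
    ν n + ν (m ℕ.* n)  ≈⟨ +-cong (sym (*-identityˡ (ν n))) (ν-* m n) ⟩
    1# * ν n + ν m * ν n  ≈⟨ distribʳ (ν n) 1# (ν m) ⟨
    (1# + ν m) * ν n  ∎

  ν-^ : ∀ m n → ν (m ℕ.^ n) ≈ ν m ^ n
  ν-^ m zero    = ν-1
  ν-^ m (suc n) = trans (ν-* m (m ℕ.^ n)) (*-congˡ (ν-^ m n))

  φ-neg : ∀ x → φ (⊝ x) ≈ - φ x
  φ-neg (+ zero)  = sym -0#≈0#
  φ-neg (+ suc n) = refl
  φ-neg -[1+ n ]  = sym (-‿involutive (ν (suc n)))

  φ-⊖ : ∀ m n → φ (m ℤ.⊖ n) ≈ ν m - ν n
  φ-⊖ zero    zero    = sym (-‿inverseʳ 0#)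
  φ-⊖ zero    (suc n) = sym (+-identityˡ (- ν (suc n)))
  φ-⊖ (suc m) zero    = sym (trans (+-congˡ -0#≈0#) (+-identityʳ (ν (suc m))))
  φ-⊖ (suc m) (suc n) = begin
    φ (suc m ℤ.⊖ suc n)  ≡⟨ cong φ (ℤ.[1+m]⊖[1+n]≡m⊖n m n) ⟩
    φ (m ℤ.⊖ n)  ≈⟨ φ-⊖ m n ⟩
    ν m - ν n  ≈⟨ +-congʳ (+-identityˡ (ν m)) ⟨
    (0# + ν m) - ν n  ≈⟨ +-congʳ (+-congʳ (-‿inverseʳ 1#)) ⟨
    ((1# - 1#) + ν m) - ν n  ≈⟨ +-congʳ (trans (+-assoc 1# (- 1#) (ν m)) (trans (+-congˡ (+-comm (- 1#) (ν m))) (sym (+-assoc 1# (ν m) (- 1#))))) ⟩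
    ((1# + ν m) - 1#) - ν n  ≈⟨ +-assoc (1# + ν m) (- 1#) (- ν n) ⟩
    (1# + ν m) + (- 1# + - ν n)  ≈⟨ +-congˡ (-‿+-comm 1# (ν n)) ⟩
    ν (suc m) - ν (suc n)  ∎

  φ-+ : ∀ x y → φ (x ∔ y) ≈ φ x + φ y
  φ-+ (+ m)    (+ n)    = ν-+ m n
  φ-+ (+ m)    -[1+ n ] = φ-⊖ m (suc n)
  φ-+ -[1+ m ] (+ n)    = trans (φ-⊖ n (suc m)) (+-comm (ν n) (- ν (suc m)))
  φ-+ -[1+ m ] -[1+ n ] = begin
    - ν (suc (suc (m ℕ.+ n)))  ≡⟨ cong (λ k → - ν (suc k)) (ℕ.+-suc m n) ⟨
    - ν (suc m ℕ.+ suc n)  ≈⟨ -‿cong (ν-+ (suc m) (suc n)) ⟩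
    - (ν (suc m) + ν (suc n))  ≈⟨ -‿+-comm (ν (suc m)) (ν (suc n)) ⟨
    - ν (suc m) + - ν (suc n)  ∎

  φ-ν* : ∀ m y → φ (+ m · y) ≈ ν m * φ y
  φ-ν* zero    y = trans (reflexive (cong φ (ℤ.*-zeroˡ y))) (sym (zeroˡ (φ y)))
  φ-ν* (suc m) y = begin
    φ (+ suc m · y)  ≡⟨ cong φ (ℤ.suc-* (+ m) y) ⟩
    φ (y ∔ + m · y)  ≈⟨ φ-+ y (+ m · y) ⟩
    φ y + φ (+ m · y)  ≈⟨ +-cong (sym (*-identityˡ (φ y))) (φ-ν* m y) ⟩
    1# * φ y + ν m * φ y  ≈⟨ distribʳ (φ y) 1# (ν m) ⟨
    (1# + ν m) * φ y  ∎

  φ-* : ∀ x y → φ (x · y) ≈ φ x * φ y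
  φ-* (+ m)    y = φ-ν* m y
  φ-* -[1+ m ] y = begin
    φ (-[1+ m ] · y)  ≡⟨ cong φ (ℤ.neg-distribˡ-* (+ suc m) y) ⟨
    φ (⊝ (+ suc m · y))  ≈⟨ φ-neg (+ suc m · y) ⟩
    - φ (+ suc m · y)  ≈⟨ -‿cong (φ-ν* (suc m) y) ⟩
    - (ν (suc m) * φ y)  ≈⟨ -‿distribˡ-* (ν (suc m)) (φ y) ⟩
    - ν (suc m) * φ y  ∎

  ν-abs : ∀ x → φ x ≈ 0# → ν ∣ x ∣ ≈ 0#
  ν-abs (+ n)    eq = eq
  ν-abs -[1+ n ] eq = trans (sym (-‿involutive (ν (suc n)))) (trans (-‿cong eq) -0#≈0#)

  φ-abs : ∀ x → ν ∣ x ∣ ≈ 0# → φ x ≈ 0#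
  φ-abs (+ n)    eq = eq
  φ-abs -[1+ n ] eq = trans (-‿cong eq) -0#≈0#

  open Summation cring using () renaming (∑ to ∑F; ∑-translate to ∑F-translate; ∑-+ to ∑F-+; sum to sumF)

  sumF-1 : ∀ n → sumF {n} (λ _ → 1#) ≈ ν n
  sumF-1 zero    = refl
  sumF-1 (suc n) = +-congˡ (sumF-1 n)

  -- Translation by 1 leaves the sum of all elements unchanged.
  ν-size : ν size ≈ 0#
  ν-size = trans (sym (sumF-1 size)) (+-cancelʳ (∑F (λ x → x)) (∑F (λ _ → 1#)) 0#
    (trans (sym (∑F-+ (λ _ → 1#) (λ x → x))) (trans (sym (∑F-translate 1# (λ x → x) (λ eq → eq))) (sym (+-identityˡ _)))))

  module Characteristic (p m : ℕ) (size≡ : size ≡ p ℕ.^ m) where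
    -- p^m is the size, which is 0 in `F`, and a field has no nilpotents.
    ν-p : ν p ≈ 0#
    ν-p with ν p ≟ 0#
    ... | yes eq = eq
    ... | no  ne = ⊥-elim (^-≉0 m ne (trans (sym (ν-^ p m)) (trans (reflexive (cong ν (≡.sym size≡))) ν-size)))

    ν-divisible : ∀ {n} → p ∣ n → ν n ≈ 0#
    ν-divisible (divides q ≡.refl) = trans (ν-* q p) (trans (*-congˡ ν-p) (zeroʳ (ν q)))

    ν-coprime : ∀ {n} → Coprime p n → ¬ (ν n ≈ 0#)
    ν-coprime {n} cop νn≈0 with coprime-Bézout cop
    ... | Bézout.+- x y eq = 1≉0 (begin
      1#  ≈⟨ +-identityʳ 1# ⟨
      1# + 0#  ≈⟨ +-congˡ (trans (ν-* y n) (trans (*-congˡ νn≈0) (zeroʳ (ν y)))) ⟨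
      ν (1 ℕ.+ y ℕ.* n)  ≡⟨ cong ν eq ⟩
      ν (x ℕ.* p)  ≈⟨ ν-divisible (divides x ≡.refl) ⟩
      0#  ∎)
    ... | Bézout.-+ x y eq = 1≉0 (begin
      1#  ≈⟨ +-identityʳ 1# ⟨
      1# + 0#  ≈⟨ +-congˡ (ν-divisible (divides x ≡.refl)) ⟨
      ν (1 ℕ.+ x ℕ.* p)  ≡⟨ cong ν eq ⟩
      ν (y ℕ.* n)  ≈⟨ trans (ν-* y n) (trans (*-congˡ νn≈0) (zeroʳ (ν y))) ⟩
      0#  ∎)

-- Jacobi sums reduced to the field, by power sums.

module JacobiReduction {c ℓ} (F : FiniteField c ℓ) (g : FiniteField.Carrier F) (gen : IsGenerator F g)
  (k : ℕ) (ord≡ : FiniteField.size F ℕ.∸ 1 ≡ k ℕ.* 4) where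
  open Quartic F g gen k ord≡
  open Reduction F
  open SetoidReasoning setoid
  private module S = Summation cring

  -- The Jacobi sum of the i-th and l-th power maps, which is what J becomes when characters reduce
  -- to powers.
  S : ℕ → ℕ → Carrier
  S i l = S.∑ (λ a → a ^ i * (1# - a) ^ l)

  S-term-cong : ∀ i l → S.Congruent (λ a → a ^ i * (1# - a) ^ l)
  S-term-cong i l eq = *-cong (^-cong i eq) (^-cong l (+-congˡ (-‿cong eq)))

  S-sym : ∀ i l → S i l ≈ S l i
  S-sym i l = trans (S.∑-reflect 1# _ (S-term-cong i l))
    (S.∑-cong (λ a → trans (*-comm ((1# - a) ^ i) ((1# - (1# - a)) ^ l)) (*-congʳ {x = (1# - a) ^ i} (^-cong l (x-[x-y]≈y 1# a)))))

  -- One factor 1 - a is split as a difference. Iterating this stands in for the binomial expansion.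
  S-suc : ∀ i l → S i (suc l) ≈ S i l - S (suc i) l
  S-suc i l = begin
    S i (suc l)  ≈⟨ S.∑-cong (λ a → term a (a ^ i) ((1# - a) ^ l)) ⟩
    S.∑ (λ a → a ^ i * (1# - a) ^ l + - 1# * (a ^ suc i * (1# - a) ^ l))  ≈⟨ S.∑-+ (λ a → a ^ i * (1# - a) ^ l) (λ a → - 1# * (a ^ suc i * (1# - a) ^ l)) ⟩
    S i l + S.∑ (λ a → - 1# * (a ^ suc i * (1# - a) ^ l))  ≈⟨ +-congˡ (S.∑-* (- 1#) (λ a → a ^ suc i * (1# - a) ^ l)) ⟩
    S i l + - 1# * S (suc i) l  ≈⟨ +-congˡ (-1*x≈-x (S (suc i) l)) ⟩
    S i l - S (suc i) l  ∎
    where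
    term : ∀ a u v → u * ((1# - a) * v) ≈ u * v + - 1# * (a * u * v)
    term a u v = begin
      u * ((1# - a) * v)  ≈⟨ *-congˡ (distribʳ v 1# (- a)) ⟩
      u * (1# * v + - a * v)  ≈⟨ distribˡ u (1# * v) (- a * v) ⟩
      u * (1# * v) + u * (- a * v)  ≈⟨ +-cong (*-congˡ (*-identityˡ v)) last ⟩
      u * v + - 1# * (a * u * v)  ∎
      where
      last : u * (- a * v) ≈ - 1# * (a * u * v)
      last = begin
        u * (- a * v)  ≈⟨ *-congˡ (-‿distribˡ-* a v) ⟨
        u * (- (a * v))  ≈⟨ -‿distribʳ-* u (a * v) ⟨
        - (u * (a * v))  ≈⟨ -‿cong (trans (sym (*-assoc u a v)) (*-congʳ (*-comm u a))) ⟩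
        - (a * u * v)  ≈⟨ -1*x≈-x (a * u * v) ⟨
        - 1# * (a * u * v)  ∎

  powerSum : ∀ i → S i 0 ≈ S.∑ (λ a → a ^ i)
  powerSum i = S.∑-cong (λ a → *-identityʳ (a ^ i))

  -- The sum is unchanged under the factor g^i, which is not 1 for 0 < i < `ord`. For i = 0 it
  -- counts the field, and the count is 0 in `F`.
  powerSum-small : ∀ i → i ℕ.< ord → S i 0 ≈ 0#
  powerSum-small zero    _   = trans (powerSum 0) (trans (sumF-1 size) ν-size)
  powerSum-small (suc i) i<ord = x*y≈0⇒ (g ^ suc i - 1#) (λ eq → ℕ.<⇒≱ i<ord (ord≤ (suc i) (x-y≈0⇒x≈y eq))) (begin
    (g ^ suc i - 1#) * P  ≈⟨ distribʳ P (g ^ suc i) (- 1#) ⟩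
    g ^ suc i * P + - 1# * P  ≈⟨ +-cong scaled (-1*x≈-x P) ⟩
    P - P  ≈⟨ -‿inverseʳ P ⟩
    0#  ∎)
    where
    P = S (suc i) 0
    scaled : g ^ suc i * P ≈ P
    scaled = begin
      g ^ suc i * P  ≈⟨ *-congˡ (powerSum (suc i)) ⟩
      g ^ suc i * S.∑ (λ a → a ^ suc i)  ≈⟨ S.∑-* (g ^ suc i) (λ a → a ^ suc i) ⟨
      S.∑ (λ a → g ^ suc i * a ^ suc i)  ≈⟨ S.∑-cong (λ a → ^-distrib-* g a (suc i)) ⟨
      S.∑ (λ a → (g * a) ^ suc i)  ≈⟨ S.∑-scale g g≉0 (λ a → a ^ suc i) (^-cong (suc i)) ⟨
      S.∑ (λ a → a ^ suc i)  ≈⟨ powerSum (suc i) ⟨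
      P  ∎

  fermat : ∀ {x} → ¬ (x ≈ 0#) → x ^ ord ≈ 1#
  fermat {x} x≉0 with nonzero-power x≉0
  ... | i , x≈ = begin
    x ^ ord  ≈⟨ ^-cong ord x≈ ⟩
    (g ^ i) ^ ord  ≈⟨ ^-* g ord i ⟨
    g ^ (ord ℕ.* i)  ≡⟨ cong (g ^_) (ℕ.*-comm ord i) ⟩
    g ^ (i ℕ.* ord)  ≈⟨ ^-* g i ord ⟩
    (g ^ ord) ^ i  ≈⟨ ^-cong i g^ord≈1 ⟩
    1# ^ i  ≈⟨ 1^ i ⟩
    1#  ∎

  0^ : ∀ n → .{{NonZero n}} → 0# ^ n ≈ 0#
  0^ (suc n) = zeroˡ (0# ^ n)

  powerSum-ord : S ord 0 ≈ - 1#
  powerSum-ord = begin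
    S ord 0  ≈⟨ powerSum ord ⟩
    S.∑ (λ a → a ^ ord)  ≈⟨ S.∑-enumeration enum′ enum′-inj enum′-surj (λ a → a ^ ord) (^-cong ord) ⟩
    0# ^ ord + S.sum {ord} (λ j → (g ^ toℕ j) ^ ord)  ≈⟨ +-cong (0^ ord {{ord-nonZero}}) (S.sum-cong-≋ {ord} (λ j → fermat (^-≉0 (toℕ j) g≉0))) ⟩
    0# + S.sum {ord} (λ _ → 1#)  ≈⟨ trans (+-identityˡ _) (sumF-1 ord) ⟩
    ν ord  ≈⟨ x+y-y≈x (ν ord) 1# ⟨
    (ν ord + 1#) - 1#  ≈⟨ +-congʳ (+-comm (ν ord) 1#) ⟩
    ν (suc ord) - 1#  ≡⟨ cong (λ n → ν n - 1#) size≡1+ord ⟨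
    ν size - 1#  ≈⟨ +-congʳ ν-size ⟩
    0# - 1#  ≈⟨ +-identityˡ (- 1#) ⟩
    - 1#  ∎

  -- A polynomial of degree below q - 1 sums to 0 over the field.
  S-small : ∀ i l → i ℕ.+ l ℕ.< ord → S i l ≈ 0#
  S-small i zero    i<ord = powerSum-small i (subst (ℕ._< ord) (ℕ.+-identityʳ i) i<ord)
  S-small i (suc l) lt = trans (S-suc i l) (x-x≈0 (trans (S-small i l (ℕ.<-trans (ℕ.n<1+n (i ℕ.+ l)) lt′)) (sym (S-small (suc i) l lt′))))
    where
    lt′ : suc (i ℕ.+ l) ℕ.< ord
    lt′ = subst (ℕ._< ord) (ℕ.+-suc i l) lt

  S-1+ord : ∀ l → S (suc ord) l ≈ S 1 l
  S-1+ord l = S.∑-cong (λ a → *-congʳ {x = (1# - a) ^ l} (x^[1+ord] a))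
    where
    x^[1+ord] : ∀ x → x ^ suc ord ≈ x ^ 1
    x^[1+ord] x with x ≟ 0#
    ... | yes x≈0 = trans (*-congʳ x≈0) (trans (zeroˡ _) (sym (trans (*-congʳ x≈0) (zeroˡ _))))
    ... | no  x≉0 = *-congˡ (fermat x≉0)

  -- Only a^(q-1) survives the summation, with sum -1, and its coefficient in a^i (1 - a)^l is
  -- (-1)^j (l choose j) for j = q - 1 - i. The induction is Pascal's rule.
  S-binomial : ∀ l i j → l ℕ.< ord → i ℕ.+ j ≡ ord → S i l ≈ φ (⊝ (signℕ j · + (l C j)))
  S-binomial zero i zero _ eq = trans (trans (reflexive (cong (λ n → S n 0) (≡.trans (≡.sym (ℕ.+-identityʳ i)) eq))) powerSum-ord) (-‿cong (sym ν-1))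
  S-binomial zero i (suc j) _ eq = trans (powerSum-small i (subst (i ℕ.<_) eq (ℕ.m<m+n i (s≤s z≤n)))) (sym (reflexive (cong (λ z → φ (⊝ z)) (ℤ.*-zeroʳ (signℕ (suc j))))))
  -- For j = 0 the raised exponent is q; a^q = a turns it into 1, and that sum has too small a
  -- degree to contribute.
  S-binomial (suc l) i zero l<ord eq = begin
    S i (suc l)  ≈⟨ S-suc i l ⟩
    S i l - S (suc i) l  ≈⟨ +-cong (S-binomial l i 0 (ℕ.<-trans (ℕ.n<1+n l) l<ord) eq) (-‿cong vanish) ⟩
    φ (⊝ (1ℤ · + (l C 0))) - 0#  ≈⟨ trans (+-congˡ -0#≈0#) (+-identityʳ _) ⟩
    φ (⊝ (1ℤ · + (l C 0)))  ≡⟨⟩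
    φ (⊝ (1ℤ · + (suc l C 0)))  ∎
    where
    vanish : S (suc i) l ≈ 0#
    vanish = trans (reflexive (cong (λ n → S (suc n) l) (≡.trans (≡.sym (ℕ.+-identityʳ i)) eq))) (trans (S-1+ord l) (S-small 1 l l<ord))
  S-binomial (suc l) i (suc j) l<ord eq = begin
    S i (suc l)  ≈⟨ S-suc i l ⟩
    S i l - S (suc i) l  ≈⟨ +-cong (S-binomial l i (suc j) l<ord′ eq) (-‿cong (S-binomial l (suc i) j l<ord′ (≡.trans (≡.sym (ℕ.+-suc i j)) eq))) ⟩
    φ (⊝ (⊝ s · + (l C suc j))) - φ (⊝ (s · + (l C j)))  ≈⟨ +-congˡ (φ-neg (⊝ (s · + (l C j)))) ⟨
    φ (⊝ (⊝ s · + (l C suc j))) + φ (⊝ (⊝ (s · + (l C j))))  ≈⟨ φ-+ (⊝ (⊝ s · + (l C suc j))) (⊝ (⊝ (s · + (l C j)))) ⟨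
    φ (⊝ (⊝ s · + (l C suc j)) ∔ ⊝ (⊝ (s · + (l C j))))  ≡⟨ cong φ (lem s (+ (l C j)) (+ (l C suc j))) ⟩
    φ (⊝ (⊝ s · (+ (l C j) ∔ + (l C suc j))))  ≡⟨ cong (λ n → φ (⊝ (⊝ s · + n))) (nCk+nC[k+1]≡[n+1]C[k+1] l j) ⟩
    φ (⊝ (⊝ s · + (suc l C suc j)))  ∎
    where
    s = signℕ j
    l<ord′ = ℕ.<-trans (ℕ.n<1+n l) l<ord
    lem : ∀ s x y → ⊝ (⊝ s · y) ∔ ⊝ (⊝ (s · x)) ≡ ⊝ (⊝ s · (x ∔ y))
    lem = solve-∀

  φ-sum : ∀ n (t : Fin n → ℤ) → φ (sum t) ≈ S.sum (λ i → φ (t i))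
  φ-sum zero    t = refl
  φ-sum (suc n) t = trans (φ-+ (t zero) (sum (λ i → t (suc i)))) (+-congˡ (φ-sum n (λ i → t (suc i))))

  φ-sign : ∀ i → φ (signℕ i) ≈ (- 1#) ^ i
  φ-sign zero    = ν-1
  φ-sign (suc i) = trans (φ-neg (signℕ i)) (trans (-‿cong (φ-sign i)) (sym (-1*x≈-x _)))

  -- Sending i to ι is a ring homomorphism from ℤ[i] to `F`, and the tables list the powers of i.
  φ-cos+sin : ∀ ι → ι * ι ≈ - 1# → ∀ i → φ (cosℕ i) + ι * φ (sinℕ i) ≈ ι ^ i
  φ-cos+sin ι ι² zero    = trans (+-cong ν-1 (zeroʳ ι)) (+-identityʳ 1#)
  φ-cos+sin ι ι² (suc i) = begin
    φ (cosℕ (suc i)) + ι * φ (sinℕ (suc i))  ≡⟨ cong₂ (λ x y → φ x + ι * φ y) (cos-suc i) (sin-suc i) ⟩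
    φ (⊝ sinℕ i) + ι * φ (cosℕ i)  ≈⟨ +-congʳ (trans (φ-neg (sinℕ i)) (trans (sym (-1*x≈-x _)) (trans (*-congʳ (sym ι²)) (*-assoc ι ι _)))) ⟩
    ι * (ι * φ (sinℕ i)) + ι * φ (cosℕ i)  ≈⟨ +-comm _ _ ⟩
    ι * φ (cosℕ i) + ι * (ι * φ (sinℕ i))  ≈⟨ distribˡ ι _ _ ⟨
    ι * (φ (cosℕ i) + ι * φ (sinℕ i))  ≈⟨ *-congˡ (φ-cos+sin ι ι² i) ⟩
    ι * ι ^ i  ∎

  power-of-power : ∀ {x} i j → x ≈ g ^ i → (g ^ j) ^ i ≈ x ^ j
  power-of-power {x} i j x≈ = begin
    (g ^ j) ^ i  ≈⟨ ^-* g i j ⟨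
    g ^ (i ℕ.* j)  ≡⟨ cong (g ^_) (ℕ.*-comm i j) ⟩
    g ^ (j ℕ.* i)  ≈⟨ ^-* g j i ⟩
    (g ^ i) ^ j  ≈⟨ ^-cong j x≈ ⟨
    x ^ j  ∎

  φ-ρ : ∀ x → φ (ρ x) ≈ x ^ (k ℕ.* 2)
  φ-ρ x with zero-or-power x
  ... | inj₁ x≈0 = trans (reflexive (cong φ (lift-zero signℕ x≈0))) (sym (trans (^-cong (k ℕ.* 2) x≈0) (0^ (k ℕ.* 2) {{ℕ.≢-nonZero k≢0}})))
  ... | inj₂ (i , x≈) = begin
    φ (ρ x)  ≡⟨ cong φ (ρ-power i x≈) ⟩
    φ (signℕ i)  ≈⟨ φ-sign i ⟩
    (- 1#) ^ i  ≈⟨ ^-cong i g^k≈-1 ⟨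
    (g ^ (k ℕ.* 2)) ^ i  ≈⟨ power-of-power i (k ℕ.* 2) x≈ ⟩
    x ^ (k ℕ.* 2)  ∎

  -- χ(gⁿ) = iⁿ goes to (gʲ)ⁿ. The exponent j is general because both square roots of -1 are needed,
  -- and nonzero so that 0^j matches χ(0) = 0.
  φ-χ : ∀ j .{{_ : NonZero j}} → g ^ j * g ^ j ≈ - 1# → ∀ x → φ (α x) + g ^ j * φ (β x) ≈ x ^ j
  φ-χ j ι² x with zero-or-power x
  ... | inj₁ x≈0 = begin
    φ (α x) + g ^ j * φ (β x)  ≡⟨ cong₂ (λ u v → φ u + g ^ j * φ v) (lift-zero cosℕ x≈0) (lift-zero sinℕ x≈0) ⟩
    0# + g ^ j * 0#  ≈⟨ trans (+-identityˡ _) (zeroʳ (g ^ j)) ⟩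
    0#  ≈⟨ 0^ j ⟨
    0# ^ j  ≈⟨ ^-cong j x≈0 ⟨
    x ^ j  ∎
  ... | inj₂ (i , x≈) = begin
    φ (α x) + g ^ j * φ (β x)  ≡⟨ cong₂ (λ u v → φ u + g ^ j * φ v) (α-power i x≈) (β-power i x≈) ⟩
    φ (cosℕ i) + g ^ j * φ (sinℕ i)  ≈⟨ φ-cos+sin (g ^ j) ι² i ⟩
    (g ^ j) ^ i  ≈⟨ power-of-power i j x≈ ⟩
    x ^ j  ∎

  φ-jacobi : ∀ j .{{_ : NonZero j}} → g ^ j * g ^ j ≈ - 1# → φ A + g ^ j * φ B ≈ S (k ℕ.* 2) j
  φ-jacobi j ι² = begin
    φ A + g ^ j * φ B  ≈⟨ +-cong (φ-sum size (λ i → ρ (enum i) · α (1# - enum i))) (*-congˡ (φ-sum size (λ i → ρ (enum i) · β (1# - enum i)))) ⟩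
    S.∑ (λ b → φ (ρ b · α (1# - b))) + g ^ j * S.∑ (λ b → φ (ρ b · β (1# - b)))
      ≈⟨ +-congˡ (S.∑-* (g ^ j) (λ b → φ (ρ b · β (1# - b)))) ⟨
    S.∑ (λ b → φ (ρ b · α (1# - b))) + S.∑ (λ b → g ^ j * φ (ρ b · β (1# - b)))
      ≈⟨ S.∑-+ (λ b → φ (ρ b · α (1# - b))) (λ b → g ^ j * φ (ρ b · β (1# - b))) ⟨
    S.∑ (λ b → φ (ρ b · α (1# - b)) + g ^ j * φ (ρ b · β (1# - b)))  ≈⟨ S.∑-cong term ⟩
    S (k ℕ.* 2) j  ∎
    where
    term : ∀ b → φ (ρ b · α (1# - b)) + g ^ j * φ (ρ b · β (1# - b)) ≈ b ^ (k ℕ.* 2) * (1# - b) ^ j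
    term b = begin
      φ (ρ b · α (1# - b)) + g ^ j * φ (ρ b · β (1# - b))  ≈⟨ +-cong (φ-* (ρ b) (α (1# - b))) (*-congˡ (φ-* (ρ b) (β (1# - b)))) ⟩
      φ (ρ b) * φ (α (1# - b)) + g ^ j * (φ (ρ b) * φ (β (1# - b)))  ≈⟨ +-congˡ (trans (sym (*-assoc _ _ _)) (trans (*-congʳ (*-comm _ _)) (*-assoc _ _ _))) ⟩
      φ (ρ b) * φ (α (1# - b)) + φ (ρ b) * (g ^ j * φ (β (1# - b)))  ≈⟨ distribˡ (φ (ρ b)) _ _ ⟨
      φ (ρ b) * (φ (α (1# - b)) + g ^ j * φ (β (1# - b)))  ≈⟨ *-cong (φ-ρ b) (φ-χ j ι² (1# - b)) ⟩
      b ^ (k ℕ.* 2) * (1# - b) ^ j  ∎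

open import Data.Nat using (_^_; _≤_)

-- The normalised Jacobi sum modulo p.

module JacobiSum {c ℓ} (F : FiniteField c ℓ) (g : FiniteField.Carrier F) (gen : IsGenerator F g)
  (k : ℕ) (ord≡ : FiniteField.size F ℕ.∸ 1 ≡ k ℕ.* 4) (p m : ℕ) (pr : Prime p) (size≡ : FiniteField.size F ≡ p ^ m) where
  open Quartic F g gen k ord≡ renaming (_^_ to _**_)
  open Reduction F
  open Characteristic p m size≡
  open JacobiReduction F g gen k ord≡
  open SetoidReasoning setoid

  private
    k≠0 : ¬ (k ≡ 0)
    k≠0 ≡.refl = k≢0 ≡.refl

    instance
      k-nonZero : NonZero k
      k-nonZero = ℕ.≢-nonZero k≠0

      3k-nonZero : NonZero (k ℕ.* 3)
      3k-nonZero = ℕ.m*n≢0 k 3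

  -- The two square roots of -1, inverse to each other. The exponent 3 k is 3(q - 1)/4, the one in
  -- the congruence for 2 t.
  γ γ³ : Carrier
  γ  = g ** k
  γ³ = g ** (k ℕ.* 3)

  γ²≈-1 : γ * γ ≈ -1#
  γ²≈-1 = trans (sym (^-+ g k k)) (trans (reflexive (cong (g **_) (lem k))) g^k≈-1)
    where
    lem : ∀ k → k ℕ.+ k ≡ k ℕ.* 2
    lem = ℕ-Solver.solve-∀

  γ³γ≈1 : γ³ * γ ≈ 1#
  γ³γ≈1 = trans (sym (^-+ g (k ℕ.* 3) k)) (trans (reflexive (cong (g **_) (≡.trans (lem k) (≡.sym ord≡)))) g^ord≈1)
    where
    lem : ∀ k → k ℕ.* 3 ℕ.+ k ≡ k ℕ.* 4
    lem = ℕ-Solver.solve-∀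

  γ³²≈-1 : γ³ * γ³ ≈ -1#
  γ³²≈-1 = begin
    γ³ * γ³  ≈⟨ ^-+ g (k ℕ.* 3) (k ℕ.* 3) ⟨
    g ** (k ℕ.* 3 ℕ.+ k ℕ.* 3)  ≡⟨ cong (g **_) (≡.trans (lem k) (cong (ℕ._+ k ℕ.* 2) (≡.sym ord≡))) ⟩
    g ** (ord ℕ.+ k ℕ.* 2)  ≈⟨ ^-+ g ord (k ℕ.* 2) ⟩
    g ** ord * g ** (k ℕ.* 2)  ≈⟨ *-cong g^ord≈1 g^k≈-1 ⟩
    1# * -1#  ≈⟨ *-identityˡ -1# ⟩
    -1#  ∎
    where
    lem : ∀ k → k ℕ.* 3 ℕ.+ k ℕ.* 3 ≡ k ℕ.* 4 ℕ.+ k ℕ.* 2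
    lem = ℕ-Solver.solve-∀

  -- The exponents 2 k and k add up to less than q - 1 = 4 k.
  φA+γφB≈0 : φ A + γ * φ B ≈ 0#
  φA+γφB≈0 = trans (φ-jacobi k γ²≈-1) (S-small (k ℕ.* 2) k
    (subst (k ℕ.* 2 ℕ.+ k ℕ.<_) (≡.trans (lem k) (≡.sym ord≡)) (ℕ.m<m+n (k ℕ.* 2 ℕ.+ k) (ℕ.n≢0⇒n>0 k≠0))))
    where
    lem : ∀ k → k ℕ.* 2 ℕ.+ k ℕ.+ k ≡ k ℕ.* 4
    lem = ℕ-Solver.solve-∀

  φA+γ³φB : φ A + γ³ * φ B ≈ φ (⊝ (signℕ k · + ((k ℕ.+ k) C k)))
  φA+γ³φB = begin
    φ A + γ³ * φ B  ≈⟨ φ-jacobi (k ℕ.* 3) γ³²≈-1 ⟩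
    -- Exchanging the exponents makes the complement j equal to 4 k - 3 k = k, so the binomial that
    -- appears is the central one.
    S (k ℕ.* 2) (k ℕ.* 3)  ≈⟨ S-sym (k ℕ.* 2) (k ℕ.* 3) ⟩
    S (k ℕ.* 3) (k ℕ.* 2)  ≈⟨ S-binomial (k ℕ.* 2) (k ℕ.* 3) k 2k<ord (≡.trans (lem₁ k) (≡.sym ord≡)) ⟩
    φ (⊝ (signℕ k · + ((k ℕ.* 2) C k)))  ≡⟨ cong (λ n → φ (⊝ (signℕ k · + (n C k)))) (lem₂ k) ⟩
    φ (⊝ (signℕ k · + ((k ℕ.+ k) C k)))  ∎
    where
    lem₁ : ∀ k → k ℕ.* 3 ℕ.+ k ≡ k ℕ.* 4
    lem₁ = ℕ-Solver.solve-∀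
    lem₂ : ∀ k → k ℕ.* 2 ≡ k ℕ.+ k
    lem₂ = ℕ-Solver.solve-∀
    lem₃ : ∀ k → k ℕ.* 2 ℕ.+ k ℕ.* 2 ≡ k ℕ.* 4
    lem₃ = ℕ-Solver.solve-∀
    2k<ord : k ℕ.* 2 ℕ.< ord
    2k<ord = subst (k ℕ.* 2 ℕ.<_) (≡.trans (lem₃ k) (≡.sym ord≡)) (ℕ.m<m+n (k ℕ.* 2) (ℕ.n≢0⇒n>0 k≢0))

  φ-sign≉0 : ∀ i → ¬ (φ (signℕ i) ≈ 0#)
  φ-sign≉0 i eq = ^-≉0 i -1≉0 (trans (sym (φ-sign i)) eq)

  -- If A vanished in `F`, so would B by `φA+γφB≈0`, and then the binomial coefficient.
  φA≉0 : p ∤ (k ℕ.+ k) C k → ¬ (φ A ≈ 0#)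
  φA≉0 p∤C φA≈0 = *-≉0 (φ-sign≉0 k) (ν-coprime (∤⇒coprime pr p∤C)) (begin
    φ (signℕ k) * ν binom  ≈⟨ φ-* (signℕ k) (+ binom) ⟨
    φ (signℕ k · + binom)  ≈⟨ -‿involutive _ ⟨
    - (- φ (signℕ k · + binom))  ≈⟨ -‿cong (φ-neg (signℕ k · + binom)) ⟨
    - φ (⊝ (signℕ k · + binom))  ≈⟨ -‿cong (trans (sym φA+γ³φB) (trans (+-cong φA≈0 (*-congˡ φB≈0)) (trans (+-identityˡ _) (zeroʳ γ³)))) ⟩
    - 0#  ≈⟨ -0#≈0# ⟩
    0#  ∎)
    where
    binom = (k ℕ.+ k) C k
    φB≈0 : φ B ≈ 0#
    φB≈0 = x*y≈0⇒ γ (^-≉0 k g≉0) (trans (sym (trans (+-congʳ φA≈0) (+-identityˡ _))) φA+γφB≈0)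

  φB≈-γ³φA : φ B ≈ - (γ³ * φ A)
  φB≈-γ³φA = +-cancelˡ (γ³ * φ A) (φ B) (- (γ³ * φ A)) (begin
    γ³ * φ A + φ B  ≈⟨ +-congˡ (trans (*-congʳ γ³γ≈1) (*-identityˡ (φ B))) ⟨
    γ³ * φ A + γ³ * γ * φ B  ≈⟨ +-congˡ (*-assoc γ³ γ (φ B)) ⟩
    γ³ * φ A + γ³ * (γ * φ B)  ≈⟨ distribˡ γ³ (φ A) (γ * φ B) ⟨
    γ³ * (φ A + γ * φ B)  ≈⟨ *-congˡ φA+γφB≈0 ⟩
    γ³ * 0#  ≈⟨ zeroʳ γ³ ⟩
    0#  ≈⟨ -‿inverseʳ (γ³ * φ A) ⟨
    γ³ * φ A - γ³ * φ A  ∎)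

  -- a + b i is -ε times the conjugate of J, the normalisation that is compared with s + 2 t i.
  a b : ℤ
  a = ⊝ (ε · A)
  b = ε · B

  ε²≡1 : ε · ε ≡ 1ℤ
  ε²≡1 = sign² k

  a²+b²≡Q : a · a ∔ b · b ≡ Q
  a²+b²≡Q = ≡.trans (lem ε A B) (≡.trans (cong (_· (A · A ∔ B · B)) ε²≡1) (≡.trans (ℤ.*-identityˡ _) A²+B²≡Q))
    where
    lem : ∀ e A B → (⊝ (e · A)) · (⊝ (e · A)) ∔ (e · B) · (e · B) ≡ (e · e) · (A · A ∔ B · B)
    lem = solve-∀

  φa≉0 : p ∤ (k ℕ.+ k) C k → ¬ (φ a ≈ 0#)
  φa≉0 p∤C eq = *-≉0 (φ-sign≉0 k) (φA≉0 p∤C) (begin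
    φ ε * φ A  ≈⟨ φ-* ε A ⟨
    φ (ε · A)  ≈⟨ -‿involutive _ ⟨
    - (- φ (ε · A))  ≈⟨ -‿cong (φ-neg (ε · A)) ⟨
    - φ a  ≈⟨ -‿cong eq ⟩
    - 0#  ≈⟨ -0#≈0# ⟩
    0#  ∎)

  -- The congruence that `STSpec` prescribes for 2 t and s, here satisfied by b and a.
  φb≈γ³φa : φ b ≈ γ³ * φ a
  φb≈γ³φa = begin
    φ (ε · B)  ≈⟨ φ-* ε B ⟩
    φ ε * φ B  ≈⟨ *-congˡ φB≈-γ³φA ⟩
    φ ε * - (γ³ * φ A)  ≈⟨ -‿distribʳ-* (φ ε) (γ³ * φ A) ⟨
    - (φ ε * (γ³ * φ A))  ≈⟨ -‿cong (trans (sym (*-assoc _ _ _)) (trans (*-congʳ (*-comm (φ ε) γ³)) (*-assoc _ _ _))) ⟩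
    - (γ³ * (φ ε * φ A))  ≈⟨ -‿distribʳ-* γ³ (φ ε * φ A) ⟩
    γ³ * - (φ ε * φ A)  ≈⟨ *-congˡ (-‿cong (φ-* ε A)) ⟨
    γ³ * - φ (ε · A)  ≈⟨ *-congˡ (φ-neg (ε · A)) ⟨
    γ³ * φ a  ∎

  -- Both u / s and b / a reduce to γ³, so the combination reduces to 2 γ³ a s, a product of units
  -- as p is odd.
  p∤au+bs : p % 2 ≡ 1 → p ∤ (k ℕ.+ k) C k → ∀ s u → ¬ (φ s ≈ 0#) → φ u ≈ φ s * γ³ → p ∤ ∣ a · u ∔ b · s ∣
  p∤au+bs p-odd p∤C s u φs≉0 φu≈ p∣ = *-≉0 1+1≉0 (*-≉0 (^-≉0 (k ℕ.* 3) g≉0) (*-≉0 (φa≉0 p∤C) φs≉0)) (begin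
    (1# + 1#) * (γ³ * (φ a * φ s))  ≈⟨ trans (distribʳ _ 1# 1#) (+-cong (*-identityˡ _) (*-identityˡ _)) ⟩
    γ³ * (φ a * φ s) + γ³ * (φ a * φ s)  ≈⟨ +-cong first (sym (*-assoc γ³ (φ a) (φ s))) ⟩
    φ a * φ u + γ³ * φ a * φ s  ≈⟨ +-congˡ (*-congʳ (sym φb≈γ³φa)) ⟩
    φ a * φ u + φ b * φ s  ≈⟨ +-cong (φ-* a u) (φ-* b s) ⟨
    φ (a · u) + φ (b · s)  ≈⟨ φ-+ (a · u) (b · s) ⟨
    φ (a · u ∔ b · s)  ≈⟨ φ-abs (a · u ∔ b · s) (ν-divisible p∣) ⟩
    0#  ∎)
    where
    first : γ³ * (φ a * φ s) ≈ φ a * φ u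
    first = trans (*-comm γ³ (φ a * φ s)) (trans (*-assoc (φ a) (φ s) γ³) (*-congˡ (sym φu≈)))
    1+1≉0 : ¬ (1# + 1# ≈ 0#)
    1+1≉0 2≈0 = 1≉0 (begin
      1#  ≈⟨ +-identityʳ 1# ⟨
      1# + 0#  ≈⟨ +-congˡ (trans (ν-* (p / 2) 2) (trans (*-congˡ (trans (+-congˡ ν-1) 2≈0)) (zeroʳ _))) ⟨
      ν (1 ℕ.+ p / 2 ℕ.* 2)  ≡⟨ cong (λ r → ν (r ℕ.+ p / 2 ℕ.* 2)) p-odd ⟨
      ν (p % 2 ℕ.+ p / 2 ℕ.* 2)  ≡⟨ cong ν (m≡m%n+[m/n]*n p 2) ⟨
      ν p  ≈⟨ ν-p ⟩
      0#  ∎)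

-- Residues of p and powers of -p modulo 4.

odd-residue : ∀ p → p % 2 ≡ 1 → p % 4 ≡ 1 ⊎ p % 4 ≡ 3
odd-residue 0 ()
odd-residue 1 _ = inj₁ ≡.refl
odd-residue 2 ()
odd-residue 3 _ = inj₂ ≡.refl
odd-residue (suc (suc (suc (suc p)))) odd = [ (λ e → inj₁ (≡.trans (%4 p) e)) , (λ e → inj₂ (≡.trans (%4 p) e)) ]′
    (odd-residue p (≡.trans (≡.sym (%2 p)) odd))
  where
  %4 : ∀ p → suc (suc (suc (suc p))) % 4 ≡ p % 4
  %4 p = ≡.trans (cong (_% 4) (ℕ.+-comm 4 p)) ([m+kn]%n≡m%n p 1 4)
  %2 : ∀ p → suc (suc (suc (suc p))) % 2 ≡ p % 2
  %2 p = ≡.trans (cong (_% 2) (ℕ.+-comm 4 p)) ([m+kn]%n≡m%n p 2 2)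

3mod4-even-exponent : ∀ {p} → p % 4 ≡ 3 → ∀ m → p ^ m % 4 ≡ 1 → m ≡ m / 2 ℕ.* 2
3mod4-even-exponent {p} p%4≡3 m q%4≡1 = go (m % 2) (m≡m%n+[m/n]*n m 2) (m%n<n m 2)
  where
  p²ʲ : ∀ j → p ^ (j ℕ.* 2) % 4 ≡ 1
  p²ʲ zero    = ≡.refl
  p²ʲ (suc j) = begin
    p ℕ.* (p ℕ.* p ^ (j ℕ.* 2)) % 4  ≡⟨ %-distribˡ-* p _ 4 ⟩
    (p % 4) ℕ.* (p ℕ.* p ^ (j ℕ.* 2) % 4) % 4  ≡⟨ cong₂ (λ x y → x ℕ.* y % 4) p%4≡3 (≡.trans (%-distribˡ-* p (p ^ (j ℕ.* 2)) 4) (cong₂ (λ x y → x ℕ.* y % 4) p%4≡3 (p²ʲ j))) ⟩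
    1  ∎
    where
    open ≡-Reasoning
  go : ∀ r → m ≡ r ℕ.+ m / 2 ℕ.* 2 → r ℕ.< 2 → m ≡ m / 2 ℕ.* 2
  go 0 eq _ = eq
  go 1 eq _ = ⊥-elim (3≢1 (≡.trans (≡.sym (≡.trans (%-distribˡ-* p (p ^ (m / 2 ℕ.* 2)) 4) (cong₂ (λ x y → x ℕ.* y % 4) p%4≡3 (p²ʲ (m / 2))))) (≡.trans (cong (λ n → p ^ n % 4) (≡.sym eq)) q%4≡1)))
    where
    3≢1 : ¬ (3 ≡ 1)
    3≢1 ()
  go (suc (suc r)) _ (s≤s (s≤s ()))

-- -p is 1 modulo 4: this is what the sign in s = (-p)^(m/2) is for.
[-p]^j-mod-4 : ∀ {p} → p % 4 ≡ 3 → ∀ j → ∃ λ w → (⊝ (+ p)) ℤ.^ j ≡ 1ℤ ∔ + 4 · w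
[-p]^j-mod-4 {p} p%4≡3 zero    = 0ℤ , ≡.refl
[-p]^j-mod-4 {p} p%4≡3 (suc j) with [-p]^j-mod-4 {p} p%4≡3 j
... | w , eq = w ⊟ (1ℤ ∔ + d) · (1ℤ ∔ + 4 · w) , (begin
    (⊝ + p) · (⊝ (+ p)) ℤ.^ j  ≡⟨ cong₂ (λ x y → (⊝ x) · y) p≡ eq ⟩
    (⊝ (+ 3 ∔ + d · + 4)) · (1ℤ ∔ + 4 · w)  ≡⟨ lem (+ d) w ⟩
    1ℤ ∔ + 4 · (w ⊟ (1ℤ ∔ + d) · (1ℤ ∔ + 4 · w))  ∎)
  where
  open ≡-Reasoning
  d = p / 4
  p≡ : + p ≡ + 3 ∔ + d · + 4
  p≡ = ≡.trans (cong +_ (≡.trans (m≡m%n+[m/n]*n p 4) (cong (ℕ._+ d ℕ.* 4) p%4≡3))) (cong (_∔_ (+ 3)) (ℤ.pos-* d 4))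
  lem : ∀ d w → (⊝ (+ 3 ∔ d · + 4)) · (1ℤ ∔ + 4 · w) ≡ 1ℤ ∔ + 4 · (w ⊟ (1ℤ ∔ d) · (1ℤ ∔ + 4 · w))
  lem = solve-∀

[-p]^j-square : ∀ p j → (⊝ (+ p)) ℤ.^ j · (⊝ (+ p)) ℤ.^ j ≡ + (p ^ (j ℕ.* 2))
[-p]^j-square p zero    = ≡.refl
[-p]^j-square p (suc j) = begin
  ((⊝ + p) · x) · ((⊝ + p) · x)  ≡⟨ lem (+ p) x ⟩
  + p · (+ p · (x · x))  ≡⟨ cong (λ y → + p · (+ p · y)) ([-p]^j-square p j) ⟩
  + p · (+ p · + (p ^ (j ℕ.* 2)))  ≡⟨ cong (+ p ·_) (ℤ.pos-* p (p ^ (j ℕ.* 2))) ⟨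
  + p · + (p ℕ.* p ^ (j ℕ.* 2))  ≡⟨ ℤ.pos-* p (p ℕ.* p ^ (j ℕ.* 2)) ⟨
  + (p ℕ.* (p ℕ.* p ^ (j ℕ.* 2)))  ∎
  where
  open ≡-Reasoning
  x = (⊝ (+ p)) ℤ.^ j
  lem : ∀ p x → ((⊝ p) · x) · ((⊝ p) · x) ≡ p · (p · (x · x))
  lem = solve-∀

-- The case q ≡ 1 (mod 4).

module Case1mod4 {c ℓ} (F : FiniteField c ℓ) (p m : ℕ) (pr : Prime p) (p-odd : p % 2 ≡ 1) (size≡ : FiniteField.size F ≡ p ^ m)
  (g : FiniteField.Carrier F) (gen : IsGenerator F g) (k : ℕ) (q≡ : p ^ m ≡ 1 ℕ.+ k ℕ.* 4) where

  ord≡4k : FiniteField.size F ℕ.∸ 1 ≡ k ℕ.* 4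
  ord≡4k = cong (ℕ._∸ 1) (≡.trans size≡ q≡)

  open Quartic F g gen k ord≡4k renaming (_^_ to _**_)
  open Reduction F
  open Characteristic p m size≡
  open JacobiSum F g gen k ord≡4k p m pr size≡
  open ≡-Reasoning

  Q≡p^m : Q ≡ + (p ^ m)
  Q≡p^m = cong +_ size≡

  -- `z` witnesses that a is 1 modulo 4; the two residues of q modulo 8 supply it in different ways.
  module Coefficients (z : ℤ) (a≡ : a ≡ 1ℤ ∔ + 4 · z) (s t : ℤ) (spec : STSpec F p m g s t) where

    private
      lem₀ : ∀ s t → s · s ∔ + 2 · t · (+ 2 · t) ≡ s · s ∔ + 4 · (t · t)
      lem₀ = solve-∀

      mod-4-decomposition : ∀ {k p} → p % 4 ≡ k → p ≡ k ℕ.+ p / 4 ℕ.* 4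
      mod-4-decomposition {k} {p} eq = ≡.trans (m≡m%n+[m/n]*n p 4) (cong (ℕ._+ p / 4 ℕ.* 4) eq)

    -- (a, b) and (s, 2 t) both represent q, start with an entry that is 1 modulo 4, and have the
    -- same ratio in `F`, where s is a unit.
    identify-1 : p % 4 ≡ 1 → a ≡ s × b ≡ + 2 · t
    identify-1 p%4≡1 with proj₁ spec p%4≡1
    ... | norm≡ , gcd≡1 , 4∣s-1 , 2t≈ with Signed.∣ᵤ⇒∣ {+ 4} {s ⊟ 1ℤ} 4∣s-1
    ... | Signed.divides w s-1≡ = two-squares-unique pr m z w a≡ s≡ (≡.trans a²+b²≡Q Q≡p^m) (≡.trans (lem₀ s t) (≡.sym norm≡))
      (p∤au+bs p-odd (p∤centralBinomial pr (p / 4) (mod-4-decomposition p%4≡1) m k q≡) s (+ 2 · t)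
        (λ φs≈0 → ν-coprime (gcd≡1⇒coprime gcd≡1) (ν-abs s φs≈0))
        (trans 2t≈ (*-congˡ (reflexive (cong (g **_) exponent≡)))))
      where
      lem₁ : ∀ s → s ≡ 1ℤ ∔ (s ⊟ 1ℤ)
      lem₁ = solve-∀
      s≡ : s ≡ 1ℤ ∔ + 4 · w
      s≡ = ≡.trans (lem₁ s) (cong (_∔_ 1ℤ) (≡.trans s-1≡ (ℤ.*-comm w (+ 4))))
      lem₂ : ∀ k → 3 ℕ.* (k ℕ.* 4) ≡ k ℕ.* 3 ℕ.* 4
      lem₂ = ℕ-Solver.solve-∀
      exponent≡ : 3 ℕ.* (p ^ m ℕ.∸ 1) / 4 ≡ k ℕ.* 3
      exponent≡ = ≡.trans (cong (_/ 4) (≡.trans (cong (λ n → 3 ℕ.* (n ℕ.∸ 1)) q≡) (lem₂ k))) (m*n/n≡m (k ℕ.* 3) 4)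

    -- q is an even power of the inert prime p, so a or b is 0. As a is 1 modulo 4 it must be b, and
    -- the residue picks the sign of a.
    identify-3 : p % 4 ≡ 3 → a ≡ s × b ≡ + 2 · t
    identify-3 p%4≡3 with proj₂ spec p%4≡3
    ... | s≡ , t≡0 = 1mod4-square-injective z (proj₁ s-mod-4) a≡ (≡.trans s≡ (proj₂ s-mod-4)) a²≡s² ,
        ≡.trans b≡0 (cong (+ 2 ·_) (≡.sym t≡0))
      where
      j = m / 2
      m≡2j : m ≡ j ℕ.* 2
      m≡2j = 3mod4-even-exponent {p} p%4≡3 m (≡.trans (cong (_% 4) q≡) ([m+kn]%n≡m%n 1 k 4))
      s-mod-4 = [-p]^j-mod-4 {p} p%4≡3 j
      a≢0 : ¬ (a ≡ 0ℤ)
      a≢0 a≡0 = 1+4y≢0 z (≡.trans (≡.sym a≡) a≡0)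
      b≡0 : b ≡ 0ℤ
      b≡0 = [ (λ e → ⊥-elim (a≢0 (ℤ.∣i∣≡0⇒i≡0 e))) , ℤ.∣i∣≡0⇒i≡0 ]′ (p^2j-two-squares pr p%4≡3 j ∣ a ∣ ∣ b ∣
        (ℤ.+-injective (≡.trans (cong₂ _∔_ (≡.sym (abs-square a)) (≡.sym (abs-square b)))
          (≡.trans a²+b²≡Q (≡.trans Q≡p^m (cong (λ n → + (p ^ n)) m≡2j))))))
      a²≡s² : a · a ≡ s · s
      a²≡s² = begin
        a · a  ≡⟨ ℤ.+-identityʳ (a · a) ⟨
        a · a ∔ 0ℤ · 0ℤ  ≡⟨ cong (λ x → a · a ∔ x · x) b≡0 ⟨
        a · a ∔ b · b  ≡⟨ ≡.trans a²+b²≡Q (≡.trans Q≡p^m (cong (λ n → + (p ^ n)) m≡2j)) ⟩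
        + (p ^ (j ℕ.* 2))  ≡⟨ [-p]^j-square p j ⟨
        (⊝ + p) ℤ.^ j · (⊝ + p) ℤ.^ j  ≡⟨ cong (λ x → x · x) s≡ ⟨
        s · s  ∎

    identify : a ≡ s × b ≡ + 2 · t
    identify = [ identify-1 , identify-3 ]′ (odd-residue p p-odd)

    Q≡norm : Q ≡ norm-ℤ s t
    Q≡norm = ≡.trans (≡.sym a²+b²≡Q) (≡.trans (cong₂ (λ x y → x · x ∔ y · y) (proj₁ identify) (proj₂ identify)) (lem₀ s t))

    A≡ : A ≡ ⊝ (ε · s)
    A≡ = begin
      A  ≡⟨ ≡.trans (cong (_· A) ε²≡1) (ℤ.*-identityˡ A) ⟨
      ε · ε · A  ≡⟨ lem ε A ⟩
      ⊝ (ε · a)  ≡⟨ cong (λ x → ⊝ (ε · x)) (proj₁ identify) ⟩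
      ⊝ (ε · s)  ∎
      where
      lem : ∀ e A → e · e · A ≡ ⊝ (e · (⊝ (e · A)))
      lem = solve-∀

    B≡ : B ≡ ε · (+ 2 · t)
    B≡ = begin
      B  ≡⟨ ≡.trans (cong (_· B) ε²≡1) (ℤ.*-identityˡ B) ⟨
      ε · ε · B  ≡⟨ ℤ.*-assoc ε ε B ⟩
      ε · b  ≡⟨ cong (ε ·_) (proj₂ identify) ⟩
      ε · (+ 2 · t)  ∎

    stepJ≡step : ∀ v → stepJ v ≡ step ε Q s t v
    stepJ≡step ⟨ e , r , x , y ⟩ = cong₃ (λ u v w → ⟨ r ∔ ε · x , u , v , w ⟩)
      (begin
        Q · e ∔ ε · A · x ∔ b · y  ≡⟨ lem₁ (Q · e) (ε · A) x (b · y) ⟩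
        Q · e ⊟ a · x ∔ b · y  ≡⟨ cong₂ (λ u v → Q · e ⊟ u · x ∔ v · y) (proj₁ identify) (proj₂ identify) ⟩
        Q · e ⊟ s · x ∔ + 2 · t · y  ∎)
      (≡.trans (cong₂ (λ A B → + 2 · Q · e ∔ + 2 · A · r ∔ A · x ∔ B · y) A≡ B≡) (lem₂ ε Q s t e r x y))
      (≡.trans (cong₂ (λ A B → + 2 · B · r ∔ B · x ⊟ A · y) A≡ B≡) (lem₃ ε s t r x y))
      where
      cong₃ : ∀ {X : Set} (f : ℤ → ℤ → ℤ → X) {u u′ v v′ w w′} → u ≡ u′ → v ≡ v′ → w ≡ w′ → f u v w ≡ f u′ v′ w′
      cong₃ f ≡.refl ≡.refl ≡.refl = ≡.refl
      lem₁ : ∀ u v x w → u ∔ v · x ∔ w ≡ u ⊟ (⊝ v) · x ∔ w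
      lem₁ = solve-∀
      lem₂ : ∀ ε Q s t e r x y → + 2 · Q · e ∔ + 2 · (⊝ (ε · s)) · r ∔ (⊝ (ε · s)) · x ∔ (ε · (+ 2 · t)) · y
        ≡ + 2 · Q · e ⊟ + 2 · ε · s · r ⊟ ε · s · x ∔ + 2 · ε · t · y
      lem₂ = solve-∀
      lem₃ : ∀ ε s t r x y → + 2 · (ε · (+ 2 · t)) · r ∔ (ε · (+ 2 · t)) · x ⊟ (⊝ (ε · s)) · y
        ≡ + 4 · ε · t · r ∔ + 2 · ε · t · x ∔ ε · s · y
      lem₃ = solve-∀

    coordsJ≡coords : ∀ n → coordsJ n ≡ coords ε Q s t n
    coordsJ≡coords zero    = ≡.refl
    coordsJ≡coords (suc n) = ≡.trans (stepJ≡step (coordsJ n)) (cong (step ε Q s t) (coordsJ≡coords n))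

  -- The search succeeds because a match lies within its range; for `ind` that match is
  -- `exponent x`.
  indFrom-spec : ∀ x i n j → j ℕ.< n → g ** (i ℕ.+ j) ≈ x → g ** indFrom F g x i n ≈ x
  indFrom-spec x i (suc n) j j<n eq with (g ** i) ≟ x
  ... | yes found = found
  ... | no  ¬eq with j
  ...   | zero  = ⊥-elim (¬eq (trans (reflexive (cong (g **_) (≡.sym (ℕ.+-identityʳ i)))) eq))
  ...   | suc j′ = indFrom-spec x (suc i) n j′ (ℕ.≤-pred j<n) (trans (reflexive (cong (g **_) (≡.sym (ℕ.+-suc i j′)))) eq)

  g^ind : ∀ {x} → ¬ (x ≈ 0#) → g ** ind F g x ≈ x
  g^ind {x} x≉0 = indFrom-spec x 0 ord (exponent x) (exponent<ord x) (g^exponent x≉0)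

  value-mod-4 : ∀ i v → value i v ≡ value (i % 4) v
  value-mod-4 i ⟨ e , r , x , y ⟩ = ≡.trans
    (cong₂ (λ u v → ⊝ e ∔ u · r ∔ v · x ∔ sinℕ i · y) (reduce signℕ sign-4*k) (reduce cosℕ cos-4*k))
    (cong (λ w → ⊝ e ∔ signℕ (i % 4) · r ∔ cosℕ (i % 4) · x ∔ w · y) (reduce sinℕ sin-4*k))
    where
    sign-4*k : ∀ j n → signℕ (j ℕ.* 4 ℕ.+ n) ≡ signℕ n
    sign-4*k j n = ≡.trans (cong (λ l → signℕ (l ℕ.+ n)) (≡.sym (ℕ.*-assoc j 2 2))) (sign-2*k (j ℕ.* 2) n)
    reduce : ∀ (f : ℕ → ℤ) → (∀ j n → f (j ℕ.* 4 ℕ.+ n) ≡ f n) → f i ≡ f (i % 4)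
    reduce f per = ≡.trans (cong f (≡.trans (m≡m%n+[m/n]*n i 4) (ℕ.+-comm (i % 4) (i / 4 ℕ.* 4)))) (per (i / 4) (i % 4))

  genSeries≡ : ∀ {x} → ¬ (x ≈ 0#) → ∀ n → genSeries F x n ≡ geomPart Q n ∔ shift (λ n → value (ind F g x % 4) (coordsJ n)) n
  genSeries≡ {x} x≉0 n = ≡.trans (split n) (cong (_∔ shift (λ n → value (ind F g x % 4) (coordsJ n)) n) (geomPart-suc Q n))
    where
    split : ∀ n → genSeries F x n ≡ shift (Q ℤ.^_) n ∔ shift (λ n → value (ind F g x % 4) (coordsJ n)) n
    split zero    = ≡.refl
    split (suc n) = ≡.trans (N-formula-quartic n x) (cong (_∔_ (Q ℤ.^ n))
      (≡.trans (comb-power (coordsJ n) (ind F g x) (sym (g^ind x≉0))) (value-mod-4 (ind F g x) (coordsJ n))))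

  shift-cong : ∀ {f f′ : Series} → f ≗ f′ → shift f ≗ shift f′
  shift-cong eq zero    = ≡.refl
  shift-cong eq (suc n) = eq n

  module _ (s t : ℤ) (spec : STSpec F p m g s t) {x : Carrier} (x≉0 : ¬ (x ≈ 0#)) where

    -- `rest` takes q as an argument because the fractions are established for `norm-ℤ s t` and
    -- stated for p^m.
    conclude : ∀ ε′ → ε ≡ ε′ → (z : ℤ) → a ≡ 1ℤ ∔ + 4 · z → (rest : ℤ → Series) →
      (shift (λ n → value (ind F g x % 4) (coords ε′ (norm-ℤ s t) s t n)) ≗ rest (norm-ℤ s t)) →
      genSeries F x ≗ geomPart (+ (p ^ m)) ⊕ rest (+ (p ^ m))
    conclude ε′ ε≡ z a≡ rest rational n = begin
      genSeries F x n  ≡⟨ genSeries≡ x≉0 n ⟩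
      geomPart Q n ∔ shift (λ n → value i (coordsJ n)) n  ≡⟨ cong (_∔_ (geomPart Q n)) (shift-cong (λ n → cong (value i) (coordsJ≡coords n)) n) ⟩
      geomPart Q n ∔ shift (λ n → value i (coords ε Q s t n)) n  ≡⟨ cong₂ (λ e q → geomPart Q n ∔ shift (λ n → value i (coords e q s t n)) n) ε≡ Q≡norm ⟩
      geomPart Q n ∔ shift (λ n → value i (coords ε′ (norm-ℤ s t) s t n)) n  ≡⟨ cong (_∔_ (geomPart Q n)) (rational n) ⟩
      geomPart Q n ∔ rest (norm-ℤ s t) n  ≡⟨ cong (λ q → geomPart Q n ∔ rest q n) Q≡norm ⟨
      geomPart Q n ∔ rest Q n  ≡⟨ cong (λ q → geomPart q n ∔ rest q n) Q≡p^m ⟩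
      geomPart (+ (p ^ m)) n ∔ rest (+ (p ^ m)) n  ∎
      where
      open Coefficients z a≡ s t spec
      i = ind F g x % 4

    theorem-1mod8 : p ^ m % 8 ≡ 1 → genSeries F x ≗ series1mod8 (ind F g x % 4) (+ (p ^ m)) s t
    -- q = 8 j + 1 gives k = 2 j, hence ε = 1. The witness is (a - 1)/4 from 2 a = -2 A = 3 + 16 K -
    -- q.
    theorem-1mod8 q%8≡1 = conclude 1ℤ ε≡1 (+ 2 · K ⊟ + j) a≡
      (λ q → numer₁ (ind F g x % 4) q s t ⁄ (1ℤ ∷ denom₁ q s)) (rational₁ (ind F g x % 4) s t (m%n<n (ind F g x) 4))
      where
      j = p ^ m / 8
      q≡8j+1 : p ^ m ≡ 1 ℕ.+ j ℕ.* 8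
      q≡8j+1 = ≡.trans (m≡m%n+[m/n]*n (p ^ m) 8) (cong (ℕ._+ j ℕ.* 8) q%8≡1)
      k≡ : k ≡ j ℕ.* 2
      k≡ = ℕ.*-cancelʳ-≡ k (j ℕ.* 2) 4 (≡.trans (ℕ.suc-injective (≡.trans (≡.sym q≡) q≡8j+1)) (≡.sym (ℕ.*-assoc j 2 4)))
      ε≡1 : ε ≡ 1ℤ
      ε≡1 = ≡.trans (cong signℕ (≡.trans k≡ (≡.sym (ℕ.+-identityʳ (j ℕ.* 2))))) (sign-2*k j 0)
      K = proj₁ (A-mod-8-when-ε≡1 ε≡1)
      lem₁ : ∀ A → + 2 · ⊝ (1ℤ · A) ≡ + 3 ⊟ (+ 3 ∔ + 2 · A)
      lem₁ = solve-∀
      lem₂ : ∀ A K → + 3 ⊟ (+ 3 ∔ + 2 · A) ≡ + 3 ∔ + 16 · K ⊟ (+ 16 · K ∔ + 3 ∔ + 2 · A)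
      lem₂ = solve-∀
      lem₃ : ∀ K j → + 3 ∔ + 16 · K ⊟ (1ℤ ∔ j · + 8) ≡ + 2 · (1ℤ ∔ + 4 · (+ 2 · K ⊟ j))
      lem₃ = solve-∀
      a≡ : a ≡ 1ℤ ∔ + 4 · (+ 2 · K ⊟ + j)
      a≡ = ℤ.*-cancelˡ-≡ (+ 2) a (1ℤ ∔ + 4 · (+ 2 · K ⊟ + j)) (begin
        + 2 · ⊝ (ε · A)  ≡⟨ cong (λ e → + 2 · ⊝ (e · A)) ε≡1 ⟩
        + 2 · ⊝ (1ℤ · A)  ≡⟨ ≡.trans (lem₁ A) (lem₂ A K) ⟩
        + 3 ∔ + 16 · K ⊟ (+ 16 · K ∔ + 3 ∔ + 2 · A)  ≡⟨ cong (_⊟_ (+ 3 ∔ + 16 · K)) (proj₂ (A-mod-8-when-ε≡1 ε≡1)) ⟨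
        + 3 ∔ + 16 · K ⊟ Q  ≡⟨ cong (_⊟_ (+ 3 ∔ + 16 · K)) (≡.trans Q≡p^m (≡.trans (cong +_ q≡8j+1) (cong (_∔_ 1ℤ) (ℤ.pos-* j 8)))) ⟩
        + 3 ∔ + 16 · K ⊟ (1ℤ ∔ + j · + 8)  ≡⟨ lem₃ K (+ j) ⟩
        + 2 · (1ℤ ∔ + 4 · (+ 2 · K ⊟ + j))  ∎)

    theorem-5mod8 : p ^ m % 8 ≡ 5 → genSeries F x ≗ series5mod8 (ind F g x % 4) (+ (p ^ m)) s t
    -- q = 8 j + 5 makes k odd, hence ε = -1 and a = A. The witness is (a - 1)/4 from 2 a = 16 K + 7
    -- - q.
    theorem-5mod8 q%8≡5 = conclude -1ℤ ε≡-1 (+ 2 · K ⊟ + j) a≡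
      (λ q → numer₂ (ind F g x % 4) q s t ⁄ (1ℤ ∷ denom₂ q s)) (rational₂ (ind F g x % 4) s t (m%n<n (ind F g x) 4))
      where
      j = p ^ m / 8
      q≡8j+5 : p ^ m ≡ 5 ℕ.+ j ℕ.* 8
      q≡8j+5 = ≡.trans (m≡m%n+[m/n]*n (p ^ m) 8) (cong (ℕ._+ j ℕ.* 8) q%8≡5)
      lem₀ : ∀ j → 4 ℕ.+ j ℕ.* 8 ≡ (1 ℕ.+ j ℕ.* 2) ℕ.* 4
      lem₀ = ℕ-Solver.solve-∀
      k≡ : k ≡ 1 ℕ.+ j ℕ.* 2
      k≡ = ℕ.*-cancelʳ-≡ k (1 ℕ.+ j ℕ.* 2) 4 (≡.trans (ℕ.suc-injective (≡.trans (≡.sym q≡) q≡8j+5)) (lem₀ j))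
      ε≡-1 : ε ≡ -1ℤ
      ε≡-1 = ≡.trans (cong signℕ k≡) (cong ⊝_ (≡.trans (cong signℕ (≡.sym (ℕ.+-identityʳ (j ℕ.* 2)))) (sign-2*k j 0)))
      K = proj₁ (A-mod-8-when-ε≡-1 ε≡-1)
      lem₁ : ∀ Q A → + 2 · ⊝ (-1ℤ · A) ≡ (Q ∔ + 2 · A) ⊟ Q
      lem₁ = solve-∀
      lem₂ : ∀ K j → (+ 16 · K ∔ + 7) ⊟ (+ 5 ∔ j · + 8) ≡ + 2 · (1ℤ ∔ + 4 · (+ 2 · K ⊟ j))
      lem₂ = solve-∀
      a≡ : a ≡ 1ℤ ∔ + 4 · (+ 2 · K ⊟ + j)
      a≡ = ℤ.*-cancelˡ-≡ (+ 2) a (1ℤ ∔ + 4 · (+ 2 · K ⊟ + j)) (begin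
        + 2 · ⊝ (ε · A)  ≡⟨ cong (λ e → + 2 · ⊝ (e · A)) ε≡-1 ⟩
        + 2 · ⊝ (-1ℤ · A)  ≡⟨ lem₁ Q A ⟩
        (Q ∔ + 2 · A) ⊟ Q  ≡⟨ cong₂ _⊟_ (proj₂ (A-mod-8-when-ε≡-1 ε≡-1)) (≡.trans Q≡p^m (≡.trans (cong +_ q≡8j+5) (cong (_∔_ (+ 5)) (ℤ.pos-* j 8)))) ⟩
        (+ 16 · K ∔ + 7) ⊟ (+ 5 ∔ + j · + 8)  ≡⟨ lem₂ K (+ j) ⟩
        + 2 · (1ℤ ∔ + 4 · (+ 2 · K ⊟ + j))  ∎)

open import Data.Integer using (-_; _-_)

theorem1p1 : ∀ {c ℓ} (F : FiniteField c ℓ) (p m : ℕ) → Prime p → p % 2 ≡ 1 → 1 ≤ m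
  → FiniteField.size F ≡ p ^ m
  → (g : FiniteField.Carrier F) → IsGenerator F g
  → (x : FiniteField.Carrier F)
  → ((p ^ m % 4 ≡ 1) → ¬ (FiniteField._≈_ F x (FiniteField.0# F))
      → (s t : ℤ) → STSpec F p m g s t
      → ((p ^ m % 8 ≡ 1) → genSeries F x ≗ series1mod8 (ind F g x % 4) (+ (p ^ m)) s t)
      × ((p ^ m % 8 ≡ 5) → genSeries F x ≗ series5mod8 (ind F g x % 4) (+ (p ^ m)) s t))
  × ((p ^ m % 4 ≡ 3)
      → (FiniteField._≈_ F x (FiniteField.0# F)
          → genSeries F x ≗ series3mod4 (+ (p ^ m)) (+ 0) (+ 1 - + (p ^ m)))
      × (¬ (FiniteField._≈_ F x (FiniteField.0# F)) → IsSquare F x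
          → genSeries F x ≗ series3mod4 (+ (p ^ m)) (+ 1) (+ 1))
      × (¬ IsSquare F x → genSeries F x ≗ series3mod4 (+ (p ^ m)) (- + 1) (+ 1)))
theorem1p1 F p m pr p-odd 1≤m size≡ g gen x = case-1 , case-3
  where
  residue : ∀ {r} → p ^ m % 4 ≡ r → p ^ m ≡ r ℕ.+ p ^ m / 4 ℕ.* 4
  residue eq = ≡.trans (m≡m%n+[m/n]*n (p ^ m) 4) (cong (ℕ._+ p ^ m / 4 ℕ.* 4) eq)

  case-1 : _
  case-1 q%4≡1 x≉0 s t spec = theorem-1mod8 s t spec x≉0 , theorem-5mod8 s t spec x≉0
    where
    open Case1mod4 F p m pr p-odd size≡ g gen (p ^ m / 4) (residue q%4≡1)

  case-3 : _
  case-3 q%4≡3 =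
    (λ x≈0 → series (+ 0) (+ 1 ⊟ + (p ^ m)) (lift-zero signℕ x≈0) (≡.trans (-E-zero x≈0) (cong (_⊟_ 1ℤ) (cong +_ size≡)))) ,
    (λ x≉0 sq → series (+ 1) (+ 1) (ρ-square x≉0 sq) (-E-nonzero x≉0)) ,
    (λ nsq → series (⊝ + 1) (+ 1) (ρ-nonsquare nsq) (-E-nonzero (λ x≈0 → nsq (0# , trans (zeroˡ 0#) (sym x≈0)))))
    where
    -- q = 4 d + 3 gives q - 1 = 2 (2 d + 1); the odd half is what makes ρ(-1) = -1.
    lem : ∀ d → 2 ℕ.+ d ℕ.* 4 ≡ (1 ℕ.+ d ℕ.* 2) ℕ.* 2
    lem = ℕ-Solver.solve-∀
    ord≡ : FiniteField.size F ℕ.∸ 1 ≡ (1 ℕ.+ p ^ m / 4 ℕ.* 2) ℕ.* 2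
    ord≡ = ≡.trans (cong (ℕ._∸ 1) (≡.trans size≡ (residue q%4≡3))) (lem (p ^ m / 4))
    open Case3mod4 F g gen (p ^ m / 4) ord≡
    open Quadratic F g gen (1 ℕ.+ p ^ m / 4 ℕ.* 2) ord≡ hiding (_^_)
    series : ∀ u v → ρ x ≡ u → ⊝ E x ≡ v → genSeries F x ≗ series3mod4 (+ (p ^ m)) u v
    series u v ρ≡ E≡ = subst (λ n → genSeries F x ≗ series3mod4 (+ n) u v) size≡ (genSeries-3mod4 x u v ρ≡ E≡)
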